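{- For every fixed choice of a real number $\epsilon>0$ and an integer $r\ge 2$, there exists an algorithm $\mathcal{A}'(\epsilon,r)$ that takes as input an $r$-uniform bipartite hypergraph $H=(A,B,E)$, runs in polynomial time, and terminates after finding either (i) a perfect matching in $H$, or (ii) a set $S\subseteq A$ such that $\tau(E_S)\le (2r-3+\epsilon)(|S|-1)$.
   Context: An $r$-uniform bipartite hypergraph $H=(A,B,E)$ is a (finite) hypergraph whose vertex set is partitioned into two sets $A$ and $B$ such that every edge $e\in E$ satisfies $|e\cap A|=1$ and $|e\cap B|=r-1$. The bipartition $(A,B)$ is given to the algorithm as part of the input. A perfect matching in $H$ is a collection of pairwise disjoint edges such that every vertex of $A$ is contained in exactly one edge of the collection (vertices of $B$ need not be covered). For $S\subseteq A$, $E_S:=\{e\in E : |e\cap S|=1\}$ is the set of edges incident to $S$. For $F\subseteq E$, $\tau(F)$ is the smallest cardinality of a subset of $B$ that hits all edges of $F$, where $R\subseteq B$ hits $F$ if $R\cap e\ne\emptyset$ for every $e\in F$. The running time is polynomial in the size of the input for each fixed pair $(\epsilon,r)$; the polynomial may depend on $\epsilon$ and $r$. -}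

module Defs where

open import Data.Bool.Base using (Bool; true; false)
open import Data.Fin.Subset
  using (Subset; _∈_; _⊆_; _∩_; ∁; ∣_∣; Nonempty; Empty)
open import Data.Integer.Base as ℤ using (ℤ; +_)
open import Data.List.Base as List using (List; []; _∷_)
open import Data.List.Membership.Propositional using () renaming (_∈_ to _∈ˡ_)
open import Data.List.Relation.Unary.All using (All; []; _∷_; lookup)
open import Data.List.Relation.Unary.AllPairs using (AllPairs)
open import Data.List.Relation.Unary.Unique.Propositional using (Unique)
open import Data.Nat.Base as ℕ using (ℕ; suc; _⊔_)
import Data.Nat.Properties as ℕₚ
open import Data.Product.Base using (Σ-syntax; ∃-syntax; _×_; _,_)
open import Data.Product using (∃!)
open import Data.Rational.Base as ℚ using (ℚ; 0ℚ; 1ℚ; ½)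
import Data.Rational.Properties as ℚₚ
open import Data.Rational.Solver using (module +-*-Solver)
open import Data.Sum.Base using (_⊎_; inj₁; inj₂)
open import Data.Unit.Base using (⊤; tt)
import Data.Vec.Base as Vec
open import Relation.Binary.PropositionalEquality
  using (_≡_; refl; sym; trans; cong; subst)

------------------------------------------------------------------------
-- Real numbers, as Cauchy sequences of rationals

record ℝ : Set where
  field
    seq    : ℕ → ℚ
    cauchy : ∀ δ → 0ℚ ℚ.< δ →
             ∃[ N ] (∀ m n → N ℕ.≤ m → N ℕ.≤ n → ℚ.∣ seq m ℚ.- seq n ∣ ℚ.< δ)
open ℝ public

infix  4 _<ᵣ_ _≤ᵣ_
infixl 6 _+ᵣ_
infixl 7 _·ᵣ_

_<ᵣ_ : ℝ → ℝ → Set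
x <ᵣ y = Σ[ δ ∈ ℚ ] 0ℚ ℚ.< δ × ∃[ N ] (∀ n → N ℕ.≤ n → seq x n ℚ.+ δ ℚ.≤ seq y n)

_≤ᵣ_ : ℝ → ℝ → Set
x ≤ᵣ y = ∀ δ → 0ℚ ℚ.< δ → ∃[ N ] (∀ n → N ℕ.≤ n → seq x n ℚ.≤ seq y n ℚ.+ δ)

fromℚ : ℚ → ℝ
fromℚ q .seq    _      = q
fromℚ q .cauchy δ 0<δ = 0 , λ _ _ _ _ →
  subst (ℚ._< δ) (sym (cong ℚ.∣_∣ (ℚₚ.+-inverseʳ q))) 0<δ

fromℤ : ℤ → ℝ
fromℤ i = fromℚ (i ℚ./ 1)

fromℕ : ℕ → ℝ
fromℕ n = fromℤ (+ n)

_+ᵣ_ : ℝ → ℝ → ℝ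
(x +ᵣ y) .seq    n      = seq x n ℚ.+ seq y n
(x +ᵣ y) .cauchy δ 0<δ =
  let h        = ½ ℚ.* δ
      0<h      = subst (ℚ._< h) (ℚₚ.*-zeroʳ ½) (ℚₚ.*-monoʳ-<-pos ½ 0<δ)
      (M , xM) = cauchy x h 0<h
      (N , yN) = cauchy y h 0<h
  in M ⊔ N , λ m n p q →
    let xb = xM m n (ℕₚ.≤-trans (ℕₚ.m≤m⊔n M N) p) (ℕₚ.≤-trans (ℕₚ.m≤m⊔n M N) q)
        yb = yN m n (ℕₚ.≤-trans (ℕₚ.m≤n⊔m M N) p) (ℕₚ.≤-trans (ℕₚ.m≤n⊔m M N) q)
    in subst (ℚ._< δ) (cong ℚ.∣_∣ (sym (regroup (seq x m) (seq y m) (seq x n) (seq y n))))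
         (ℚₚ.≤-<-trans (ℚₚ.∣p+q∣≤∣p∣+∣q∣ (seq x m ℚ.- seq x n) (seq y m ℚ.- seq y n))
           (subst (_ ℚ.<_) (halves δ) (ℚₚ.+-mono-< xb yb)))
  where
  regroup : ∀ a b c d → (a ℚ.+ b) ℚ.- (c ℚ.+ d) ≡ (a ℚ.- c) ℚ.+ (b ℚ.- d)
  regroup = solve 4 (λ a b c d →
    (a :+ b) :- (c :+ d) := (a :- c) :+ (b :- d)) refl
    where open +-*-Solver

  halves : ∀ d → ½ ℚ.* d ℚ.+ ½ ℚ.* d ≡ d
  halves d = trans (sym (ℚₚ.*-distribʳ-+ d ½ ½)) (ℚₚ.*-identityˡ d)

_·ᵣ_ : ℝ → ℤ → ℝ
(x ·ᵣ i) .seq    n      = seq x n ℚ.* (i ℚ./ 1)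
(x ·ᵣ i) .cauchy δ 0<δ =
  let (N , xN) = cauchy x η 0<η
  in N , λ m n p q → subst (ℚ._< δ) (sym (scaled (seq x m) (seq x n)))
       (ℚₚ.≤-<-trans (ℚₚ.*-monoʳ-≤-nonNeg a (ℚₚ.<⇒≤ (xN m n p q))) ηa<δ)
  where
  a b η : ℚ
  a = ℚ.∣ i ℚ./ 1 ∣
  instance
    a≥0 : ℚ.NonNegative a
    a≥0 = ℚₚ.∣-∣-nonNeg (i ℚ./ 1)
    δ>0 : ℚ.Positive δ
    δ>0 = ℚ.positive 0<δ
  b = a ℚ.+ 1ℚ
  a<b : a ℚ.< b
  a<b = subst (ℚ._< b) (ℚₚ.+-identityʳ a) (ℚₚ.+-monoʳ-< a (ℚₚ.positive⁻¹ 1ℚ))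
  instance
    b>0 : ℚ.Positive b
    b>0 = ℚ.positive (ℚₚ.≤-<-trans (ℚₚ.nonNegative⁻¹ a) a<b)
    b≢0 : ℚ.NonZero b
    b≢0 = ℚₚ.pos⇒nonZero b
    b⁻¹>0 : ℚ.Positive (ℚ.1/ b)
    b⁻¹>0 = ℚₚ.1/pos⇒pos b
  η = δ ℚ.* ℚ.1/ b
  instance
    η>0 : ℚ.Positive η
    η>0 = ℚₚ.pos*pos⇒pos δ (ℚ.1/ b)
  0<η : 0ℚ ℚ.< η
  0<η = ℚₚ.positive⁻¹ η

  ηb≡δ : η ℚ.* b ≡ δ
  ηb≡δ = trans (ℚₚ.*-assoc δ (ℚ.1/ b) b)
        (trans (cong (δ ℚ.*_) (ℚₚ.*-inverseˡ b)) (ℚₚ.*-identityʳ δ))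

  ηa<δ : η ℚ.* a ℚ.< δ
  ηa<δ = subst (η ℚ.* a ℚ.<_) ηb≡δ (ℚₚ.*-monoʳ-<-pos η a<b)

  distrib : ∀ s t u → s ℚ.* u ℚ.- t ℚ.* u ≡ (s ℚ.- t) ℚ.* u
  distrib = solve 3 (λ s t u → s :* u :- t :* u := (s :- t) :* u) refl
    where open +-*-Solver

  scaled : ∀ s t → ℚ.∣ s ℚ.* (i ℚ./ 1) ℚ.- t ℚ.* (i ℚ./ 1) ∣ ≡ ℚ.∣ s ℚ.- t ∣ ℚ.* a
  scaled s t = trans (cong ℚ.∣_∣ (distrib s t (i ℚ./ 1)))
                     (ℚₚ.∣p*q∣≡∣p∣*∣q∣ (s ℚ.- t) (i ℚ./ 1))

------------------------------------------------------------------------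
-- Bipartite hypergraphs on the vertex set Fin n

record BipartiteHypergraph (r : ℕ) : Set where
  field
    n : ℕ
    A : Subset n

  B : Subset n
  B = ∁ A

  field
    E       : List (Subset n)
    unique  : Unique E
    uniform : All (λ e → ∣ e ∩ A ∣ ≡ 1 × ∣ e ∩ B ∣ ≡ r ℕ.∸ 1) E

  E⟨_⟩ : Subset n → List (Subset n)
  E⟨ S ⟩ = List.filter (λ e → ∣ e ∩ S ∣ ℕₚ.≟ 1) E

  record IsPerfectMatching (M : List (Subset n)) : Set where
    field
      edges    : All (_∈ˡ E) M
      disjoint : AllPairs (λ e f → Empty (e ∩ f)) M
      covers   : ∀ a → a ∈ A → ∃! _≡_ (λ e → e ∈ˡ M × a ∈ e)

  _Hits_ : Subset n → List (Subset n) → Set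
  R Hits F = All (λ e → Nonempty (R ∩ e)) F

  record τ⟨_⟩≡_ (F : List (Subset n)) (t : ℕ) : Set where
    field
      attained : Σ[ R ∈ Subset n ] R ⊆ B × R Hits F × ∣ R ∣ ≡ t
      minimal  : ∀ R → R ⊆ B → R Hits F → t ℕ.≤ ∣ R ∣

module _ {r : ℕ} (ε : ℝ) (H : BipartiteHypergraph r) where
  open BipartiteHypergraph H

  -- The integers 2r - 3 and |S| - 1 use untruncated subtraction; in
  -- particular the bound is negative when S is empty.
  data Outcome : Set where
    matching : (M : List (Subset n)) → IsPerfectMatching M → Outcome
    witness  : (S : Subset n) → S ⊆ A → (t : ℕ) → τ⟨ E⟨ S ⟩ ⟩≡ t →
               fromℕ t ≤ᵣ
                 (fromℤ (+ (2 ℕ.* r) ℤ.- + 3) +ᵣ ε) ·ᵣ (+ ∣ S ∣ ℤ.- + 1) →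
               Outcome

------------------------------------------------------------------------
-- Model of computation
--
-- A strict first-order language over finite tree-like data, with
-- unbounded iteration. Values are thought of as pointers into a shared
-- heap, so that each evaluation rule performs a bounded number of pointer
-- operations (a variable is fetched from an environment whose length is
-- fixed by the program) and is charged one unit of time. No rule compares,
-- traverses or copies a structured value. A run of time t allocates at
-- most t heap cells, hence a Turing machine simulates it in time
-- polynomial in t and the size of the input; conversely a Turing machine
-- step takes constant time here, with tapes kept as pairs of lists.

infixr 6 _⊕_
infixr 7 _⊗_

data Ty : Set where
  unit bool : Ty
  _⊗_ _⊕_   : Ty → Ty → Ty
  list      : Ty → Ty

⟦_⟧ : Ty → Set
⟦ unit   ⟧ = ⊤
⟦ bool   ⟧ = Bool
⟦ σ ⊗ τ  ⟧ = ⟦ σ ⟧ × ⟦ τ ⟧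
⟦ σ ⊕ τ  ⟧ = ⟦ σ ⟧ ⊎ ⟦ τ ⟧
⟦ list σ ⟧ = List ⟦ σ ⟧

-- The number of constructors in a value.
size : ∀ σ → ⟦ σ ⟧ → ℕ
size unit     _        = 1
size bool     _        = 1
size (σ ⊗ τ)  (x , y)  = suc (size σ x ℕ.+ size τ y)
size (σ ⊕ τ)  (inj₁ x) = suc (size σ x)
size (σ ⊕ τ)  (inj₂ y) = suc (size τ y)
size (list σ) []       = 1
size (list σ) (x ∷ xs) = suc (size σ x ℕ.+ size (list σ) xs)

Ctx : Set
Ctx = List Ty

-- Variables are de Bruijn indices. In `loop s b` the body b is run on the
-- state s, which it replaces by a new state (inl) or turns into the final
-- result (inr).
data Exp (Γ : Ctx) : Ty → Set where
  var    : ∀ {σ} → σ ∈ˡ Γ → Exp Γ σ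
  bind   : ∀ {σ τ} → Exp Γ σ → Exp (σ ∷ Γ) τ → Exp Γ τ
  unit   : Exp Γ unit
  true   : Exp Γ bool
  false  : Exp Γ bool
  if     : ∀ {σ} → Exp Γ bool → Exp Γ σ → Exp Γ σ → Exp Γ σ
  pair   : ∀ {σ τ} → Exp Γ σ → Exp Γ τ → Exp Γ (σ ⊗ τ)
  fst    : ∀ {σ τ} → Exp Γ (σ ⊗ τ) → Exp Γ σ
  snd    : ∀ {σ τ} → Exp Γ (σ ⊗ τ) → Exp Γ τ
  inl    : ∀ {σ τ} → Exp Γ σ → Exp Γ (σ ⊕ τ)
  inr    : ∀ {σ τ} → Exp Γ τ → Exp Γ (σ ⊕ τ)
  case   : ∀ {σ τ υ} → Exp Γ (σ ⊕ τ) → Exp (σ ∷ Γ) υ → Exp (τ ∷ Γ) υ → Exp Γ υ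
  nil    : ∀ {σ} → Exp Γ (list σ)
  cons   : ∀ {σ} → Exp Γ σ → Exp Γ (list σ) → Exp Γ (list σ)
  uncons : ∀ {σ υ} → Exp Γ (list σ) → Exp Γ υ → Exp (σ ∷ list σ ∷ Γ) υ → Exp Γ υ
  loop   : ∀ {σ τ} → Exp Γ σ → Exp (σ ∷ Γ) (σ ⊕ τ) → Exp Γ τ

Env : Ctx → Set
Env = All ⟦_⟧

infix 4 _⊢_⇓_[_] _⊢_↻_⇓_[_]

-- ρ ⊢ e ⇓ v [ t ]     : in ρ, e terminates with value v after time t.
-- ρ ⊢ x ↻ b ⇓ v [ t ] : the same for iterating the body b from state x.
data _⊢_⇓_[_] {Γ : Ctx} (ρ : Env Γ) : ∀ {σ} → Exp Γ σ → ⟦ σ ⟧ → ℕ → Set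
data _⊢_↻_⇓_[_] {Γ : Ctx} (ρ : Env Γ) {σ τ : Ty} :
  ⟦ σ ⟧ → Exp (σ ∷ Γ) (σ ⊕ τ) → ⟦ τ ⟧ → ℕ → Set

data _⊢_⇓_[_] {Γ} ρ where
  var : ∀ {σ} (i : σ ∈ˡ Γ) → ρ ⊢ var i ⇓ lookup ρ i [ 1 ]
  bind : ∀ {σ τ} {e : Exp Γ σ} {f : Exp (σ ∷ Γ) τ} {x y s t} →
    ρ ⊢ e ⇓ x [ s ] → x ∷ ρ ⊢ f ⇓ y [ t ] → ρ ⊢ bind e f ⇓ y [ suc (s ℕ.+ t) ]
  unit : ρ ⊢ unit ⇓ tt [ 1 ]
  true : ρ ⊢ true ⇓ true [ 1 ]
  false : ρ ⊢ false ⇓ false [ 1 ]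
  if-true : ∀ {σ} {c} {e f : Exp Γ σ} {x s t} →
    ρ ⊢ c ⇓ true [ s ] → ρ ⊢ e ⇓ x [ t ] → ρ ⊢ if c e f ⇓ x [ suc (s ℕ.+ t) ]
  if-false : ∀ {σ} {c} {e f : Exp Γ σ} {x s t} →
    ρ ⊢ c ⇓ false [ s ] → ρ ⊢ f ⇓ x [ t ] → ρ ⊢ if c e f ⇓ x [ suc (s ℕ.+ t) ]
  pair : ∀ {σ τ} {e : Exp Γ σ} {f : Exp Γ τ} {x y s t} →
    ρ ⊢ e ⇓ x [ s ] → ρ ⊢ f ⇓ y [ t ] → ρ ⊢ pair e f ⇓ (x , y) [ suc (s ℕ.+ t) ]
  fst : ∀ {σ τ} {e : Exp Γ (σ ⊗ τ)} {x y s} →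
    ρ ⊢ e ⇓ (x , y) [ s ] → ρ ⊢ fst e ⇓ x [ suc s ]
  snd : ∀ {σ τ} {e : Exp Γ (σ ⊗ τ)} {x y s} →
    ρ ⊢ e ⇓ (x , y) [ s ] → ρ ⊢ snd e ⇓ y [ suc s ]
  inl : ∀ {σ τ} {e : Exp Γ σ} {x s} →
    ρ ⊢ e ⇓ x [ s ] → ρ ⊢ inl {τ = τ} e ⇓ inj₁ x [ suc s ]
  inr : ∀ {σ τ} {e : Exp Γ τ} {y s} →
    ρ ⊢ e ⇓ y [ s ] → ρ ⊢ inr {σ = σ} e ⇓ inj₂ y [ suc s ]
  case-inl : ∀ {σ τ υ} {e : Exp Γ (σ ⊕ τ)} {f} {g} {x} {z : ⟦ υ ⟧} {s t} →
    ρ ⊢ e ⇓ inj₁ x [ s ] → x ∷ ρ ⊢ f ⇓ z [ t ] → ρ ⊢ case e f g ⇓ z [ suc (s ℕ.+ t) ]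
  case-inr : ∀ {σ τ υ} {e : Exp Γ (σ ⊕ τ)} {f} {g} {y} {z : ⟦ υ ⟧} {s t} →
    ρ ⊢ e ⇓ inj₂ y [ s ] → y ∷ ρ ⊢ g ⇓ z [ t ] → ρ ⊢ case e f g ⇓ z [ suc (s ℕ.+ t) ]
  nil : ∀ {σ} → ρ ⊢ nil {σ = σ} ⇓ [] [ 1 ]
  cons : ∀ {σ} {e : Exp Γ σ} {f} {x xs s t} →
    ρ ⊢ e ⇓ x [ s ] → ρ ⊢ f ⇓ xs [ t ] → ρ ⊢ cons e f ⇓ x ∷ xs [ suc (s ℕ.+ t) ]
  uncons-nil : ∀ {σ υ} {e : Exp Γ (list σ)} {f} {g} {z : ⟦ υ ⟧} {s t} →
    ρ ⊢ e ⇓ [] [ s ] → ρ ⊢ f ⇓ z [ t ] → ρ ⊢ uncons e f g ⇓ z [ suc (s ℕ.+ t) ]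
  uncons-cons : ∀ {σ υ} {e : Exp Γ (list σ)} {f} {g} {x xs} {z : ⟦ υ ⟧} {s t} →
    ρ ⊢ e ⇓ x ∷ xs [ s ] → x ∷ xs ∷ ρ ⊢ g ⇓ z [ t ] →
    ρ ⊢ uncons e f g ⇓ z [ suc (s ℕ.+ t) ]
  loop : ∀ {σ τ} {e : Exp Γ σ} {b : Exp (σ ∷ Γ) (σ ⊕ τ)} {x y s t} →
    ρ ⊢ e ⇓ x [ s ] → ρ ⊢ x ↻ b ⇓ y [ t ] → ρ ⊢ loop e b ⇓ y [ suc (s ℕ.+ t) ]

data _⊢_↻_⇓_[_] {Γ} ρ {σ} {τ} where
  again : ∀ {x x′ b y s t} →
    x ∷ ρ ⊢ b ⇓ inj₁ x′ [ s ] → ρ ⊢ x′ ↻ b ⇓ y [ t ] →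
    ρ ⊢ x ↻ b ⇓ y [ suc (s ℕ.+ t) ]
  done : ∀ {x b y s} →
    x ∷ ρ ⊢ b ⇓ inj₂ y [ s ] → ρ ⊢ x ↻ b ⇓ y [ suc s ]

Program : Ty → Ty → Set
Program σ τ = Exp (σ ∷ []) τ

infix 4 _on_yields_inTime_

_on_yields_inTime_ : ∀ {σ τ} → Program σ τ → ⟦ σ ⟧ → ⟦ τ ⟧ → ℕ → Set
p on x yields y inTime t = (x ∷ []) ⊢ p ⇓ y [ t ]

------------------------------------------------------------------------
-- Sets of vertices are presented to programs as characteristic vectors:
-- the input is the characteristic vector of A and the incidence matrix.

vertexSetTy inputTy outputTy : Ty
vertexSetTy = list bool
inputTy     = vertexSetTy ⊗ list vertexSetTy
outputTy    = list vertexSetTy ⊕ vertexSetTy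

encode : ∀ {r} → BipartiteHypergraph r → ⟦ inputTy ⟧
encode H = Vec.toList A , List.map Vec.toList E
  where open BipartiteHypergraph H

encodeOutcome : ∀ {r} {ε : ℝ} {H : BipartiteHypergraph r} → Outcome ε H → ⟦ outputTy ⟧
encodeOutcome (matching M _)        = inj₁ (List.map Vec.toList M)
encodeOutcome (witness S _ _ _ _)   = inj₂ (Vec.toList S)

{-# OPTIONS --safe #-}
-- Replace ε by a smaller 1/m and put b = r - 1. Following Annamalai's refinement
-- of Haxell's argument, fix an unmatched root in A and grow layers (X, Y): X is a
-- maximal set of edges issuing from the A-vertices of the previous Y (at most U
-- from each), disjoint in B from one another and from everything below, and Y is
-- the set of matching edges that meet X. If a fixed fraction of the sources have
-- an edge in X that nothing blocks, swap these edges into the matching; this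
-- removes as many edges from the Y below, and the layer is dropped. If otherwise X
-- is small compared with all Y below, then the B-vertices of all X and Y cover
-- every edge at the unsaturated sources S; as each edge of Y meets X, they number
-- at most b |X| + (b - 1) |Y|, which is close to (2b - 1) (|S| - 1). In the
-- remaining case |Y| is at least a fixed fraction of everything below, so there
-- are only O(log |A|) layers, and since a layer allows boundedly many swaps
-- between two changes below it, an exponentially weighted potential bounds the
-- number of steps by a polynomial.
module Submission where

open import Defs
open import Data.Nat.Base using (ℕ; _≤_; _+_; _*_; _^_)
open import Data.Product.Base using (Σ-syntax; _×_)

open import Data.Bool.Base using (Bool; true; false; not; if_then_else_; T; _∧_; _∨_)
open import Data.Bool.ListAction using (any)
open import Data.Bool.Properties using (T-∧; ∧-assoc; ∧-comm; ∧-identityʳ; ∧-zeroʳ)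
open import Data.Fin.Base using (Fin; zero; suc)
open import Data.Fin.Subset
  using (Subset; _∈_; _∉_; _⊆_; _∩_; _∪_; ∁; ∣_∣; Nonempty; Empty; ⁅_⁆; ⊥; ⋃)
open import Data.Fin.Subset.Properties
open import Data.Integer.Base as ℤ using (ℤ; +≤+)
import Data.Integer.Properties as ℤₚ
open import Data.List.Base
  using (List; []; _∷_; _++_; map; foldr; foldl; length; reverse; concatMap; filterᵇ; zipWith)
open import Data.List.Membership.Propositional using (find) renaming (_∈_ to _∈ˡ_)
open import Data.List.Membership.Propositional.Properties
  using (∈-++⁺ˡ; ∈-++⁺ʳ; ∈-++⁻; ∈-map⁺; ∈-map⁻; ∈-filter⁺; ∈-filter⁻)
open import Data.List.Properties
open import Data.List.Relation.Binary.Pointwise.Base using (Pointwise; []; _∷_)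
open import Data.List.Relation.Binary.Sublist.Propositional
  using ([]; _∷_; _∷ʳ_) renaming (_⊆_ to _⊑_)
open import Data.List.Relation.Binary.Sublist.Propositional.Properties
  using (All-resp-⊆; Any-resp-⊆; filter-⊆; ++⁺)
open import Data.List.Relation.Unary.All as All using (All; []; _∷_)
import Data.List.Relation.Unary.All.Properties as All
open import Data.List.Relation.Unary.AllPairs as AllPairs using (AllPairs; []; _∷_)
import Data.List.Relation.Unary.AllPairs.Properties as AllPairs
open import Data.List.Relation.Unary.Any as Any using (Any; here; there)
import Data.List.Relation.Unary.Any.Properties as Any
open import Data.Nat.Base as ℕ
open import Data.Nat.Coprimality using (Coprime)
open import Data.Nat.Properties
import Data.Nat.Properties as ℕₚ
open import Data.Nat.Tactic.RingSolver using (solve-∀)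
open import Data.Product using (∃!)
open import Data.Product.Base using (∃-syntax; _,_; proj₁; proj₂)
open import Data.Rational.Base as ℚ using (mkℚ; 0ℚ; toℚᵘ)
import Data.Rational.Properties as ℚₚ
open import Data.Rational.Unnormalised.Base as ℚᵘ using (mkℚᵘ; *≤*)
import Data.Rational.Unnormalised.Properties as ℚᵘₚ
open import Data.Sum.Base using (_⊎_; inj₁; inj₂; [_,_]′)
open import Data.Unit.Base using (⊤; tt)
open import Data.Vec.Base as Vec using (toList; []; _∷_; here; there)
open import Data.Vec.Properties using (toList-map)
open import Function.Base using (_∘_; id)
open import Function.Bundles using (Equivalence)
open import Relation.Binary.PropositionalEquality
open import Relation.Nullary using (¬_; Dec; yes; no; contradiction)
open import Relation.Nullary.Decidable using (T?; _×-dec_)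
open import Relation.Unary using (Decidable)

-- Polynomial-time programs

-- The growth of the layers, the cover and the potential all depend on comparing `X` with `Y` and
-- with the sources. An edge added to `X` must also avoid the matching edges that already block its
-- own layer: each edge of `Y` then meets exactly one edge of `X`, so `X` exceeds `Y` at most by its
-- unblocked edges, and these are few while no swap is due. The cap `U` limits `X` in terms of the
-- number of sources, and thereby the potential. Its price is that a saturated source may have edges
-- which the cover misses; there are at most `|X| / U` such sources, so a large constant `U` makes
-- their loss negligible. Programs come from combinators that carry their meaning, a polynomial for
-- the time and another for the lengths of lists in the result. An unbounded iteration has no such
-- polynomial by itself. So the search runs on a clock of explicitly polynomial length; a finished
-- state is a fixed point of the step, and the potential only has to show that the clock is long
-- enough.

infixl 6 _⊞_
infixl 7 _⊠_
infix  8 _⟨_⟩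

data Poly : Set where
  con         : ℕ → Poly
  𝒳           : Poly
  _⊞_ _⊠_     : Poly → Poly → Poly
  _⟨_⟩        : Poly → Poly → Poly

⟪_⟫ : Poly → ℕ → ℕ
⟪ con c ⟫   s = c
⟪ 𝒳 ⟫       s = s
⟪ p ⊞ q ⟫   s = ⟪ p ⟫ s + ⟪ q ⟫ s
⟪ p ⊠ q ⟫   s = ⟪ p ⟫ s * ⟪ q ⟫ s
⟪ p ⟨ q ⟩ ⟫ s = ⟪ p ⟫ (⟪ q ⟫ s)

infix 9 _^ₚ_
_^ₚ_ : Poly → ℕ → Poly
p ^ₚ zero  = con 1
p ^ₚ suc k = p ⊠ p ^ₚ k

⟪^ₚ⟫ : ∀ p k s → ⟪ p ^ₚ k ⟫ s ≡ ⟪ p ⟫ s ^ k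
⟪^ₚ⟫ p zero    s = refl
⟪^ₚ⟫ p (suc k) s = cong (⟪ p ⟫ s *_) (⟪^ₚ⟫ p k s)

^-distribʳ-* : ∀ o m n → (m * n) ^ o ≡ m ^ o * n ^ o
^-distribʳ-* zero    m n = refl
^-distribʳ-* (suc o) m n = trans (cong (m * n *_) (^-distribʳ-* o m n))
                                 ([m*n]*[o*p]≡[m*o]*[n*p] m n (m ^ o) (n ^ o))

m+n≤2mn : ∀ {m n} → 1 ≤ m → 1 ≤ n → m + n ≤ 2 * (m * n)
m+n≤2mn {m} {n} 1≤m 1≤n = begin
  m + n             ≤⟨ +-mono-≤ (m≤m*n m n {{>-nonZero 1≤n}}) (m≤n*m n m {{>-nonZero 1≤m}}) ⟩
  m * n + m * n     ≡⟨ cong (m * n +_) (sym (+-identityʳ (m * n))) ⟩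
  2 * (m * n)       ∎
  where open ≤-Reasoning

module _ (s : ℕ) where
  private
    z = 2 + s
    instance
      z≢0 : NonZero z
      z≢0 = _

    1≤z^ : ∀ k → 1 ≤ z ^ k
    1≤z^ k = m^n>0 z k

    2*z^ : ∀ {m} k → m ≤ 2 * z ^ k → m ≤ z ^ suc k
    2*z^ k m≤ = ≤-trans m≤ (*-monoˡ-≤ (z ^ k) (m≤m+n 2 s))

    n≤z^n : ∀ n → n ≤ z ^ n
    n≤z^n zero    = z≤n
    n≤z^n (suc n) = 2*z^ n (≤-trans (+-mono-≤ (1≤z^ n) (n≤z^n n))
      (≤-reflexive (cong (z ^ n +_) (sym (+-identityʳ (z ^ n))))))

  z^+z^≤ : ∀ k l → (2 + s) ^ k + (2 + s) ^ l ≤ (2 + s) ^ suc (k + l)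
  z^+z^≤ k l = 2*z^ (k + l) (subst (λ u → z ^ k + z ^ l ≤ 2 * u) (sym (^-distribˡ-+-* z k l))
    (m+n≤2mn (1≤z^ k) (1≤z^ l)))

  con≤ : ∀ c → c ≤ (2 + s) ^ c
  con≤ = n≤z^n

-- Not the degree, but an exponent for the base `2 + s`. That base is at least 2, so it absorbs
-- constants (`c ≤ 2 ^ c`) and the factor 2 of a sum, and no coefficients have to be tracked, even
-- under composition.
deg : Poly → ℕ
deg (con c)   = c
deg 𝒳         = 1
deg (p ⊞ q)   = suc (deg p + deg q)
deg (p ⊠ q)   = deg p + deg q
deg (p ⟨ q ⟩) = suc (1 + deg q) * deg p

⟪⟫≤z^ : ∀ p s → ⟪ p ⟫ s ≤ (2 + s) ^ deg p
⟪⟫≤z^ (con c)   s = con≤ s c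
⟪⟫≤z^ 𝒳         s = ≤-trans (m≤n+m s 2) (≤-reflexive (sym (*-identityʳ (2 + s))))
⟪⟫≤z^ (p ⊞ q)   s = ≤-trans (+-mono-≤ (⟪⟫≤z^ p s) (⟪⟫≤z^ q s)) (z^+z^≤ s (deg p) (deg q))
⟪⟫≤z^ (p ⊠ q)   s = ≤-trans (*-mono-≤ (⟪⟫≤z^ p s) (⟪⟫≤z^ q s))
  (≤-reflexive (sym (^-distribˡ-+-* (2 + s) (deg p) (deg q))))
⟪⟫≤z^ (p ⟨ q ⟩) s = begin
  ⟪ p ⟫ (⟪ q ⟫ s)                            ≤⟨ ⟪⟫≤z^ p (⟪ q ⟫ s) ⟩
  (2 + ⟪ q ⟫ s) ^ deg p                   ≤⟨ ^-monoˡ-≤ (deg p) 2+q≤ ⟩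
  ((2 + s) ^ suc (1 + deg q)) ^ deg p  ≡⟨ ^-*-assoc (2 + s) (suc (1 + deg q)) (deg p) ⟩
  (2 + s) ^ deg (p ⟨ q ⟩)                 ∎
  where
  open ≤-Reasoning
  2+q≤ : 2 + ⟪ q ⟫ s ≤ (2 + s) ^ suc (1 + deg q)
  2+q≤ = ≤-trans (+-mono-≤ (≤-trans (m≤m+n 2 s) (≤-reflexive (sym (*-identityʳ (2 + s))))) (⟪⟫≤z^ q s))
                 (z^+z^≤ s 1 (deg q))

-- For positive `s` the base `2 + s` is at most `3 * s`. At 0 the power of `s` may vanish, and the
-- additive constant takes over.
⟪⟫-bound : ∀ p s → ⟪ p ⟫ s ≤ 3 ^ deg p * s ^ deg p + 3 ^ deg p
⟪⟫-bound p zero = ≤-trans (⟪⟫≤z^ p 0)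
  (≤-trans (^-monoˡ-≤ (deg p) (s≤s (s≤s z≤n))) (m≤n+m _ _))
⟪⟫-bound p (suc s) = begin
  ⟪ p ⟫ (suc s)                    ≤⟨ ⟪⟫≤z^ p (suc s) ⟩
  (3 + s) ^ deg p               ≤⟨ ^-monoˡ-≤ (deg p) 3+s≤ ⟩
  (3 * suc s) ^ deg p           ≡⟨ ^-distribʳ-* (deg p) 3 (suc s) ⟩
  3 ^ deg p * suc s ^ deg p  ≤⟨ m≤m+n _ _ ⟩
  _                                ∎
  where
  open ≤-Reasoning
  3+s≤ : 3 + s ≤ 3 * suc s
  3+s≤ = ≤-trans (+-monoʳ-≤ 3 (m≤n*m s 3)) (≤-reflexive (sym (*-suc 3 s)))

-- Sizes would not do here: a value of linear time may share its parts and so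
-- have exponential size. The cost of a program only depends on list lengths.
Bounded : ℕ → ∀ σ → ⟦ σ ⟧ → Set
Bounded s unit     _        = ⊤
Bounded s bool     _        = ⊤
Bounded s (σ ⊗ τ)  (x , y)  = Bounded s σ x × Bounded s τ y
Bounded s (σ ⊕ τ)  (inj₁ x) = Bounded s σ x
Bounded s (σ ⊕ τ)  (inj₂ y) = Bounded s τ y
Bounded s (list σ) xs       = length xs ≤ s × All (Bounded s σ) xs

Bounded-mono : ∀ σ {s t v} → s ≤ t → Bounded s σ v → Bounded t σ v
Bounded-mono unit     s≤t _       = tt
Bounded-mono bool     s≤t _       = tt
Bounded-mono (σ ⊗ τ)  s≤t (p , q) = Bounded-mono σ s≤t p , Bounded-mono τ s≤t q
Bounded-mono (σ ⊕ τ) {v = inj₁ _} s≤t p = Bounded-mono σ s≤t p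
Bounded-mono (σ ⊕ τ) {v = inj₂ _} s≤t p = Bounded-mono τ s≤t p
Bounded-mono (list σ) s≤t (l , ps) = ≤-trans l s≤t , all ps
  where
  all : ∀ {xs} → All (Bounded _ σ) xs → All (Bounded _ σ) xs
  all []       = []
  all (p ∷ ps) = Bounded-mono σ s≤t p ∷ all ps

Bounded-size : ∀ σ v → Bounded (size σ v) σ v
Bounded-size unit     _        = tt
Bounded-size bool     _        = tt
Bounded-size (σ ⊗ τ)  (x , y)  =
  Bounded-mono σ (m≤n⇒m≤1+n (m≤m+n _ _)) (Bounded-size σ x) ,
  Bounded-mono τ (m≤n⇒m≤1+n (m≤n+m _ _)) (Bounded-size τ y)
Bounded-size (σ ⊕ τ)  (inj₁ x) = Bounded-mono σ (n≤1+n _) (Bounded-size σ x)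
Bounded-size (σ ⊕ τ)  (inj₂ y) = Bounded-mono τ (n≤1+n _) (Bounded-size τ y)
Bounded-size (list σ) []       = z≤n , []
Bounded-size (list σ) (x ∷ xs) =
  let l , ps = Bounded-size (list σ) xs in
  s≤s (≤-trans l (m≤n+m _ _)) ,
  Bounded-mono σ (m≤n⇒m≤1+n (m≤m+n _ _)) (Bounded-size σ x) ∷
  All.map (Bounded-mono σ (m≤n⇒m≤1+n (m≤n+m _ _))) ps

data BoundedEnv (s : ℕ) : ∀ {Γ} → Env Γ → Set where
  []  : BoundedEnv s []
  _∷_ : ∀ {σ Γ x} {ρ : Env Γ} → Bounded s σ x → BoundedEnv s ρ → BoundedEnv s (_∷_ {x = σ} x ρ)

BoundedEnv-mono : ∀ {s t Γ} {ρ : Env Γ} → s ≤ t → BoundedEnv s ρ → BoundedEnv t ρ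
BoundedEnv-mono s≤t []       = []
BoundedEnv-mono s≤t (_∷_ {σ} p ps) = Bounded-mono σ s≤t p ∷ BoundedEnv-mono s≤t ps

Bounded-lookup : ∀ {s Γ σ} {ρ : Env Γ} (i : σ ∈ˡ Γ) → BoundedEnv s ρ → Bounded s σ (All.lookup ρ i)
Bounded-lookup (here refl) (p ∷ _)  = p
Bounded-lookup (there i)   (_ ∷ ps) = Bounded-lookup i ps

-- Code with certified meaning and cost

Ren : Ctx → Ctx → Set
Ren Γ Δ = ∀ {σ} → σ ∈ˡ Γ → σ ∈ˡ Δ

lift : ∀ {Γ Δ σ} → Ren Γ Δ → Ren (σ ∷ Γ) (σ ∷ Δ)
lift θ (here p)  = here p
lift θ (there i) = there (θ i)

Agree : ∀ {Γ Δ} → Ren Γ Δ → Env Γ → Env Δ → Set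
Agree {Γ} θ ρ δ = ∀ {σ} (i : σ ∈ˡ Γ) → All.lookup δ (θ i) ≡ All.lookup ρ i

lift-agree : ∀ {Γ Δ σ x} {θ : Ren Γ Δ} {ρ δ} → Agree θ ρ δ →
             Agree (lift {σ = σ} θ) (x ∷ ρ) (x ∷ δ)
lift-agree ag (here refl) = refl
lift-agree ag (there i)   = ag i

infix 4 _⊢_⇓_≤[_]
_⊢_⇓_≤[_] : ∀ {Γ σ} → Env Γ → Exp Γ σ → ⟦ σ ⟧ → ℕ → Set
δ ⊢ e ⇓ v ≤[ T ] = ∃[ t ] t ≤ T × (δ ⊢ e ⇓ v [ t ])

-- The code is given in every extension of Γ, so that weakening needs no
-- induction over expressions.
record Impl (Γ : Ctx) (σ : Ty) (f : Env Γ → ⟦ σ ⟧) : Set where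
  field
    code  : ∀ {Δ} → Ren Γ Δ → Exp Δ σ
    time  : Poly
    width : Poly
    run   : ∀ {Δ} (θ : Ren Γ Δ) {ρ δ s} → Agree θ ρ δ → BoundedEnv s ρ →
            δ ⊢ code θ ⇓ f ρ ≤[ ⟪ time ⟫ s ]
    bound : ∀ {ρ s} → BoundedEnv s ρ → Bounded (⟪ width ⟫ s) σ (f ρ)
open Impl public

private
  variable
    Γ : Ctx
    σ τ υ : Ty

-- A combinator describes its function in the form dictated by the code; a pointwise equation then
-- suffices to pass to the intended form.
castI : ∀ {f g : Env Γ → ⟦ σ ⟧} → (∀ ρ → f ρ ≡ g ρ) → Impl Γ σ f → Impl Γ σ g
castI f≗g F = record
  { code = code F ; time = time F ; width = width F
  ; run = λ θ {ρ} ag ok → subst (λ v → _ ⊢ _ ⇓ v ≤[ _ ]) (f≗g ρ) (run F θ ag ok)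
  ; bound = λ {ρ} ok → subst (Bounded _ _) (f≗g ρ) (bound F ok) }

varI : (i : σ ∈ˡ Γ) → Impl Γ σ (λ ρ → All.lookup ρ i)
varI i = record
  { code = λ θ → var (θ i) ; time = con 1 ; width = 𝒳
  ; run = λ θ ag ok → 1 , ≤-refl , subst (λ v → _ ⊢ var (θ i) ⇓ v [ 1 ]) (ag i) (var (θ i))
  ; bound = Bounded-lookup i }

wk : ∀ {f} → Impl Γ σ f → Impl (τ ∷ Γ) σ (λ ρ → f (All.tail ρ))
wk F = record
  { code = λ θ → code F (λ i → θ (there i)) ; time = time F ; width = width F
  ; run = λ { θ {_ ∷ _} ag (_ ∷ ok) → run F (λ i → θ (there i)) (λ i → ag (there i)) ok }
  ; bound = λ { {_ ∷ _} (_ ∷ ok) → bound F ok } }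

private
  node : ∀ {a b c d} → a ≤ c → b ≤ d → suc (a + b) ≤ suc (c + d)
  node p q = s≤s (+-mono-≤ p q)

  -- Sums stand in for maxima throughout, as `Poly` is closed under sums.
  inner : ∀ {s w} {ρ : Env Γ} {x} → BoundedEnv s ρ → Bounded w σ x →
          BoundedEnv (s + w) (_∷_ {x = σ} x ρ)
  inner {σ = σ} ok p = Bounded-mono σ (m≤n+m _ _) p ∷ BoundedEnv-mono (m≤m+n _ _) ok

  left : ∀ σ {a b v} → Bounded a σ v → Bounded (a + b) σ v
  left σ = Bounded-mono σ (m≤m+n _ _)

  right : ∀ σ {a b v} → Bounded b σ v → Bounded (a + b) σ v
  right σ = Bounded-mono σ (m≤n+m _ _)

bindI : ∀ {f g} → Impl Γ σ f → Impl (σ ∷ Γ) τ g → Impl Γ τ (λ ρ → g (f ρ ∷ ρ))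
bindI F G = record
  { code  = λ θ → bind (code F θ) (code G (lift θ))
  ; time  = con 1 ⊞ (time F ⊞ time G ⟨ 𝒳 ⊞ width F ⟩)
  ; width = width G ⟨ 𝒳 ⊞ width F ⟩
  ; run   = λ θ ag ok →
      let _ , p , d = run F θ ag ok
          _ , q , e = run G (lift θ) (lift-agree ag) (inner ok (bound F ok))
      in _ , node p q , bind d e
  ; bound = λ ok → bound G (inner ok (bound F ok)) }

unitI : Impl Γ unit (λ _ → tt)
unitI = record { code = λ _ → unit ; time = con 1 ; width = con 0
               ; run = λ _ _ _ → 1 , ≤-refl , unit ; bound = λ _ → tt }

trueI : Impl Γ bool (λ _ → true)
trueI = record { code = λ _ → true ; time = con 1 ; width = con 0
               ; run = λ _ _ _ → 1 , ≤-refl , true ; bound = λ _ → tt }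

falseI : Impl Γ bool (λ _ → false)
falseI = record { code = λ _ → false ; time = con 1 ; width = con 0
                ; run = λ _ _ _ → 1 , ≤-refl , false ; bound = λ _ → tt }

ifI : ∀ {c f g} → Impl Γ bool c → Impl Γ σ f → Impl Γ σ g →
      Impl Γ σ (λ ρ → if c ρ then f ρ else g ρ)
ifI {Γ} {σ} {c} {f} {g} C F G = record
  { code  = λ θ → if (code C θ) (code F θ) (code G θ)
  ; time  = con 1 ⊞ (time C ⊞ (time F ⊞ time G))
  ; width = width F ⊞ width G
  ; run   = λ θ ag ok → branch θ (run C θ ag ok) (run F θ ag ok) (run G θ ag ok)
  ; bound = λ {ρ} ok → choose (c ρ) (bound F ok) (bound G ok) }
  where
  branch : ∀ {Δ} {δ : Env Δ} (θ : Ren Γ Δ) {b x y k l m} →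
           δ ⊢ code C θ ⇓ b ≤[ k ] → δ ⊢ code F θ ⇓ x ≤[ l ] → δ ⊢ code G θ ⇓ y ≤[ m ] →
           δ ⊢ if (code C θ) (code F θ) (code G θ) ⇓ (if b then x else y) ≤[ suc (k + (l + m)) ]
  branch θ {true}  (_ , p , d) (_ , q , e) _ = _ , node p (≤-trans q (m≤m+n _ _)) , if-true d e
  branch θ {false} (_ , p , d) _ (_ , q , e) = _ , node p (≤-trans q (m≤n+m _ _)) , if-false d e
  choose : ∀ b {x y k l} → Bounded k σ x → Bounded l σ y → Bounded (k + l) σ (if b then x else y)
  choose true  p q = left σ p
  choose false p q = right σ q

pairI : ∀ {f g} → Impl Γ σ f → Impl Γ τ g → Impl Γ (σ ⊗ τ) (λ ρ → f ρ , g ρ)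
pairI {σ = σ} {τ = τ} F G = record
  { code  = λ θ → pair (code F θ) (code G θ)
  ; time  = con 1 ⊞ (time F ⊞ time G)
  ; width = width F ⊞ width G
  ; run   = λ θ ag ok →
      let _ , p , d = run F θ ag ok ; _ , q , e = run G θ ag ok in _ , node p q , pair d e
  ; bound = λ ok → left σ (bound F ok) , right τ (bound G ok) }

fstI : ∀ {f} → Impl Γ (σ ⊗ τ) f → Impl Γ σ (λ ρ → proj₁ (f ρ))
fstI F = record
  { code  = λ θ → fst (code F θ)
  ; time  = con 1 ⊞ time F ; width = width F
  ; run   = λ θ ag ok → let _ , p , d = run F θ ag ok in _ , s≤s p , fst d
  ; bound = λ ok → proj₁ (bound F ok) }

sndI : ∀ {f} → Impl Γ (σ ⊗ τ) f → Impl Γ τ (λ ρ → proj₂ (f ρ))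
sndI F = record
  { code  = λ θ → snd (code F θ)
  ; time  = con 1 ⊞ time F ; width = width F
  ; run   = λ θ ag ok → let _ , p , d = run F θ ag ok in _ , s≤s p , snd d
  ; bound = λ ok → proj₂ (bound F ok) }

inlI : ∀ {f} → Impl Γ σ f → Impl Γ (σ ⊕ τ) (λ ρ → inj₁ (f ρ))
inlI F = record
  { code  = λ θ → inl (code F θ)
  ; time  = con 1 ⊞ time F ; width = width F
  ; run   = λ θ ag ok → let _ , p , d = run F θ ag ok in _ , s≤s p , inl d
  ; bound = bound F }

inrI : ∀ {f} → Impl Γ τ f → Impl Γ (σ ⊕ τ) (λ ρ → inj₂ (f ρ))
inrI F = record
  { code  = λ θ → inr (code F θ)
  ; time  = con 1 ⊞ time F ; width = width F
  ; run   = λ θ ag ok → let _ , p , d = run F θ ag ok in _ , s≤s p , inr d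
  ; bound = bound F }

caseI : ∀ {f g h} → Impl Γ (σ ⊕ τ) f → Impl (σ ∷ Γ) υ g → Impl (τ ∷ Γ) υ h →
        Impl Γ υ (λ ρ → [ (λ x → g (x ∷ ρ)) , (λ y → h (y ∷ ρ)) ]′ (f ρ))
caseI {Γ} {σ} {τ} {υ} {f} {g} {h} F G H = record
  { code  = λ θ → case (code F θ) (code G (lift θ)) (code H (lift θ))
  ; time  = con 1 ⊞ (time F ⊞ (time G ⟨ 𝒳 ⊞ width F ⟩ ⊞ time H ⟨ 𝒳 ⊞ width F ⟩))
  ; width = width G ⟨ 𝒳 ⊞ width F ⟩ ⊞ width H ⟨ 𝒳 ⊞ width F ⟩
  ; run   = λ θ ag ok → branch θ ag ok (run F θ ag ok) (bound F ok)
  ; bound = λ {ρ} ok → choose (f ρ) ok (bound F ok) }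
  where
  branch : ∀ {Δ} {δ : Env Δ} (θ : Ren Γ Δ) {ρ s v k w} → Agree θ ρ δ → BoundedEnv s ρ →
           δ ⊢ code F θ ⇓ v ≤[ k ] → Bounded w (σ ⊕ τ) v →
           δ ⊢ case (code F θ) (code G (lift θ)) (code H (lift θ)) ⇓
             [ (λ x → g (x ∷ ρ)) , (λ y → h (y ∷ ρ)) ]′ v
             ≤[ suc (k + (⟪ time G ⟫ (s + w) + ⟪ time H ⟫ (s + w))) ]
  branch θ {v = inj₁ x} ag ok (_ , p , d) b =
    let _ , q , e = run G (lift θ) (lift-agree ag) (inner ok b)
    in _ , node p (≤-trans q (m≤m+n _ _)) , case-inl d e
  branch θ {v = inj₂ y} ag ok (_ , p , d) b =
    let _ , q , e = run H (lift θ) (lift-agree ag) (inner ok b)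
    in _ , node p (≤-trans q (m≤n+m _ _)) , case-inr d e
  choose : ∀ v {ρ s w} → BoundedEnv s ρ → Bounded w (σ ⊕ τ) v →
           Bounded (⟪ width G ⟫ (s + w) + ⟪ width H ⟫ (s + w)) υ
             ([ (λ x → g (x ∷ ρ)) , (λ y → h (y ∷ ρ)) ]′ v)
  choose (inj₁ x) ok b = left υ (bound G (inner ok b))
  choose (inj₂ y) ok b = right υ (bound H (inner ok b))

nilI : Impl Γ (list σ) (λ _ → [])
nilI = record { code = λ _ → nil ; time = con 1 ; width = con 0
              ; run = λ _ _ _ → 1 , ≤-refl , nil ; bound = λ _ → z≤n , [] }

consI : ∀ {f g} → Impl Γ σ f → Impl Γ (list σ) g → Impl Γ (list σ) (λ ρ → f ρ ∷ g ρ)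
consI {σ = σ} F G = record
  { code  = λ θ → cons (code F θ) (code G θ)
  ; time  = con 1 ⊞ (time F ⊞ time G)
  ; width = con 1 ⊞ (width F ⊞ width G)
  ; run   = λ θ ag ok →
      let _ , p , d = run F θ ag ok ; _ , q , e = run G θ ag ok in _ , node p q , cons d e
  ; bound = λ ok →
      let l , bs = bound G ok in
      s≤s (≤-trans l (m≤n+m _ _)) ,
      Bounded-mono σ (m≤n⇒m≤1+n (m≤m+n _ _)) (bound F ok) ∷
      All.map (Bounded-mono σ (m≤n⇒m≤1+n (m≤n+m _ _))) bs }

match : ∀ {A B : Set} → List A → B → (A → List A → B) → B
match []       z k = z
match (x ∷ xs) z k = k x xs

unconsI : ∀ {f g h} → Impl Γ (list σ) f → Impl Γ υ g → Impl (σ ∷ list σ ∷ Γ) υ h →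
          Impl Γ υ (λ ρ → match (f ρ) (g ρ) (λ x xs → h (x ∷ xs ∷ ρ)))
unconsI {Γ} {σ} {υ} {f} {g} {h} F G H = record
  { code  = λ θ → uncons (code F θ) (code G θ) (code H (lift (lift θ)))
  ; time  = con 1 ⊞ (time F ⊞ (time G ⊞ time H ⟨ 𝒳 ⊞ width F ⟩))
  ; width = width G ⊞ width H ⟨ 𝒳 ⊞ width F ⟩
  ; run   = λ θ ag ok → branch θ ag ok (run F θ ag ok) (bound F ok)
  ; bound = λ {ρ} ok → choose (f ρ) ok (bound F ok) }
  where
  inner₂ : ∀ {s w ρ x xs} → BoundedEnv s ρ → Bounded w (list σ) (x ∷ xs) →
           BoundedEnv (s + w) (_∷_ {x = σ} x (_∷_ {x = list σ} xs ρ))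
  inner₂ ok (l , p ∷ ps) =
    right σ p ∷ right (list σ) (≤-trans (n≤1+n _) l , ps) ∷ BoundedEnv-mono (m≤m+n _ _) ok
  branch : ∀ {Δ} {δ : Env Δ} (θ : Ren Γ Δ) {ρ s v k w} → Agree θ ρ δ → BoundedEnv s ρ →
           δ ⊢ code F θ ⇓ v ≤[ k ] → Bounded w (list σ) v →
           δ ⊢ uncons (code F θ) (code G θ) (code H (lift (lift θ))) ⇓
             match v (g ρ) (λ x xs → h (x ∷ xs ∷ ρ))
             ≤[ suc (k + (⟪ time G ⟫ s + ⟪ time H ⟫ (s + w))) ]
  branch θ {v = []} ag ok (_ , p , d) b =
    let _ , q , e = run G θ ag ok
    in _ , node p (≤-trans q (m≤m+n _ _)) , uncons-nil d e
  branch θ {v = x ∷ xs} ag ok (_ , p , d) b =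
    let _ , q , e = run H (lift (lift θ)) (lift-agree (lift-agree ag)) (inner₂ ok b)
    in _ , node p (≤-trans q (m≤n+m _ _)) , uncons-cons d e
  choose : ∀ v {ρ s w} → BoundedEnv s ρ → Bounded w (list σ) v →
           Bounded (⟪ width G ⟫ s + ⟪ width H ⟫ (s + w)) υ
             (match v (g ρ) (λ x xs → h (x ∷ xs ∷ ρ)))
  choose []       ok b = left υ (bound G ok)
  choose (x ∷ xs) ok b = right υ (bound H (inner₂ ok b))

-- No width bound can be derived for an iterated function, so a bound on the
-- accumulator is supplied semantically.
module _ {f : Env Γ → List ⟦ σ ⟧} {a : Env Γ → ⟦ τ ⟧} {g : Env (σ ∷ τ ∷ Γ) → ⟦ τ ⟧}
         (F : Impl Γ (list σ) f) (A : Impl Γ τ a) (G : Impl (σ ∷ τ ∷ Γ) τ g) (w : Poly) where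
  private
    bodyRen : ∀ {Δ} → Ren Γ Δ → Ren (σ ∷ τ ∷ Γ) (τ ∷ σ ∷ list σ ∷ (list σ ⊗ τ) ∷ Δ)
    bodyRen θ (here p)          = there (here p)
    bodyRen θ (there (here p))  = here p
    bodyRen θ (there (there i)) = there (there (there (there (θ i))))

    bodyAgree : ∀ {Δ} (θ : Ren Γ Δ) {ρ δ x acc xs st} → Agree θ ρ δ →
                Agree (bodyRen θ) (x ∷ acc ∷ ρ) (acc ∷ x ∷ xs ∷ st ∷ δ)
    bodyAgree θ ag (here refl)         = refl
    bodyAgree θ ag (there (here refl)) = refl
    bodyAgree θ ag (there (there i))   = ag i

    body : ∀ {Δ} → Ren Γ Δ → Exp ((list σ ⊗ τ) ∷ Δ) ((list σ ⊗ τ) ⊕ τ)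
    body θ = uncons (fst (var (here refl))) (inr (snd (var (here refl))))
      (bind (snd (var (there (there (here refl)))))
        (inl (pair (var (there (there (here refl)))) (code G (bodyRen θ)))))

    stepTime : Poly
    -- A round costs ten units on top of `G`, and the last one, which finds the list empty, costs
    -- seven; 14 covers both.
    stepTime = con 14 ⊞ time G ⟨ 𝒳 ⊞ (width F ⊞ w) ⟩

  -- The accumulator has to be bounded on the prefixes of the actual list only, since these give the
  -- states that the loop passes through.
  foldlI : (∀ {ρ s} → BoundedEnv s ρ → ∀ xs ys → xs ++ ys ≡ f ρ →
              Bounded (⟪ w ⟫ s) τ (foldl (λ acc x → g (x ∷ acc ∷ ρ)) (a ρ) xs)) →
           Impl Γ τ (λ ρ → foldl (λ acc x → g (x ∷ acc ∷ ρ)) (a ρ) (f ρ))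
  foldlI inv = record
    { code  = λ θ → loop (pair (code F θ) (code A θ)) (body θ)
    ; time  = con 1 ⊞ ((con 1 ⊞ (time F ⊞ time A)) ⊞ (stepTime ⊞ width F ⊠ stepTime))
    ; width = w
    ; run   = λ θ {ρ} {δ} {s} ag ok →
        let _ , p , d = run F θ ag ok
            _ , q , e = run A θ ag ok
            _ , r , c = iterate θ ag ok [] (f ρ) refl
        in _ , node (node p q) (≤-trans r (+-monoʳ-≤ (⟪ stepTime ⟫ s)
                (*-monoˡ-≤ (⟪ stepTime ⟫ s) (proj₁ (bound F ok))))) , loop (pair d e) c
    ; bound = λ {ρ} ok → inv ok (f ρ) [] (++-identityʳ (f ρ)) }
    where
    go : ∀ ρ → ⟦ τ ⟧ → List ⟦ σ ⟧ → ⟦ τ ⟧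
    go ρ = foldl (λ acc x → g (x ∷ acc ∷ ρ))
    suffix : ∀ {s} {ρ : Env Γ} → BoundedEnv s ρ → ∀ xs {ys} → xs ++ ys ≡ f ρ →
             All (Bounded (⟪ width F ⟫ s) σ) ys
    suffix ok xs eq = drop xs (subst (All _) (sym eq) (proj₂ (bound F ok)))
      where
      drop : ∀ xs {ys} {P : ⟦ σ ⟧ → Set} → All P (xs ++ ys) → All P ys
      drop []       ps       = ps
      drop (x ∷ xs) (_ ∷ ps) = drop xs ps
    iterate : ∀ {Δ} (θ : Ren Γ Δ) {ρ δ s} → Agree θ ρ δ → BoundedEnv s ρ →
              ∀ xs ys → xs ++ ys ≡ f ρ →
              ∃[ t ] t ≤ ⟪ stepTime ⟫ s + length ys * ⟪ stepTime ⟫ s ×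
                (δ ⊢ ys , go ρ (a ρ) xs ↻ body θ ⇓ go ρ (a ρ) (f ρ) [ t ])
    iterate θ {ρ} {δ} ag ok xs [] eq =
      _ , s≤s (s≤s (s≤s (s≤s (s≤s (s≤s (s≤s z≤n)))))) ,
      subst (λ zs → δ ⊢ [] , go ρ (a ρ) xs ↻ body θ ⇓ go ρ (a ρ) zs [ _ ])
            (trans (sym (++-identityʳ xs)) eq)
            (done (uncons-nil (fst (var (here refl))) (inr (snd (var (here refl))))))
    iterate θ {ρ} {δ} {s} ag ok xs (y ∷ ys) eq =
      let eq′ = trans (++-assoc xs (y ∷ []) ys) eq
          acc-ok = inv ok xs (y ∷ ys) eq
          y-ok = All.head (suffix ok xs eq)
          widen = Bounded-mono
          _ , p , d = run G (bodyRen θ) (bodyAgree θ ag)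
            (widen σ (≤-trans (m≤m+n _ _) (m≤n+m _ s)) y-ok ∷
             widen τ (≤-trans (m≤n+m _ _) (m≤n+m _ s)) acc-ok ∷
             BoundedEnv-mono (m≤m+n s _) ok)
          u , q , e = iterate θ ag ok (xs ++ y ∷ []) ys eq′
      in _ , step p q , again (uncons-cons (fst (var (here refl)))
           (bind (snd (var (there (there (here refl)))))
             (inl (pair (var (there (there (here refl)))) d))))
           (subst (λ acc → δ ⊢ ys , acc ↻ body θ ⇓ go ρ (a ρ) (f ρ) [ u ])
             (foldl-++ (λ acc x → g (x ∷ acc ∷ ρ)) (a ρ) xs (y ∷ [])) e)
      where
      step : ∀ {t u k m} → t ≤ k → u ≤ (14 + k) + m →
             suc (9 + t + u) ≤ (14 + k) + ((14 + k) + m)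
      step p q = s≤s (s≤s (s≤s (s≤s (s≤s (s≤s (s≤s (s≤s (s≤s (s≤s
        (+-mono-≤ (≤-trans p (m≤n+m _ 4)) q))))))))))

-- Programs for list operations

v0 : Impl (σ ∷ Γ) σ (λ ρ → All.lookup ρ (here refl))
v0 = varI (here refl)

v1 : Impl (τ ∷ σ ∷ Γ) σ (λ ρ → All.lookup ρ (there (here refl)))
v1 = varI (there (here refl))

v2 : Impl (υ ∷ τ ∷ σ ∷ Γ) σ (λ ρ → All.lookup ρ (there (there (here refl))))
v2 = varI (there (there (here refl)))

wk³ : ∀ {σ₁ σ₂ σ₃ f} → Impl Γ τ f →
      Impl (σ₁ ∷ σ₂ ∷ σ₃ ∷ Γ) τ (λ ρ → f (All.tail (All.tail (All.tail ρ))))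
wk³ F = wk (wk (wk F))

wk⁴ : ∀ {σ₁ σ₂ σ₃ σ₄ f} → Impl Γ τ f →
      Impl (σ₁ ∷ σ₂ ∷ σ₃ ∷ σ₄ ∷ Γ) τ (λ ρ → f (All.tail (All.tail (All.tail (All.tail ρ)))))
wk⁴ F = wk (wk³ F)

tail⁵ : ∀ {σ₁ σ₂ σ₃ σ₄ σ₅} → Env (σ₁ ∷ σ₂ ∷ σ₃ ∷ σ₄ ∷ σ₅ ∷ Γ) → Env Γ
tail⁵ ρ = All.tail (All.tail (All.tail (All.tail (All.tail ρ))))

tail⁶ : ∀ {σ₁ σ₂ σ₃ σ₄ σ₅ σ₆} → Env (σ₁ ∷ σ₂ ∷ σ₃ ∷ σ₄ ∷ σ₅ ∷ σ₆ ∷ Γ) → Env Γ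
tail⁶ ρ = All.tail (tail⁵ ρ)

wk⁵ : ∀ {σ₁ σ₂ σ₃ σ₄ σ₅ f} → Impl Γ τ f → Impl (σ₁ ∷ σ₂ ∷ σ₃ ∷ σ₄ ∷ σ₅ ∷ Γ) τ (λ ρ → f (tail⁵ ρ))
wk⁵ F = wk (wk⁴ F)

wk₁ : ∀ {f : Env (σ ∷ Γ) → ⟦ υ ⟧} → Impl (σ ∷ Γ) υ f →
      Impl (σ ∷ τ ∷ Γ) υ (λ ρ → f (All.head ρ ∷ All.tail (All.tail ρ)))
wk₁ F = record
  { code = λ θ → code F (skip θ) ; time = time F ; width = width F
  ; run = λ { θ {_ ∷ _ ∷ _} ag (p ∷ _ ∷ ok) → run F (skip θ)
      (λ { (here refl) → ag (here refl) ; (there i) → ag (there (there i)) }) (p ∷ ok) }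
  ; bound = λ { {_ ∷ _ ∷ _} (p ∷ _ ∷ ok) → bound F (p ∷ ok) } }
  where
  skip : ∀ {σ τ Γ Δ} → Ren (σ ∷ τ ∷ Γ) Δ → Ren (σ ∷ Γ) Δ
  skip θ (here p)  = θ (here p)
  skip θ (there i) = θ (there (there i))

Bounded-++ : ∀ {s t} {xs ys : List ⟦ σ ⟧} → Bounded s (list σ) xs → Bounded t (list σ) ys →
             Bounded (s + t) (list σ) (xs ++ ys)
Bounded-++ {σ} {xs = xs} (l , ps) (m , qs) = ≤-trans (≤-reflexive (length-++ xs)) (+-mono-≤ l m) ,
  All.++⁺ (All.map (Bounded-mono σ (m≤m+n _ _)) ps) (All.map (Bounded-mono σ (m≤n+m _ _)) qs)

Bounded-prefix : ∀ {s} xs {ys zs : List ⟦ σ ⟧} → xs ++ ys ≡ zs → Bounded s (list σ) zs → Bounded s (list σ) xs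
Bounded-prefix xs {ys} refl (l , ps) =
  ≤-trans (≤-trans (m≤m+n _ _) (≤-reflexive (sym (length-++ xs)))) l , All.++⁻ˡ xs ps

foldlI′ : ∀ {f a} {g : Env (σ ∷ τ ∷ Γ) → ⟦ τ ⟧} (F : Impl Γ (list σ) f) (A : Impl Γ τ a) (G : Impl (σ ∷ τ ∷ Γ) τ g)
  (w : Poly) →
  (∀ {ρ s} → BoundedEnv s ρ → ∀ xs → Bounded (⟪ width F ⟫ s) (list σ) xs →
     Bounded (⟪ w ⟫ s) τ (foldl (λ acc x → g (x ∷ acc ∷ ρ)) (a ρ) xs)) →
  Impl Γ τ (λ ρ → foldl (λ acc x → g (x ∷ acc ∷ ρ)) (a ρ) (f ρ))
foldlI′ F A G w inv = foldlI F A G w λ ok xs ys eq → inv ok xs (Bounded-prefix xs eq (bound F ok))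

Bounded-reverse : ∀ {s} {xs : List ⟦ σ ⟧} → Bounded s (list σ) xs → Bounded s (list σ) (reverse xs)
Bounded-reverse {σ} {xs = xs} (l , ps) = ≤-trans (≤-reflexive (length-reverse xs)) l , go ps []
  where
  go : ∀ {P : ⟦ σ ⟧ → Set} {xs ys} → All P xs → All P ys → All P (foldl (λ zs x → x ∷ zs) ys xs)
  go []       qs = qs
  go (p ∷ ps) qs = go ps (p ∷ qs)

reverseI : ∀ {f} → Impl Γ (list σ) f → Impl Γ (list σ) (λ ρ → reverse (f ρ))
reverseI F = foldlI′ F nilI (consI v0 v1) (width F) λ ok xs → Bounded-reverse

foldrI : ∀ {f a} {g : Env (σ ∷ τ ∷ Γ) → ⟦ τ ⟧} (F : Impl Γ (list σ) f) (A : Impl Γ τ a) (G : Impl (σ ∷ τ ∷ Γ) τ g)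
  (w : Poly) →
  (∀ {ρ s} → BoundedEnv s ρ → ∀ xs → Bounded (⟪ width F ⟫ s) (list σ) xs →
     Bounded (⟪ w ⟫ s) τ (foldr (λ x acc → g (x ∷ acc ∷ ρ)) (a ρ) xs)) →
  Impl Γ τ (λ ρ → foldr (λ x acc → g (x ∷ acc ∷ ρ)) (a ρ) (f ρ))
foldrI {f = f} {a} {g} F A G w inv = castI
  (λ ρ → reverse-foldl (λ acc x → g (x ∷ acc ∷ ρ)) (a ρ) (f ρ))
  (foldlI′ (reverseI F) A G w λ {ρ} ok xs b →
    subst (Bounded _ _)
      (trans (sym (reverse-foldl (λ acc x → g (x ∷ acc ∷ ρ)) (a ρ) (reverse xs)))
             (cong (foldl (λ acc x → g (x ∷ acc ∷ ρ)) (a ρ)) (reverse-involutive xs)))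
      (inv ok (reverse xs) (Bounded-reverse b)))

mapI : ∀ {f} {g : Env (σ ∷ Γ) → ⟦ τ ⟧} → Impl Γ (list σ) f → Impl (σ ∷ Γ) τ g →
       Impl Γ (list τ) (λ ρ → map (λ x → g (x ∷ ρ)) (f ρ))
mapI {σ} {Γ} {τ} {f} {g} F G = castI (λ ρ → as-foldr ρ (f ρ))
  (foldrI F nilI (consI (wk₁ G) v1) w
    λ {ρ} ok xs b → subst (Bounded _ _) (sym (as-foldr ρ xs)) (bounded ok xs b))
  where
  w = width F ⊞ width G ⟨ 𝒳 ⊞ width F ⟩
  as-foldr : ∀ ρ xs → foldr (λ x acc → g (x ∷ ρ) ∷ acc) [] xs ≡ map (λ x → g (x ∷ ρ)) xs
  as-foldr ρ []       = refl
  as-foldr ρ (x ∷ xs) = cong (g (x ∷ ρ) ∷_) (as-foldr ρ xs)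
  bounded : ∀ {ρ s} → BoundedEnv s ρ → ∀ xs → Bounded (⟪ width F ⟫ s) (list σ) xs →
            Bounded (⟪ w ⟫ s) (list τ) (map (λ x → g (x ∷ ρ)) xs)
  bounded {s = s} ok xs (l , ps) = ≤-trans (≤-reflexive (length-map _ xs)) (≤-trans l (m≤m+n _ _)) ,
    All.map⁺ (All.map (λ p → Bounded-mono τ (m≤n+m _ _) (bound G
      (Bounded-mono σ (m≤n+m _ s) p ∷ BoundedEnv-mono (m≤m+n s _) ok))) ps)

filterI : ∀ {f} {g : Env (σ ∷ Γ) → Bool} → Impl Γ (list σ) f → Impl (σ ∷ Γ) bool g →
          Impl Γ (list σ) (λ ρ → filterᵇ (λ x → g (x ∷ ρ)) (f ρ))
filterI {σ} {Γ} {f} {g} F G = castI (λ ρ → as-foldr ρ (f ρ))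
  (foldrI F nilI (ifI (wk₁ G) (consI v0 v1) v1) (width F)
    λ {ρ} ok xs b → subst (Bounded _ _) (sym (as-foldr ρ xs))
      (≤-trans (length-filter (λ x → T? (g (x ∷ ρ))) xs) (proj₁ b) , All.filter⁺ (λ x → T? (g (x ∷ ρ))) (proj₂ b)))
  where
  as-foldr : ∀ ρ xs → foldr (λ x acc → if g (x ∷ ρ) then x ∷ acc else acc) [] xs ≡ filterᵇ (λ x → g (x ∷ ρ)) xs
  as-foldr ρ []       = refl
  as-foldr ρ (x ∷ xs) with g (x ∷ ρ)
  ... | true  = cong (x ∷_) (as-foldr ρ xs)
  ... | false = as-foldr ρ xs

notI : ∀ {f} → Impl Γ bool f → Impl Γ bool (λ ρ → not (f ρ))
notI {f = f} F = castI (λ ρ → lemma (f ρ)) (ifI F falseI trueI)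
  where
  lemma : ∀ b → (if b then false else true) ≡ not b
  lemma true  = refl
  lemma false = refl

∧I : ∀ {f g} → Impl Γ bool f → Impl Γ bool g → Impl Γ bool (λ ρ → f ρ ∧ g ρ)
∧I {f = f} {g} F G = castI (λ ρ → lemma (f ρ) (g ρ)) (ifI F G falseI)
  where
  lemma : ∀ a b → (if a then b else false) ≡ a ∧ b
  lemma true  b = refl
  lemma false b = refl

∨I : ∀ {f g} → Impl Γ bool f → Impl Γ bool g → Impl Γ bool (λ ρ → f ρ ∨ g ρ)
∨I {f = f} {g} F G = castI (λ ρ → lemma (f ρ) (g ρ)) (ifI F trueI G)
  where
  lemma : ∀ a b → (if a then true else b) ≡ a ∨ b
  lemma true  b = refl
  lemma false b = refl

anyI : ∀ {f} {g : Env (σ ∷ Γ) → Bool} → Impl Γ (list σ) f → Impl (σ ∷ Γ) bool g →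
       Impl Γ bool (λ ρ → any (λ x → g (x ∷ ρ)) (f ρ))
anyI {σ} {Γ} {f} {g} F G = castI (λ ρ → as-foldr ρ (f ρ))
  (foldrI F falseI (∨I (wk₁ G) v1) (con 0) λ _ _ _ → tt)
  where
  as-foldr : ∀ ρ xs → foldr (λ x acc → g (x ∷ ρ) ∨ acc) false xs ≡ any (λ x → g (x ∷ ρ)) xs
  as-foldr ρ []       = refl
  as-foldr ρ (x ∷ xs) = cong (g (x ∷ ρ) ∨_) (as-foldr ρ xs)

infixr 5 _++I_
_++I_ : ∀ {f g} → Impl Γ (list σ) f → Impl Γ (list σ) g → Impl Γ (list σ) (λ ρ → f ρ ++ g ρ)
_++I_ {Γ} {σ} {f} {g} F G = castI (λ ρ → as-foldr ρ (f ρ)) (foldrI F G (consI v0 v1) (width F ⊞ width G)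
  λ {ρ} ok xs b → subst (Bounded _ _) (sym (as-foldr ρ xs)) (Bounded-++ b (bound G ok)))
  where
  as-foldr : ∀ ρ xs → foldr _∷_ (g ρ) xs ≡ xs ++ g ρ
  as-foldr ρ []       = refl
  as-foldr ρ (x ∷ xs) = cong (x ∷_) (as-foldr ρ xs)

concatMapI : ∀ {f} {g : Env (σ ∷ Γ) → List ⟦ τ ⟧} → Impl Γ (list σ) f → Impl (σ ∷ Γ) (list τ) g →
             Impl Γ (list τ) (λ ρ → concatMap (λ x → g (x ∷ ρ)) (f ρ))
concatMapI {σ} {Γ} {τ} {f} {g} F G = castI (λ ρ → as-foldr ρ (f ρ))
  (foldrI F nilI (wk₁ G ++I v1) (wG ⊞ width F ⊠ wG) λ {ρ} {s} ok xs b →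
    subst (Bounded (⟪ wG ⊞ width F ⊠ wG ⟫ s) (list τ)) (sym (as-foldr ρ xs))
      (≤-trans (len ok xs (proj₂ b)) (≤-trans (*-monoˡ-≤ (⟪ wG ⟫ s) (proj₁ b)) (m≤n+m _ _)) ,
       All.map (Bounded-mono τ (m≤m+n _ _)) (elems ok xs (proj₂ b))))
  where
  wG = width G ⟨ 𝒳 ⊞ width F ⟩
  as-foldr : ∀ ρ xs → foldr (λ x acc → g (x ∷ ρ) ++ acc) [] xs ≡ concatMap (λ x → g (x ∷ ρ)) xs
  as-foldr ρ []       = refl
  as-foldr ρ (x ∷ xs) = cong (g (x ∷ ρ) ++_) (as-foldr ρ xs)
  one : ∀ {ρ s x} → BoundedEnv s ρ → Bounded (⟪ width F ⟫ s) σ x → Bounded (⟪ wG ⟫ s) (list τ) (g (x ∷ ρ))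
  one {s = s} ok p = bound G (Bounded-mono σ (m≤n+m _ s) p ∷ BoundedEnv-mono (m≤m+n s _) ok)
  len : ∀ {ρ s} → BoundedEnv s ρ → ∀ xs → All (Bounded (⟪ width F ⟫ s) σ) xs →
        length (concatMap (λ x → g (x ∷ ρ)) xs) ≤ length xs * ⟪ wG ⟫ s
  len ok []       []       = z≤n
  len {ρ} ok (x ∷ xs) (p ∷ ps) = ≤-trans (≤-reflexive (length-++ (g (x ∷ ρ))))
    (+-mono-≤ (proj₁ (one ok p)) (len ok xs ps))
  elems : ∀ {ρ s} → BoundedEnv s ρ → ∀ xs → All (Bounded (⟪ width F ⟫ s) σ) xs →
          All (Bounded (⟪ wG ⟫ s) τ) (concatMap (λ x → g (x ∷ ρ)) xs)
  elems ok []       []       = []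
  elems ok (x ∷ xs) (p ∷ ps) = All.++⁺ (proj₂ (one ok p)) (elems ok xs ps)

drop₁ : ∀ {A : Set} → List A → List A
drop₁ xs = match xs [] λ _ ys → ys

infix 4 _≤I_
-- Numbers are represented by lists: one element of the first list is dropped for each element of
-- the second, and nothing is left exactly if the inequality holds.
_≤I_ : ∀ {f g} → Impl Γ (list σ) f → Impl Γ (list τ) g → Impl Γ bool (λ ρ → length (f ρ) ≤ᵇ length (g ρ))
_≤I_ {Γ} {σ} {τ} {f} {g} F G = castI (λ ρ → lemma (f ρ) (g ρ))
  (unconsI (foldlI′ G F (unconsI v1 nilI v1) (width F) (λ ok xs _ → bounded xs (bound F ok))) trueI falseI)
  where
  bounded : ∀ {s xs} (ys : List ⟦ τ ⟧) → Bounded s (list σ) xs →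
            Bounded s (list σ) (foldl (λ xs _ → drop₁ xs) xs ys)
  bounded []       b = b
  bounded {xs = []}     (y ∷ ys) b            = bounded ys b
  bounded {xs = x ∷ xs} (y ∷ ys) (l , _ ∷ ps) = bounded ys (≤-trans (n≤1+n _) l , ps)
  ≤ᵇ-suc : ∀ m n → (m ≤ᵇ n) ≡ (m <ᵇ suc n)
  ≤ᵇ-suc zero    n = refl
  ≤ᵇ-suc (suc m) n = refl
  lemma : ∀ xs ys → match (foldl (λ xs _ → drop₁ xs) xs ys) true (λ _ _ → false) ≡ (length xs ≤ᵇ length ys)
  lemma []       []       = refl
  lemma []       (y ∷ ys) = lemma [] ys
  lemma (x ∷ xs) []       = refl
  lemma (x ∷ xs) (y ∷ ys) = trans (lemma xs ys) (≤ᵇ-suc (length xs) (length ys))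

repeat : ∀ {A : Set} → ℕ → List A → List A
repeat zero    xs = []
repeat (suc k) xs = xs ++ repeat k xs

length-repeat : ∀ {A : Set} k (xs : List A) → length (repeat k xs) ≡ k * length xs
length-repeat zero    xs = refl
length-repeat (suc k) xs = trans (length-++ xs) (cong (length xs +_) (length-repeat k xs))

repeatI : ∀ k {f} → Impl Γ (list σ) f → Impl Γ (list σ) (λ ρ → repeat k (f ρ))
repeatI zero    F = nilI
repeatI (suc k) F = F ++I repeatI k F

-- A clock in unary: the list is as long as the value of the polynomial and serves as the fuel of
-- the search.
units : ∀ {A : Set} → Poly → List A → List ⊤
units (con c)   xs = repeat c (tt ∷ [])
units 𝒳         xs = map (λ _ → tt) xs
units (p ⊞ q)   xs = units p xs ++ units q xs
units (p ⊠ q)   xs = concatMap (λ _ → units q xs) (units p xs)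
units (p ⟨ q ⟩) xs = units p (units q xs)

length-units : ∀ {A : Set} p (xs : List A) → length (units p xs) ≡ ⟪ p ⟫ (length xs)
length-units (con c)   xs = trans (length-repeat c (tt ∷ [])) (*-identityʳ c)
length-units 𝒳         xs = length-map _ xs
length-units (p ⊞ q)   xs = trans (length-++ (units p xs)) (cong₂ _+_ (length-units p xs) (length-units q xs))
length-units (p ⊠ q)   xs = trans (go (units p xs)) (cong₂ _*_ (length-units p xs) (length-units q xs))
  where
  go : ∀ us → length (concatMap (λ _ → units q xs) us) ≡ length us * length (units q xs)
  go []       = refl
  go (_ ∷ us) = trans (length-++ (units q xs)) (cong (length (units q xs) +_) (go us))
length-units (p ⟨ q ⟩) xs = trans (length-units p (units q xs)) (cong ⟪ p ⟫ (length-units q xs))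

unitsI : ∀ p {f} → Impl Γ (list σ) f → Impl Γ (list unit) (λ ρ → units p (f ρ))
unitsI (con c)   F = repeatI c (consI unitI nilI)
unitsI 𝒳         F = mapI F unitI
unitsI (p ⊞ q)   F = unitsI p F ++I unitsI q F
unitsI (p ⊠ q)   F = concatMapI (unitsI p F) (wk (unitsI q F))
unitsI (p ⟨ q ⟩) F = unitsI p (unitsI q F)

-- Counting in lists

private
  variable
    α γ : Set

T-not⁻ : ∀ {b} → T (not b) → ¬ T b
T-not⁻ {true}  ()
T-not⁻ {false} _ ()

T-not⁺ : ∀ {b} → ¬ T b → T (not b)
T-not⁺ {true}  ¬b = ¬b _
T-not⁺ {false} _  = _

count : (α → Bool) → List α → ℕ
count p xs = length (filterᵇ p xs)

bit : Bool → ℕ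
bit b = if b then 1 else 0

count-∷ : ∀ (p : α → Bool) x xs → count p (x ∷ xs) ≡ bit (p x) + count p xs
count-∷ p x xs with p x
... | true  = refl
... | false = refl

filterᵇ-∷ : ∀ (p : α → Bool) x xs →
            filterᵇ p (x ∷ xs) ≡ (if p x then (x ∷_) else id) (filterᵇ p xs)
filterᵇ-∷ p x xs with p x
... | true  = refl
... | false = refl

bit-mono : ∀ {a b} → (T a → T b) → bit a ≤ bit b
bit-mono {true}  {true}  f = ≤-refl
bit-mono {true}  {false} f = contradiction _ f
bit-mono {false} {_}     f = z≤n

count-some : ∀ (p : α → Bool) {xs} → Any (T ∘ p) xs → 1 ≤ count p xs
count-some p = filter-some (T? ∘ p)

count-none : ∀ (p : α → Bool) {xs} → All (λ x → ¬ T (p x)) xs → count p xs ≡ 0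
count-none p ¬ps = cong length (filter-none (T? ∘ p) ¬ps)

count-mono : ∀ (p q : α → Bool) xs → (∀ {x} → x ∈ˡ xs → T (p x) → T (q x)) → count p xs ≤ count q xs
count-mono p q []       imp = z≤n
count-mono p q (x ∷ xs) imp rewrite count-∷ p x xs | count-∷ q x xs =
  +-mono-≤ (bit-mono (imp (here refl))) (count-mono p q xs (imp ∘ there))

count-filterᵇ : ∀ (p q : α → Bool) xs → count p (filterᵇ q xs) ≤ count p xs
count-filterᵇ p q []       = z≤n
count-filterᵇ p q (x ∷ xs) with q x
... | false = ≤-trans (count-filterᵇ p q xs)
                (≤-trans (m≤n+m _ (bit (p x))) (≤-reflexive (sym (count-∷ p x xs))))
... | true  = ≤-trans (≤-reflexive (count-∷ p x _))
                (≤-trans (+-monoʳ-≤ (bit (p x)) (count-filterᵇ p q xs)) (≤-reflexive (sym (count-∷ p x xs))))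

count-∨ : ∀ (p q : α → Bool) xs → count (λ x → p x ∨ q x) xs ≤ count p xs + count q xs
count-∨ p q []       = z≤n
count-∨ p q (x ∷ xs) with p x | q x | count-∨ p q xs
... | false | false | ih = ih
... | true  | false | ih = s≤s ih
... | false | true  | ih = ≤-trans (s≤s ih) (≤-reflexive (sym (+-suc _ _)))
... | true  | true  | ih = s≤s (≤-trans ih (+-monoʳ-≤ _ (n≤1+n _)))

count-not : ∀ (p : α → Bool) xs → count p xs + count (not ∘ p) xs ≡ length xs
count-not p []       = refl
count-not p (x ∷ xs) with p x | count-not p xs
... | true  | ih = cong suc ih
... | false | ih = trans (+-suc _ _) (cong suc ih)

count-≤1 : ∀ {R : α → α → Set} (p : α → Bool) {xs} → AllPairs R xs →
           (∀ {x y} → T (p x) → T (p y) → ¬ R x y) → count p xs ≤ 1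
count-≤1 p []         ¬R = z≤n
count-≤1 p {x ∷ xs} (rs ∷ rss) ¬R with p x in eq
... | false = count-≤1 p rss ¬R
... | true  = s≤s (≤-reflexive (count-none p
                (All.map (λ r py → ¬R (subst T (sym eq) _) py r) rs)))

∈-filterᵇ⁺ : ∀ (p : α → Bool) {x xs} → x ∈ˡ xs → T (p x) → x ∈ˡ filterᵇ p xs
∈-filterᵇ⁺ p = ∈-filter⁺ (T? ∘ p)

∈-filterᵇ⁻ : ∀ (p : α → Bool) xs {x} → x ∈ˡ filterᵇ p xs → x ∈ˡ xs × T (p x)
∈-filterᵇ⁻ p xs = ∈-filter⁻ (T? ∘ p)

∑ : (α → ℕ) → List α → ℕ
∑ f = foldr (λ x n → f x + n) 0

∑-lower : ∀ {u} {f : α → ℕ} {xs} → All (λ x → u ≤ f x) xs → u * length xs ≤ ∑ f xs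
∑-lower {u = u} []       = ≤-reflexive (*-zeroʳ u)
∑-lower {u = u} (p ∷ ps) = ≤-trans (≤-reflexive (*-suc u _)) (+-mono-≤ p (∑-lower ps))

∑-upper : ∀ {c} {f : α → ℕ} {xs} → All (λ x → f x ≤ c) xs → ∑ f xs ≤ c * length xs
∑-upper {c = c} []       = z≤n
∑-upper {c = c} (p ∷ ps) = ≤-trans (+-mono-≤ p (∑-upper ps)) (≤-reflexive (sym (*-suc c _)))

∑-+ : ∀ (f g : α → ℕ) xs → ∑ (λ x → f x + g x) xs ≡ ∑ f xs + ∑ g xs
∑-+ f g []       = refl
∑-+ f g (x ∷ xs) = trans (cong (f x + g x +_) (∑-+ f g xs)) (interchange (f x) (g x) _ _)
  where
  interchange : ∀ a b c d → a + b + (c + d) ≡ a + c + (b + d)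
  interchange = solve-∀

∑-cong : ∀ {f g : α → ℕ} → (∀ x → f x ≡ g x) → ∀ xs → ∑ f xs ≡ ∑ g xs
∑-cong f≗g []       = refl
∑-cong f≗g (x ∷ xs) = cong₂ _+_ (f≗g x) (∑-cong f≗g xs)

∑-bit : ∀ (p : α → Bool) xs → ∑ (bit ∘ p) xs ≡ count p xs
∑-bit p []       = refl
∑-bit p (x ∷ xs) = trans (cong (bit (p x) +_) (∑-bit p xs)) (sym (count-∷ p x xs))

∑-0 : ∀ (xs : List α) → ∑ (λ _ → 0) xs ≡ 0
∑-0 []       = refl
∑-0 (x ∷ xs) = ∑-0 xs

∑-swap : ∀ (R : α → γ → Bool) xs ys →
         ∑ (λ x → count (R x) ys) xs ≡ ∑ (λ y → count (λ x → R x y) xs) ys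
∑-swap R []       ys = sym (∑-0 ys)
∑-swap R (x ∷ xs) ys = begin
  count (R x) ys + ∑ (λ x → count (R x) ys) xs
    ≡⟨ cong₂ _+_ (sym (∑-bit (R x) ys)) (∑-swap R xs ys) ⟩
  ∑ (λ y → bit (R x y)) ys + ∑ (λ y → count (λ x → R x y) xs) ys
    ≡⟨ sym (∑-+ (λ y → bit (R x y)) _ ys) ⟩
  ∑ (λ y → bit (R x y) + count (λ x → R x y) xs) ys
    ≡⟨ ∑-cong (λ y → sym (count-∷ (λ x → R x y) x xs)) ys ⟩
  ∑ (λ y → count (λ x → R x y) (x ∷ xs)) ys ∎
  where open ≡-Reasoning

-- The pairs related by `R` are counted in both orders. With `u = c = 1` this doubles as the
-- principle that an injection cannot shrink.
double-counting : ∀ (R : α → γ → Bool) xs ys {u c} →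
  All (λ x → u ≤ count (R x) ys) xs → All (λ y → count (λ x → R x y) xs ≤ c) ys →
  u * length xs ≤ c * length ys
double-counting R xs ys lower upper =
  ≤-trans (∑-lower lower) (≤-trans (≤-reflexive (∑-swap R xs ys)) (∑-upper upper))

AllPairs-lookup : ∀ {R : α → α → Set} {xs x y} → (∀ {x y} → R x y → R y x) →
  AllPairs R xs → x ∈ˡ xs → y ∈ˡ xs → x ≡ y ⊎ R x y
AllPairs-lookup s (rs ∷ rss) (here refl) (here refl) = inj₁ refl
AllPairs-lookup s (rs ∷ rss) (here refl) (there j)   = inj₂ (All.lookup rs j)
AllPairs-lookup s (rs ∷ rss) (there i)   (here refl) = inj₂ (s (All.lookup rs i))
AllPairs-lookup s (rs ∷ rss) (there i)   (there j)   = AllPairs-lookup s rss i j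

-- The local search

-- An edge that does not even meet itself is the placeholder {a} of a vertex a
-- not matched so far. Hence M has exactly one member for each vertex of A, and
-- augmenting is mapping `replace` over M. Layers are listed latest first.
module Algorithm {Edge : Set} (sameA meetB : Edge → Edge → Bool) (E : List Edge) (U p q : ℕ) where

  Layer : Set
  Layer = List Edge × List Edge

  meets : List Edge → Edge → Bool
  meets xs e = any (meetB e) xs

  blockers : List Edge → List Edge → List Edge
  blockers M X = filterᵇ (meets X) M

  -- Only the `X` parts are stored. Their blockers are recomputed from the current matching, so a
  -- swap leaves no stale ones behind.
  annotate : List Edge → List (List Edge) → List Layer
  annotate M = map (λ X → X , blockers M X)

  source : Edge → List Layer → List Edge
  source root []            = root ∷ []
  source root ((_ , Y) ∷ _) = Y

  used : List Layer → List Edge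
  used = concatMap (λ Z → proj₁ Z ++ proj₂ Z)

  allY : List Layer → List Edge
  allY = concatMap proj₂

  degree : List Edge → Edge → ℕ
  degree X e = count (sameA e) X

  addable : List Edge → List Edge → List Edge → List Edge → Edge → Bool
  addable M s u X e =
    any (sameA e) s ∧ (not (meets (X ++ (blockers M X ++ u)) e) ∧ (degree X e <ᵇ U))

  add : List Edge → List Edge → List Edge → List Edge → Edge → List Edge
  add M s u X e = if addable M s u X e then e ∷ X else X

  extend : List Edge → List Edge → List Edge → List Edge → List Edge
  extend M s u X = foldl (add M s u) X E

  insert : Edge → List Edge → List Edge
  insert e N = if any (sameA e) N then N else e ∷ N

  -- A source can be exchanged for one edge only, so among the unblocked edges one of each key is
  -- retained.
  fresh : List Edge → List Edge → List Edge
  fresh Y X = foldr insert [] (filterᵇ (not ∘ meets Y) X)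

  replace : List Edge → Edge → Edge
  replace N f = foldr (λ g h → if sameA f g then g else h) f N

  roots : List Edge → List Edge
  roots = filterᵇ (λ e → not (meetB e e))

  State : Set
  State = List Edge × List (List Edge)

  module Top (M : List Edge) (root : Edge) (X : List Edge) (Ls : List (List Edge)) where
    Zs : List Layer
    Zs = annotate M Ls
    s X⁺ Y⁺ N : List Edge
    s  = source root Zs
    X⁺ = extend M s (used Zs) X
    Y⁺ = blockers M X⁺
    N  = fresh Y⁺ X⁺
    collapsible small : Bool
    collapsible = length s ≤ᵇ p * length N
    small = q * length X⁺ ≤ᵇ length (allY Zs)
    next : State
    -- If `small` holds, even the extension of `X` is discarded: an unchanged state signals the end,
    -- and `output` repeats the extension.
    next = if collapsible then map (replace N) M , Ls
           else if small then M , X ∷ Ls else M , [] ∷ X⁺ ∷ Ls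

  step : State → State
  step (M , Ls) = match (roots M) (M , Ls) λ root _ →
    match Ls (M , [] ∷ []) λ X Ls′ → Top.next M root X Ls′

  -- Only at sources below the cap does the maximality of `X` force every edge to be hit, so the
  -- saturated ones are left out.
  opens : Edge → List Layer → List Edge
  opens root []             = []
  opens root ((X , Y) ∷ Zs) = filterᵇ (λ f → degree X f <ᵇ U) (source root Zs) ++ opens root Zs

  output : State → List Edge ⊎ List Edge
  output (M , Ls) = match (roots M) (inj₁ M) λ root _ →
    match Ls (inj₁ M) λ X Ls′ → let open Top M root X Ls′ in
      inj₂ (opens root ((X⁺ , Y⁺) ∷ Zs))

-- Correctness of the local search

module Correctness {Edge K : Set} (key : Edge → K) (sameA meetB : Edge → Edge → Bool)
  (sameA⇒key : ∀ {e f} → T (sameA e f) → key e ≡ key f)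
  (key⇒sameA : ∀ {e f} → key e ≡ key f → T (sameA e f))
  (meetB-sym : ∀ {e f} → T (meetB e f) → T (meetB f e))
  (meetB-self : ∀ {e f} → T (meetB e f) → T (meetB e e))
  (E : List Edge) (E-real : ∀ {e} → e ∈ˡ E → T (meetB e e)) (b : ℕ)
  (E-meets : ∀ {e M} → e ∈ˡ E → All (λ f → f ∈ˡ E ⊎ ¬ T (meetB f f)) M →
             AllPairs (λ f g → ¬ T (meetB f g)) M → count (meetB e) M ≤ b)
  (U p q : ℕ)
  where

  open Algorithm sameA meetB E U p q

  _#_ : Edge → Edge → Set
  e # f = ¬ T (meetB e f)

  #-sym : ∀ {e f} → e # f → f # e
  #-sym e#f m = e#f (meetB-sym m)

  meets⁺ : ∀ {e f} xs → f ∈ˡ xs → T (meetB e f) → T (meets xs e)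
  meets⁺ {e} {f} xs i m = Any.any⁺ (meetB e) (Any.map (λ { refl → m }) i)

  meets⁻ : ∀ {e} xs → T (meets xs e) → ∃[ f ] f ∈ˡ xs × T (meetB e f)
  meets⁻ {e} xs m = let f , i , n = find (Any.any⁻ (meetB e) xs m) in f , i , n

  ¬meets : ∀ {e} xs → ¬ T (meets xs e) → ∀ {f} → f ∈ˡ xs → e # f
  ¬meets xs ¬m i m = ¬m (meets⁺ xs i m)

  blockers⁺ : ∀ M X {e f} → f ∈ˡ M → e ∈ˡ X → T (meetB f e) → f ∈ˡ blockers M X
  blockers⁺ M X i j m = ∈-filterᵇ⁺ (meets X) i (meets⁺ X j m)

  blockers⁻ : ∀ M X {f} → f ∈ˡ blockers M X → f ∈ˡ M × ∃[ e ] e ∈ˡ X × T (meetB f e)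
  blockers⁻ M X i = let j , m = ∈-filterᵇ⁻ (meets X) M i in j , meets⁻ X m

  Distinct : List Edge → Set
  Distinct = AllPairs λ e f → key e ≢ key f

  record IsMatching (M : List Edge) : Set where
    field
      real     : All (λ f → f ∈ˡ E ⊎ f # f) M
      apart    : AllPairs _#_ M
      distinct : Distinct M

  -- `touching` and `single` attach each edge of `Y` to exactly one edge of `X`: the former saves a
  -- vertex for each edge of `Y` in the cover, the latter bounds `X` in terms of `Y`.
  record IsLayer (s u X Y : List Edge) : Set where
    field
      edges    : All (_∈ˡ E) X
      sourced  : All (λ e → Any (λ f → key e ≡ key f) s) X
      avoids   : ∀ {e f} → e ∈ˡ X → f ∈ˡ u → e # f
      apart    : AllPairs _#_ X
      single   : All (λ f → count (meetB f) X ≤ 1) Y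
      capped   : All (λ f → degree X f ≤ U) s
      touching : ∀ {f} → f ∈ˡ Y → ∃[ e ] e ∈ˡ X × T (meetB f e)
      spread   : length Y ≤ b * length X

  -- The reasons for which a maximal `X` rejects an edge. Both persist while `X` grows, as a blocker
  -- of the smaller set also blocks the larger one.
  data Covered (u X Y : List Edge) (e : Edge) : Set where
    hit  : ∀ {f} → f ∈ˡ X ++ (Y ++ u) → T (meetB e f) → Covered u X Y e
    full : U ≤ degree X e → Covered u X Y e

  degree-cong : ∀ X {e f} → key e ≡ key f → degree X e ≤ degree X f
  degree-cong X {e} {f} k = count-mono (sameA e) (sameA f) X λ _ m → key⇒sameA (trans (sym k) (sameA⇒key m))

  degree≤1 : ∀ {N} → Distinct N → ∀ e → degree N e ≤ 1
  degree≤1 ne e = count-≤1 (sameA e) ne λ p q ne → ne (trans (sym (sameA⇒key p)) (sameA⇒key q))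

  capacity : ∀ {s u X Y} → IsLayer s u X Y → length X ≤ U * length s
  capacity {s} {u} {X} L = subst (_≤ U * length s) (+-identityʳ (length X))
    (double-counting sameA X s
      (All.map (λ {e} a → count-some (sameA e) (Any.map key⇒sameA a)) sourced)
      (All.map (λ {f} d → ≤-trans (count-mono (λ e → sameA e f) (sameA f) X λ _ m → key⇒sameA (sym (sameA⇒key m))) d) capped))
    where open IsLayer L

  -- Each blocker meets an edge of `X`, and an edge of `X` meets at most `b` members of a matching.
  spread-out : ∀ {M X} → IsMatching M → All (_∈ˡ E) X → length (blockers M X) ≤ b * length X
  spread-out {M} {X} Mok X⊆E = subst (_≤ b * length X) (+-identityʳ _)
    (double-counting meetB (blockers M X) X
      (All.tabulate λ {f} i → let _ , e , j , m = blockers⁻ M X i in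
        count-some (meetB f) (Any.map (λ { refl → m }) j))
      (All.map (λ {e} e∈E → ≤-trans
        (≤-trans (count-mono (λ f → meetB f e) (meetB e) (blockers M X) λ _ → meetB-sym)
          (count-filterᵇ (meetB e) (meets X) M)) (E-meets e∈E real apart)) X⊆E))
    where
    open IsMatching Mok

  -- A new edge of X brings in at most b blockers, so while the source of a layer
  -- is unchanged its potential cannot increase, and it drops with every blocker
  -- removed.
  potential : List Edge → List Edge → List Edge → ℕ
  potential s X Y = b * (U * length s ∸ length X) + length Y

  module _ {M s u : List Edge} (Mok : IsMatching M) where
    private module M = IsMatching Mok

    blockers-∷ : ∀ e X → length (blockers M (e ∷ X)) ≤ count (meetB e) M + length (blockers M X)
    blockers-∷ e X = ≤-trans (count-∨ (λ f → meetB f e) (meets X) M)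
      (+-monoˡ-≤ _ (count-mono (λ f → meetB f e) (meetB e) M λ _ → meetB-sym))

    add-layer : ∀ {X e} → IsLayer s u X (blockers M X) → e ∈ˡ E → T (addable M s u X e) →
                IsLayer s u (e ∷ X) (blockers M (e ∷ X))
    add-layer {X} {e} L e∈E ok = record
      { edges    = e∈E ∷ edges
      ; sourced  = Any.map sameA⇒key (Any.any⁻ (sameA e) s ok₁) ∷ sourced
      ; avoids   = λ { (here refl) j → new (∈-++⁺ʳ X (∈-++⁺ʳ (blockers M X) j)) ; (there i) j → avoids i j }
      ; apart    = All.tabulate (λ i → new (∈-++⁺ˡ i)) ∷ apart
      ; single   = All.tabulate single′
      ; capped   = All.tabulate capped′
      ; touching = λ i → proj₂ (blockers⁻ M (e ∷ X) i)
      ; spread   = spread-out Mok (e∈E ∷ edges)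
      }
      where
      open IsLayer L
      ok₁ = proj₁ (Equivalence.to T-∧ ok)
      ok₂ = proj₁ (Equivalence.to T-∧ (proj₂ (Equivalence.to (T-∧ {any (sameA e) s}) ok)))
      ok₃ = <ᵇ⇒< (degree X e) U (proj₂ (Equivalence.to (T-∧ {not (meets (X ++ (blockers M X ++ u)) e)})
              (proj₂ (Equivalence.to (T-∧ {any (sameA e) s}) ok))))
      new : ∀ {f} → f ∈ˡ X ++ (blockers M X ++ u) → e # f
      new = ¬meets (X ++ (blockers M X ++ u)) (T-not⁻ ok₂)
      single′ : ∀ {f} → f ∈ˡ blockers M (e ∷ X) → count (meetB f) (e ∷ X) ≤ 1
      single′ {f} i with blockers⁻ M (e ∷ X) i
      ... | f∈M , g , j , m with meetB f e in eq
      -- If `f` meets the new edge `e`, it cannot have blocked `X` before, because `e` avoids the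
      -- old blockers.
      ... | true  = s≤s (≤-reflexive (count-none (meetB f) (All.tabulate λ k fk →
                      new (∈-++⁺ʳ X (∈-++⁺ˡ (blockers⁺ M X f∈M k fk))) (meetB-sym (subst T (sym eq) _)))))
      ... | false = All.lookup single (blockers⁺ M X f∈M (tail j) m)
        where
        tail : g ∈ˡ e ∷ X → g ∈ˡ X
        tail (here refl) = contradiction m (subst (¬_ ∘ T) (sym eq) id)
        tail (there k)   = k
      capped′ : ∀ {f} → f ∈ˡ s → degree (e ∷ X) f ≤ U
      capped′ {f} i with sameA f e in eq
      ... | true  = ≤-trans (s≤s (degree-cong X (sameA⇒key (subst T (sym eq) _)))) ok₃
      ... | false = All.lookup capped i

    potential-∷ : ∀ {X e} → e ∈ˡ E → IsLayer s u (e ∷ X) (blockers M (e ∷ X)) →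
      potential s (e ∷ X) (blockers M (e ∷ X)) ≤ potential s X (blockers M X)
    potential-∷ {X} {e} e∈E L = begin
      b * (U * length s ∸ suc (length X)) + length (blockers M (e ∷ X))
        ≤⟨ +-monoʳ-≤ _ (≤-trans (blockers-∷ e X) (+-monoˡ-≤ _ (E-meets e∈E M.real M.apart))) ⟩
      b * (U * length s ∸ suc (length X)) + (b + length (blockers M X))
        ≡⟨ sym (+-assoc (b * (U * length s ∸ suc (length X))) b (length (blockers M X))) ⟩
      b * (U * length s ∸ suc (length X)) + b + length (blockers M X)
        ≡⟨ cong (_+ length (blockers M X)) (trans (+-comm _ b) (sym (*-suc b _))) ⟩
      b * suc (U * length s ∸ suc (length X)) + length (blockers M X)
        -- `capacity` for the larger layer ensures that the truncated difference drops by exactly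
        -- one.
        ≡⟨ cong (λ k → b * k + length (blockers M X)) (sym (+-∸-assoc 1 (capacity L))) ⟩
      b * (U * length s ∸ length X) + length (blockers M X) ∎
      where open ≤-Reasoning

    covered-∷ : ∀ {X e f} → Covered u X (blockers M X) f → Covered u (e ∷ X) (blockers M (e ∷ X)) f
    covered-∷ {X} {e} (hit i m) with ∈-++⁻ X i
    ... | inj₁ j = hit (∈-++⁺ˡ (there j)) m
    ... | inj₂ j with ∈-++⁻ (blockers M X) j
    ...   | inj₂ k = hit (∈-++⁺ʳ (e ∷ X) (∈-++⁺ʳ (blockers M (e ∷ X)) k)) m
    ...   | inj₁ k = let g∈M , h , h∈X , gh = blockers⁻ M X k in
      hit (∈-++⁺ʳ (e ∷ X) (∈-++⁺ˡ (blockers⁺ M (e ∷ X) g∈M (there h∈X) gh))) m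
    covered-∷ {X} {e} {f} (full d) = full (≤-trans d (≤-trans (m≤n+m _ (bit (sameA f e)))
      (≤-reflexive (sym (count-∷ (sameA f) e X)))))

    record Extended (X X′ : List Edge) (fs : List Edge) : Set where
      field
        layer   : IsLayer s u X′ (blockers M X′)
        lower   : potential s X′ (blockers M X′) ≤ potential s X (blockers M X)
        keeps   : ∀ {f} → Covered u X (blockers M X) f → Covered u X′ (blockers M X′) f
        maximal : ∀ {f} → f ∈ˡ fs → Any (λ g → key f ≡ key g) s → Covered u X′ (blockers M X′) f

    not-addable : ∀ {X e} → ¬ T (addable M s u X e) → Any (λ g → key e ≡ key g) s →
                  Covered u X (blockers M X) e
    not-addable {X} {e} ¬ok src with T? (meets (X ++ (blockers M X ++ u)) e) | degree X e <? U
    ... | yes m | _     = let _ , i , n = meets⁻ (X ++ (blockers M X ++ u)) m in hit i n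
    ... | no _  | no ¬d = full (≮⇒≥ ¬d)
    ... | no ¬m | yes d = contradiction
      (Equivalence.from T-∧ (Any.any⁺ (sameA e) (Any.map key⇒sameA src) ,
        Equivalence.from T-∧ (T-not⁺ ¬m , <⇒<ᵇ d))) ¬ok

    extended : ∀ fs {X} → All (_∈ˡ E) fs → IsLayer s u X (blockers M X) →
               Extended X (foldl (add M s u) X fs) fs
    extended []       []        L = record { layer = L ; lower = ≤-refl ; keeps = id ; maximal = λ () }
    extended (e ∷ fs) {X} (e∈E ∷ fs⊆E) L with addable M s u X e in eq
    ... | true = record
      { layer   = layer
      ; lower   = ≤-trans lower (potential-∷ e∈E L′)
      ; keeps   = keeps ∘ covered-∷
      ; maximal = λ { (here refl) _ → keeps (hit (here refl) (E-real e∈E))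
                    ; (there i) src → maximal i src } }
      where
      L′ = add-layer L e∈E (subst T (sym eq) _)
      open Extended (extended fs fs⊆E L′)
    ... | false = record
      { layer   = layer
      ; lower   = lower
      ; keeps   = keeps
      ; maximal = λ { (here refl) src → keeps (not-addable (subst (¬_ ∘ T) (sym eq) id) src)
                    ; (there i) src → maximal i src } }
      where open Extended (extended fs fs⊆E L)

  AllPairs-map-∈ : ∀ {R S : Edge → Edge → Set} {xs} →
    (∀ {x y} → x ∈ˡ xs → y ∈ˡ xs → R x y → S x y) → AllPairs R xs → AllPairs S xs
  AllPairs-map-∈ f []         = []
  AllPairs-map-∈ f (rs ∷ rss) =
    All.tabulate (λ i → f (here refl) (there i) (All.lookup rs i)) ∷
    AllPairs-map-∈ (λ i j → f (there i) (there j)) rss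

  SameKey : Edge → List Edge → Set
  SameKey e N = Any (λ f → key e ≡ key f) N

  sameKey⁻ : ∀ {e} N → T (any (sameA e) N) → SameKey e N
  sameKey⁻ {e} N t = Any.map sameA⇒key (Any.any⁻ (sameA e) N t)

  sameKey⁺ : ∀ {e N} → SameKey e N → T (any (sameA e) N)
  sameKey⁺ {e} k = Any.any⁺ (sameA e) (Any.map key⇒sameA k)

  insert-⊆ : ∀ e N {f} → f ∈ˡ insert e N → f ∈ˡ e ∷ N
  insert-⊆ e N i with any (sameA e) N
  ... | true  = there i
  ... | false = i

  insert-distinct : ∀ e N → Distinct N → Distinct (insert e N)
  insert-distinct e N ne with any (sameA e) N in eq
  ... | true  = ne
  ... | false = All.tabulate (λ i k → subst T eq (sameKey⁺ (Any.map (λ { refl → k }) i))) ∷ ne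

  insert-covers : ∀ e N {f} → SameKey f (e ∷ N) → SameKey f (insert e N)
  insert-covers e N k with any (sameA e) N in eq
  insert-covers e N k         | false = k
  insert-covers e N (there k) | true  = k
  insert-covers e N (here k)  | true  = Any.map (trans k) (sameKey⁻ N (subst T (sym eq) _))

  module _ (Y X : List Edge) where
    private
      free = filterᵇ (not ∘ meets Y) X
      go : List Edge → List Edge
      go = foldr insert []

    fresh-⊆ : ∀ {e} → e ∈ˡ fresh Y X → e ∈ˡ X × ¬ T (meets Y e)
    fresh-⊆ i = let j , ok = ∈-filterᵇ⁻ (not ∘ meets Y) X (sub free i) in j , T-not⁻ ok
      where
      sub : ∀ L {e} → e ∈ˡ go L → e ∈ˡ L
      sub (x ∷ L) i with insert-⊆ x (go L) i
      ... | here refl = here refl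
      ... | there j   = there (sub L j)

    fresh-distinct : Distinct (fresh Y X)
    fresh-distinct = dis free
      where
      dis : ∀ L → Distinct (go L)
      dis []      = []
      dis (x ∷ L) = insert-distinct x (go L) (dis L)

    fresh-complete : ∀ {e} → e ∈ˡ X → ¬ T (meets Y e) → SameKey e (fresh Y X)
    fresh-complete i ¬m = com free (∈-filterᵇ⁺ (not ∘ meets Y) i (T-not⁺ ¬m))
      where
      com : ∀ L {e} → e ∈ˡ L → SameKey e (go L)
      com (x ∷ L) (here refl) = insert-covers x (go L) (here refl)
      com (x ∷ L) (there i)   = insert-covers x (go L) (there (com L i))

  data Replaced (N : List Edge) (f h : Edge) : Set where
    kept    : h ≡ f → ¬ SameKey f N → Replaced N f h
    swapped : h ∈ˡ N → key f ≡ key h → Replaced N f h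

  replaced : ∀ N f → Replaced N f (replace N f)
  replaced []      f = kept refl λ ()
  replaced (g ∷ N) f with sameA f g in eq | replaced N f
  ... | true  | _             = swapped (here refl) (sameA⇒key (subst T (sym eq) _))
  ... | false | swapped i k   = swapped (there i) k
  ... | false | kept h≡f ¬k   = kept h≡f λ
    { (here k)  → subst T eq (key⇒sameA k)
    ; (there k) → ¬k k }

  key-replace : ∀ N f → key (replace N f) ≡ key f
  key-replace N f with replace N f | replaced N f
  ... | _ | kept refl _ = refl
  ... | _ | swapped _ k = sym k

  replace-∈ : ∀ N f → SameKey f N → replace N f ∈ˡ N
  replace-∈ N f k with replace N f | replaced N f
  ... | _ | kept _ ¬k   = contradiction k ¬k
  ... | _ | swapped i _ = i

  replace-≡ : ∀ N f → ¬ SameKey f N → replace N f ≡ f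
  replace-≡ N f ¬k with replace N f | replaced N f
  ... | _ | kept refl _ = refl
  ... | _ | swapped i k = contradiction (Any.map (λ { refl → k }) i) ¬k

  sameKey? : ∀ f N → SameKey f N ⊎ ¬ SameKey f N
  sameKey? f N with T? (any (sameA f) N)
  ... | yes t = inj₁ (sameKey⁻ N t)
  ... | no ¬t = inj₂ (¬t ∘ sameKey⁺)

  filter-replace : ∀ P N M →
    (∀ {f} → f ∈ˡ M → SameKey f N → ¬ T (P f) × ¬ T (P (replace N f))) →
    filterᵇ P (map (replace N) M) ≡ filterᵇ P M
  filter-replace P N []      hyp = refl
  filter-replace P N (f ∷ M) hyp with sameKey? f N
  ... | inj₂ ¬k = trans (filterᵇ-∷ P (replace N f) (map (replace N) M))
    (trans (cong₂ (λ g → (if P g then (g ∷_) else id)) (replace-≡ N f ¬k) (filter-replace P N M (hyp ∘ there)))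
           (sym (filterᵇ-∷ P f M)))
  ... | inj₁ k with P f | P (replace N f) | hyp (here refl) k
  ...   | true  | _     | ¬t , _ = contradiction _ ¬t
  ...   | false | true  | _ , ¬t = contradiction _ ¬t
  ...   | false | false | _      = filter-replace P N M (hyp ∘ there)

  count-replace : ∀ P N M →
    (∀ {f} → f ∈ˡ M → SameKey f N → T (P f) × ¬ T (P (replace N f))) →
    count P (map (replace N) M) + count (λ f → any (sameA f) N) M ≤ count P M
  count-replace P N []      hyp = z≤n
  count-replace P N (f ∷ M) hyp
    rewrite count-∷ P (replace N f) (map (replace N) M) | count-∷ (λ f → any (sameA f) N) f M | count-∷ P f M
    = ≤-trans (≤-reflexive (interchange (bit (P (replace N f))) _ (bit (any (sameA f) N)) _))
              (+-mono-≤ here≤ (count-replace P N M (hyp ∘ there)))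
    where
    interchange : ∀ a b c d → a + b + (c + d) ≡ a + c + (b + d)
    interchange = solve-∀
    here≤ : bit (P (replace N f)) + bit (any (sameA f) N) ≤ bit (P f)
    here≤ with any (sameA f) N in eq
    ... | true with P f | P (replace N f) | hyp (here refl) (sameKey⁻ N (subst T (sym eq) _))
    ...   | true  | true  | _ , ¬t = contradiction _ ¬t
    ...   | true  | false | _      = ≤-refl
    ...   | false | _     | () , _
    here≤ | false rewrite replace-≡ N f (λ k → subst T eq (sameKey⁺ k)) = ≤-reflexive (+-identityʳ _)

  key-injective : ∀ {M f g} → Distinct M → f ∈ˡ M → g ∈ˡ M → key f ≡ key g → f ≡ g
  key-injective ne i j k with AllPairs-lookup (λ n → n ∘ sym) ne i j
  ... | inj₁ eq = eq
  ... | inj₂ n  = contradiction k n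

  module Collapse {M s u X : List Edge} (Mok : IsMatching M) (L : IsLayer s u X (blockers M X))
                  (s⊆M : ∀ {f} → f ∈ˡ s → f ∈ˡ M) where
    private
      module M = IsMatching Mok
      module L = IsLayer L
      Y = blockers M X
      N = fresh Y X

    M′ : List Edge
    M′ = map (replace N) M

    N⊆X : ∀ {n} → n ∈ˡ N → n ∈ˡ X
    N⊆X i = proj₁ (fresh-⊆ Y X i)

    -- Whatever in `M` meets an edge of `X` belongs to `Y`, and fresh edges meet nothing in `Y`.
    N#M : ∀ {n f} → n ∈ˡ N → f ∈ˡ M → n # f
    N#M i j m = proj₂ (fresh-⊆ Y X i)
      (meets⁺ Y (blockers⁺ M X j (N⊆X i) (meetB-sym m)) m)

    N#N : ∀ {n n′} → n ∈ˡ N → n′ ∈ˡ N → key n ≢ key n′ → n # n′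
    N#N i j ne with AllPairs-lookup #-sym L.apart (N⊆X i) (N⊆X j)
    ... | inj₁ refl = contradiction refl ne
    ... | inj₂ n#n′ = n#n′

    hit-source : ∀ {f} → f ∈ˡ M → SameKey f N → f ∈ˡ s
    hit-source {f} i k =
      let n , n∈N , f~n = find k
          g , g∈s , n~g = find (All.lookup L.sourced (N⊆X n∈N))
      in subst (_∈ˡ s) (sym (key-injective M.distinct i (s⊆M g∈s) (trans f~n n~g))) g∈s

    still-matching : IsMatching M′
    still-matching = record
      { real     = All.map⁺ (All.tabulate real′)
      ; apart    = AllPairs.map⁺ (AllPairs-map-∈ apart′ (AllPairs.zip (M.apart , M.distinct)))
      ; distinct = AllPairs.map⁺ (AllPairs.map (λ {f} {g} ne k →
                     ne (trans (sym (key-replace N f)) (trans k (key-replace N g)))) M.distinct)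
      }
      where
      real′ : ∀ {f} → f ∈ˡ M → replace N f ∈ˡ E ⊎ replace N f # replace N f
      real′ {f} i with replace N f | replaced N f
      ... | _ | kept refl _ = All.lookup M.real i
      ... | _ | swapped j _ = inj₁ (All.lookup L.edges (N⊆X j))
      apart′ : ∀ {f g} → f ∈ˡ M → g ∈ˡ M → f # g × key f ≢ key g → replace N f # replace N g
      apart′ {f} {g} i j (f#g , ne) with replace N f | replaced N f | replace N g | replaced N g
      ... | _ | kept refl _  | _ | kept refl _  = f#g
      ... | _ | swapped i′ _ | _ | kept refl _  = N#M i′ j
      ... | _ | kept refl _  | _ | swapped j′ _ = #-sym (N#M j′ i)
      ... | _ | swapped i′ k | _ | swapped j′ l = N#N i′ j′ (λ e → ne (trans k (trans e (sym l))))

    keys : map key M′ ≡ map key M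
    keys = trans (sym (map-∘ M)) (map-cong (key-replace N) M)

    -- The fresh edges have distinct keys, so they displace at least as many sources. With `P` as
    -- being unmatched this matches the root; with `P` as meeting the layer below it removes
    -- blockers there.
    drop-count : ∀ P → (∀ {f} → f ∈ˡ s → T (P f)) → (∀ {n} → n ∈ˡ N → ¬ T (P n)) →
                 count P M′ + length N ≤ count P M
    drop-count P Ps ¬PN = ≤-trans (+-monoʳ-≤ (count P M′) N≤hits) (count-replace P N M
      λ i k → Ps (hit-source i k) , ¬PN (replace-∈ N _ k))
      where
      hits = filterᵇ (λ f → any (sameA f) N) M
      N≤hits : length N ≤ length hits
      N≤hits = subst₂ _≤_ (+-identityʳ _) (+-identityʳ _) (double-counting sameA N hits {1} {1}
        (All.tabulate λ {n} i →
          let g , g∈s , n~g = find (All.lookup L.sourced (N⊆X i))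
              g∈hits = ∈-filterᵇ⁺ (λ f → any (sameA f) N) (s⊆M g∈s)
                         (sameKey⁺ (Any.map (λ { refl → sym n~g }) i))
          in count-some (sameA n) (Any.map (λ { refl → key⇒sameA n~g }) g∈hits))
        (All.tabulate λ {f} _ → ≤-trans
          (count-mono (λ n → sameA n f) (sameA f) N λ _ m → key⇒sameA (sym (sameA⇒key m)))
          (degree≤1 (fresh-distinct Y X) f)))

    same-filter : ∀ P → (∀ {f} → f ∈ˡ s → ¬ T (P f)) → (∀ {n} → n ∈ˡ N → ¬ T (P n)) →
                  filterᵇ P M′ ≡ filterᵇ P M
    same-filter P ¬Ps ¬PN = filter-replace P N M
      λ i k → ¬Ps (hit-source i k) , ¬PN (replace-∈ N _ k)

  -- Frozen layers and the depth of a stack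

  record IsFrozen (s u X Y : List Edge) (y : ℕ) : Set where
    field
      maximal : ∀ {e} → e ∈ˡ E → SameKey e s → Covered u X Y e
      growing : y < q * length X
      stuck   : p * length (fresh Y X) < length s

  LayerOn FrozenOn : Edge → List Layer → List Edge → List Edge → Set
  LayerOn  root Zs X Y = IsLayer (source root Zs) (used Zs) X Y
  FrozenOn root Zs X Y = IsFrozen (source root Zs) (used Zs) X Y (length (allY Zs))

  -- These are the layers below the top. Each was maximal and allowed neither a collapse nor giving
  -- up when the next one was started. A collapse alters the blockers of the layer directly below
  -- only, and that layer leaves the stack to become the top.
  data IsStack (root : Edge) : List Layer → Set where
    []   : IsStack root []
    push : ∀ {X Y Zs} → LayerOn root Zs X Y →
            FrozenOn root Zs X Y →
            IsStack root Zs → IsStack root ((X , Y) ∷ Zs)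

  length-source : ∀ root Zs → length (source root Zs) ≤ suc (length (allY Zs))
  length-source root []             = ≤-refl
  length-source root ((X , Y) ∷ Zs) = m≤n⇒m≤1+n (≤-trans (m≤m+n _ _) (≤-reflexive (sym (length-++ Y))))

  -- An edge of X is blocked by an edge of Y which blocks nothing else in X, or
  -- it has the key of a fresh edge; by the cap, at most U edges share a key.
  length-layer : ∀ {s u X Y} → IsLayer s u X Y → length X ≤ length Y + U * length (fresh Y X)
  length-layer {s} {u} {X} {Y} L = ≤-trans (≤-reflexive (sym (count-not (meets Y) X))) (+-mono-≤ blocked≤ free≤)
    where
    open IsLayer L
    blocked = filterᵇ (meets Y) X
    free    = filterᵇ (not ∘ meets Y) X
    blocked≤ : length blocked ≤ length Y
    blocked≤ = subst₂ _≤_ (+-identityʳ _) (+-identityʳ _) (double-counting meetB blocked Y {1} {1}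
      (All.tabulate λ {e} i → let f , j , m = meets⁻ Y (proj₂ (∈-filterᵇ⁻ (meets Y) X i)) in
        count-some (meetB e) (Any.map (λ { refl → m }) j))
      (All.map (λ {f} c → ≤-trans (count-filterᵇ (λ e → meetB e f) (meets Y) X)
        (≤-trans (count-mono (λ e → meetB e f) (meetB f) X λ _ → meetB-sym) c)) single))
    free≤ : length free ≤ U * length (fresh Y X)
    free≤ = subst (_≤ U * length (fresh Y X)) (+-identityʳ _) (double-counting sameA free (fresh Y X) {1}
      (All.tabulate λ {e} i → let j , ok = ∈-filterᵇ⁻ (not ∘ meets Y) X i in
        count-some (sameA e) (Any.map key⇒sameA (fresh-complete Y X j (T-not⁻ ok))))
      (All.tabulate λ {n} i →
        let g , g∈s , n~g = find (All.lookup sourced (proj₁ (fresh-⊆ Y X i))) in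
        ≤-trans (count-filterᵇ (λ e → sameA e n) (not ∘ meets Y) X)
        (≤-trans (count-mono (λ e → sameA e n) (sameA n) X λ _ m → key⇒sameA (sym (sameA⇒key m)))
        (≤-trans (degree-cong X n~g) (All.lookup capped g∈s)))))

  potential≤ : ∀ {s u X Y} → IsLayer s u X Y → potential s X Y ≤ b * (U * length s)
  potential≤ {s} {u} {X} {Y} L = begin
    b * (U * length s ∸ length X) + length Y      ≤⟨ +-monoʳ-≤ _ spread ⟩
    b * (U * length s ∸ length X) + b * length X  ≡⟨ sym (*-distribˡ-+ b _ (length X)) ⟩
    b * (U * length s ∸ length X + length X)      ≡⟨ cong (b *_) (m∸n+n≡m (capacity L)) ⟩
    b * (U * length s)                            ∎
    where
    open ≤-Reasoning
    open IsLayer L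

  positive : ∀ {z c y} → suc z ≤ c * y → 1 ≤ y
  positive {c = c} {zero}  g = contradiction (≤-trans g (≤-reflexive (*-zeroʳ c))) λ ()
  positive {c = c} {suc _} _ = s≤s z≤n

  module _ (p≡ : p ≡ 2 * q * U) where

    -- `growing` makes `X` large and `length-layer` passes this on to `Y` up to the fresh edges. By
    -- `stuck` and the choice of `p`, these account for at most half of it.
    frozen-growth : ∀ root Zs {X Y} → LayerOn root Zs X Y →
      FrozenOn root Zs X Y →
      suc (length (allY Zs)) ≤ 2 * q * length Y
    frozen-growth root Zs {X} {Y} L F = growth (length X) (length Y) (length (fresh Y X)) (length (allY Zs))
      (length-layer L) growing (≤-trans (<⇒≤ (subst (λ p → p * length (fresh Y X) < length (source root Zs)) p≡ stuck)) (length-source root Zs))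
      where
      open IsFrozen F
      growth : ∀ x y n z → x ≤ y + U * n → z < q * x → 2 * q * U * n ≤ suc z → suc z ≤ 2 * q * y
      growth x y n z x≤ z< n≤ = +-cancelʳ-≤ (suc z) (suc z) (2 * q * y) (begin
        suc z + suc z                    ≤⟨ +-mono-≤ z< z< ⟩
        q * x + q * x                    ≡⟨ e₁ q x ⟩
        2 * q * x                        ≤⟨ *-monoʳ-≤ (2 * q) x≤ ⟩
        2 * q * (y + U * n)              ≡⟨ e₂ q y U n ⟩
        2 * q * y + 2 * q * U * n        ≤⟨ +-monoʳ-≤ (2 * q * y) n≤ ⟩
        2 * q * y + suc z                ∎)
        where
        open ≤-Reasoning
        e₁ : ∀ q x → q * x + q * x ≡ 2 * q * x
        e₁ = solve-∀
        e₂ : ∀ q y U n → 2 * q * (y + U * n) ≡ 2 * q * y + 2 * q * U * n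
        e₂ = solve-∀

    -- By `frozen-growth`, each layer multiplies the number of sources found so far, the root
    -- included, by at least `1 + 1 / (2 * q)`.
    depth : ∀ {root Zs} → IsStack root Zs →
            suc (2 * q) ^ length Zs ≤ suc (length (allY Zs)) * (2 * q) ^ length Zs
    depth [] = ≤-refl
    depth {root} {(X , Y) ∷ Zs} (push L F S) = begin
      suc c * suc c ^ l                    ≤⟨ *-monoʳ-≤ (suc c) (depth S) ⟩
      suc c * (suc z * c ^ l)              ≡⟨ e₁ c (suc z) (c ^ l) ⟩
      (c * suc z + suc z) * c ^ l          ≤⟨ *-monoˡ-≤ (c ^ l) (+-monoʳ-≤ (c * suc z) (frozen-growth root Zs L F)) ⟩
      (c * suc z + c * length Y) * c ^ l   ≡⟨ e₂ c z (length Y) (c ^ l) ⟩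
      suc (length Y + z) * (c * c ^ l)     ≡⟨ cong (λ k → suc k * (c * c ^ l)) (sym (length-++ Y)) ⟩
      suc (length (Y ++ allY Zs)) * (c * c ^ l) ∎
      where
      open ≤-Reasoning
      c = 2 * q
      l = length Zs
      z = length (allY Zs)
      e₁ : ∀ c z w → suc c * (z * w) ≡ (c * z + z) * w
      e₁ = solve-∀
      e₂ : ∀ c z y w → (c * suc z + c * y) * w ≡ suc (y + z) * (c * w)
      e₂ = solve-∀

  module OnMatching {M : List Edge} {root : Edge} (Mok : IsMatching M) (root∈M : root ∈ˡ M) (root# : root # root) where
    private module M = IsMatching Mok

    used-X : ∀ Ls {X e} → X ∈ˡ Ls → e ∈ˡ X → e ∈ˡ used (annotate M Ls)
    used-X (_ ∷ _) (here refl) i = ∈-++⁺ˡ (∈-++⁺ˡ i)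
    used-X (X′ ∷ Ls) (there j) i = ∈-++⁺ʳ (X′ ++ blockers M X′) (used-X Ls j i)

    used-Y : ∀ Ls {f} → f ∈ˡ allY (annotate M Ls) → f ∈ˡ used (annotate M Ls)
    used-Y (X ∷ Ls) i with ∈-++⁻ (blockers M X) i
    ... | inj₁ j = ∈-++⁺ˡ (∈-++⁺ʳ X j)
    ... | inj₂ j = ∈-++⁺ʳ (X ++ blockers M X) (used-Y Ls j)

    allY-blockers : ∀ Ls {X f} → X ∈ˡ Ls → f ∈ˡ blockers M X → f ∈ˡ allY (annotate M Ls)
    allY-blockers (_ ∷ _) (here refl) i = ∈-++⁺ˡ i
    allY-blockers (X′ ∷ Ls) (there j) i = ∈-++⁺ʳ (blockers M X′) (allY-blockers Ls j i)

    allY-⊆ : ∀ Ls {f} → f ∈ˡ allY (annotate M Ls) → f ∈ˡ M × T (meetB f f)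
    allY-⊆ (X ∷ Ls) i with ∈-++⁻ (blockers M X) i
    ... | inj₁ j = let f∈M , e , _ , m = blockers⁻ M X j in f∈M , meetB-self m
    ... | inj₂ j = allY-⊆ Ls j

    -- An edge that blocks two layers would meet an edge of the upper `X`, which avoids the whole
    -- `Y` of the lower layer.
    allY-distinct : ∀ Ls → IsStack root (annotate M Ls) →
                    Distinct (allY (annotate M Ls))
    allY-distinct []       []          = []
    allY-distinct (X ∷ Ls) (push L F S) = AllPairs.++⁺ (AllPairs.filter⁺ (λ f → T? (meets X f)) M.distinct)
      (allY-distinct Ls S) (All.tabulate λ i → All.tabulate λ j k →
        let f∈M , e , e∈X , m = blockers⁻ M X i
            f≡g = key-injective M.distinct f∈M (proj₁ (allY-⊆ Ls j)) k
        in IsLayer.avoids L e∈X (used-Y Ls j) (meetB-sym (subst (λ f → T (meetB f e)) f≡g m)))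

    sources : List (List Edge) → List Edge
    sources Ls = allY (annotate M Ls) ++ (root ∷ [])

    sources-⊆ : ∀ Ls {f} → f ∈ˡ sources Ls → f ∈ˡ M
    sources-⊆ Ls i with ∈-++⁻ (allY (annotate M Ls)) i
    ... | inj₁ j           = proj₁ (allY-⊆ Ls j)
    ... | inj₂ (here refl) = root∈M

    -- The root is none of the blockers: they meet themselves, and a placeholder does not.
    sources-distinct : ∀ Ls → IsStack root (annotate M Ls) →
                       Distinct (sources Ls)
    sources-distinct Ls S = AllPairs.++⁺ (allY-distinct Ls S) ([] ∷ [])
      (All.tabulate λ i → (λ k → let f∈M , m = allY-⊆ Ls i in
        root# (subst (λ e → T (meetB e e)) (key-injective M.distinct f∈M root∈M k) m)) ∷ [])

    length-sources : ∀ Ls → length (sources Ls) ≡ suc (length (allY (annotate M Ls)))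
    length-sources Ls = trans (length-++ (allY (annotate M Ls))) (+-comm _ 1)

    sources≤ : ∀ Ls → IsStack root (annotate M Ls) → suc (length (allY (annotate M Ls))) ≤ length M
    sources≤ Ls S = subst₂ _≤_ (trans (+-identityʳ _) (length-sources Ls)) (+-identityʳ _)
      (double-counting sameA (sources Ls) M {1} {1}
        (All.tabulate λ {f} i → count-some (sameA f) (Any.map (λ { refl → key⇒sameA refl }) (sources-⊆ Ls i)))
        (All.tabulate λ {f} _ → ≤-trans
          (count-mono (λ e → sameA e f) (sameA f) (sources Ls) λ _ m → key⇒sameA (sym (sameA⇒key m)))
          (degree≤1 (sources-distinct Ls S) f)))

    module _ {X X′ : List Edge} {Ls : List (List Edge)} (L : IsLayer (blockers M X′) (used (annotate M (X′ ∷ Ls))) X (blockers M X))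
             (L′ : LayerOn root (annotate M Ls) X′ (blockers M X′)) where
      open Collapse Mok L (λ i → proj₁ (blockers⁻ M X′ i))
      private
        module L = IsLayer L
        module L′ = IsLayer L′
        N = fresh (blockers M X) X

      -- The sources of every layer but the first are real edges, and so are those that replace
      -- them.
      pop-roots : roots M′ ≡ roots M
      pop-roots = same-filter (λ e → not (meetB e e))
        (λ i t → T-not⁻ t (meetB-self (proj₂ (proj₂ (L′.touching i)))))
        (λ i t → T-not⁻ t (E-real (All.lookup L.edges (N⊆X i))))

      -- A source that blocks a deeper layer would be avoided by `X′`, although it meets `X′`; and
      -- the new edges avoid every deeper `X`. So deeper layers neither lose nor gain a blocker.
      pop-annotate : annotate M′ Ls ≡ annotate M Ls
      pop-annotate = map-cong-local (All.tabulate λ {X″} i → cong (X″ ,_) (same-filter (meets X″)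
        (λ {f} j m → let e , e∈X″ , fe = meets⁻ X″ m
                         f∈Y″ = blockers⁺ M X″ (proj₁ (blockers⁻ M X′ j)) e∈X″ fe
                         x , x∈X′ , fx = L′.touching j
                     in L′.avoids x∈X′ (used-Y Ls (allY-blockers Ls i f∈Y″)) (meetB-sym fx))
        (λ j m → let e , e∈X″ , ne = meets⁻ X″ m in
                 L.avoids (N⊆X j) (∈-++⁺ʳ (X′ ++ blockers M X′) (used-X Ls i e∈X″)) ne)))

      private
        N#X′ : ∀ {n} → n ∈ˡ N → ¬ T (meets X′ n)
        N#X′ i m = let e , e∈X′ , ne = meets⁻ X′ m in
          L.avoids (N⊆X i) (used-X (X′ ∷ Ls) (here refl) e∈X′) ne

      pop-blockers : length (blockers M′ X′) + length N ≤ length (blockers M X′)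
      pop-blockers = drop-count (meets X′) (λ i → proj₂ (∈-filterᵇ⁻ (meets X′) M i)) N#X′

      pop-layer : LayerOn root (annotate M Ls) X′ (blockers M′ X′)
      pop-layer = record
        { edges = edges ; sourced = sourced ; avoids = avoids ; apart = apart
        ; single   = All.tabulate single′
        ; capped   = capped
        ; touching = λ i → proj₂ (blockers⁻ M′ X′ i)
        ; spread   = ≤-trans (m+n≤o⇒m≤o _ pop-blockers) spread
        }
        where
        open IsLayer L′
        single′ : ∀ {f} → f ∈ˡ blockers M′ X′ → count (meetB f) X′ ≤ 1
        single′ {f} i with ∈-filterᵇ⁻ (meets X′) M′ i
        ... | f∈M′ , m with ∈-map⁻ (replace N) f∈M′
        ...   | g , g∈M , refl with replace N g | replaced N g
        ...     | _ | swapped j _ = contradiction m (N#X′ j)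
        ...     | _ | kept refl _ = All.lookup single (∈-filterᵇ⁺ (meets X′) g∈M m)

  -- Termination of the search

  module Run (ks : List K) (h D depthBound : ℕ)
    (p≡ : p ≡ 2 * q * U) (h≡ : h ≡ b * U * (2 * q) * p) (D≡ : D ≡ suc (suc h * (b * U)))
    (shallow : ∀ l → suc (2 * q) ^ l ≤ length ks * (2 * q) ^ l → suc l ≤ depthBound) where

    weight : List Layer → ℕ
    weight Zs = D ^ (depthBound ∸ length Zs)

    -- The weights decrease by the factor D from each layer to the next. The top
    -- layer has the additional weight of one part in h: it pays for a layer pushed
    -- above, and it is repaid by the blockers that a collapse removes.
    Ψ : Edge → List Layer → ℕ
    Ψ root []             = 0
    Ψ root ((X , Y) ∷ Zs) = h * weight Zs * potential (source root Zs) X Y + Ψ root Zs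

    Φ : Edge → Layer → List Layer → ℕ
    Φ root (X , Y) Zs = suc h * weight Zs * potential (source root Zs) X Y + Ψ root Zs

    -- The value of `Φ` for a first layer that is still empty, with the root as its only source.
    Φ₀ : ℕ
    Φ₀ = suc h * weight [] * (b * (U * 1) + 0) + 0

    -- Each unmatched vertex holds the price of a whole search: `Φ₀`, one unit for opening the first
    -- layer, and one to make the matching of a root a strict decrease.
    rootCost : List Edge → ℕ
    rootCost M = length (roots M) * (2 + Φ₀)

    measure : State → ℕ
    measure (M , Ls) = rootCost M + match (roots M) 0 λ root _ →
      match Ls (1 + Φ₀) λ X Ls′ → Φ root (X , blockers M X) (annotate M Ls′)

    data Inv : State → Set where
      base : ∀ {M} → IsMatching M → map key M ≡ ks → Inv (M , [])
      top  : ∀ {M root rest X Ls} → IsMatching M → map key M ≡ ks → roots M ≡ root ∷ rest →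
             LayerOn root (annotate M Ls) X (blockers M X) →
             IsStack root (annotate M Ls) → Inv (M , X ∷ Ls)

    data Terminal : State → Set where
      matched : ∀ {M Ls} → IsMatching M → map key M ≡ ks → roots M ≡ [] → Terminal (M , Ls)
      failed  : ∀ {M root rest X Ls} → IsMatching M → map key M ≡ ks → roots M ≡ root ∷ rest →
        let open Top M root X Ls in
        IsLayer s (used Zs) X⁺ Y⁺ →
        (∀ {e} → e ∈ˡ E → SameKey e s → Covered (used Zs) X⁺ Y⁺ e) →
        IsStack root Zs → q * length X⁺ ≤ length (allY Zs) → Terminal (M , X ∷ Ls)

    data Progress (st : State) : State → Set where
      advance : ∀ {st′} → Inv st′ → measure st′ < measure st → Progress st st′
      halt    : Terminal st → Progress st st

    blockers-[] : ∀ M → blockers M [] ≡ []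
    blockers-[] []      = refl
    blockers-[] (f ∷ M) = blockers-[] M

    empty-layer : ∀ {s u} → IsLayer s u [] []
    empty-layer {s} = record
      { edges = [] ; sourced = [] ; avoids = λ () ; apart = [] ; single = []
      ; capped = All.tabulate λ _ → z≤n ; touching = λ () ; spread = z≤n }

    roots-head : ∀ M {root rest} → roots M ≡ root ∷ rest → root ∈ˡ M × root # root
    roots-head M eq =
      let i , t = ∈-filterᵇ⁻ (λ e → not (meetB e e)) M (subst (_ ∈ˡ_) (sym eq) (here refl)) in i , T-not⁻ t

    instance
      D≢0 : NonZero D
      D≢0 = subst NonZero (sym D≡) _

    weight>0 : ∀ Zs → 1 ≤ weight Zs
    weight>0 Zs = m^n>0 D (depthBound ∸ length Zs)

    step-top : ∀ M {root rest} X Ls → roots M ≡ root ∷ rest → step (M , X ∷ Ls) ≡ Top.next M root X Ls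
    step-top M X Ls eq rewrite eq = refl

    measure-top : ∀ M {root rest} X Ls → roots M ≡ root ∷ rest →
      measure (M , X ∷ Ls) ≡ rootCost M + Φ root (X , blockers M X) (annotate M Ls)
    measure-top M X Ls eq rewrite eq = refl

    measure-base : ∀ M → measure (M , []) ≤ rootCost M + (1 + Φ₀)
    measure-base M with roots M
    ... | []    = z≤n
    ... | _ ∷ _ = ≤-refl

    measure-base≡ : ∀ M {root rest} → roots M ≡ root ∷ rest →
      measure (M , []) ≡ rootCost M + (1 + Φ₀)
    measure-base≡ M eq rewrite eq = refl

    open-base : ∀ {M root rest} → IsMatching M → map key M ≡ ks → roots M ≡ root ∷ rest →
                Progress (M , []) (M , [] ∷ [])
    open-base {M} {root} Mok keys eq = advance
      (top Mok keys eq (subst (IsLayer _ _ []) (sym (blockers-[] M)) empty-layer) [])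
      (subst₂ _<_ (sym (measure-top M [] [] eq)) (sym (measure-base≡ M eq))
        (+-monoʳ-< (rootCost M) (s≤s (≤-reflexive
          (cong (λ Y → suc h * weight [] * potential (root ∷ []) [] Y + 0) (blockers-[] M))))))

    -- Freezing a layer of weight `w` and potential `P` frees `w * P`. An empty layer on `y` sources
    -- costs `suc h * v * (c * y)`, which is less than `w * y` for `w ≡ suc (suc h * c) * v`. This
    -- dictates `D`.
    build-gain : ∀ h v c y P w ψ → w ≡ suc (suc h * c) * v → 1 ≤ v → 1 ≤ y → y ≤ P →
      suc h * v * (c * y) + (h * w * P + ψ) < suc h * w * P + ψ
    build-gain h v c y P w ψ refl 1≤v 1≤y y≤P = begin-strict
      suc h * v * (c * y) + (h * w * P + ψ)  ≡⟨ sym (+-assoc (suc h * v * (c * y)) (h * w * P) ψ) ⟩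
      suc h * v * (c * y) + h * w * P + ψ    <⟨ +-monoˡ-< ψ (+-monoˡ-< (h * w * P) gain) ⟩
      w * P + h * w * P + ψ                  ≡⟨ cong (_+ ψ) (e h w P) ⟩
      suc h * w * P + ψ                      ∎
      where
      open ≤-Reasoning
      e : ∀ h w P → w * P + h * w * P ≡ suc h * w * P
      e = solve-∀
      e′ : ∀ h v y c → suc h * v * (c * y) + v * y ≡ suc (suc h * c) * v * y
      e′ = solve-∀
      gain : suc h * v * (c * y) < w * P
      gain = begin-strict
        suc h * v * (c * y)          <⟨ m<m+n (suc h * v * (c * y)) (*-mono-≤ 1≤v 1≤y) ⟩
        suc h * v * (c * y) + v * y  ≡⟨ e′ h v y c ⟩
        w * y                        ≤⟨ *-monoʳ-≤ w y≤P ⟩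
        w * P                        ∎

    length-matching : ∀ {M} → map key M ≡ ks → length M ≡ length ks
    length-matching {M} keys = trans (sym (length-map key M)) (cong length keys)

    push-measure : ∀ {M root rest} X Ls → IsMatching M → map key M ≡ ks → roots M ≡ root ∷ rest →
      LayerOn root (annotate M Ls) X (blockers M X) →
      FrozenOn root (annotate M Ls) X (blockers M X) →
      IsStack root (annotate M Ls) →
      measure (M , [] ∷ X ∷ Ls) < rootCost M + Φ root (X , blockers M X) (annotate M Ls)
    push-measure {M} {root} X Ls Mok keys eq L F S =
      subst (_< rootCost M + Φ root (X , Y) Zs) (sym (measure-top M [] (X ∷ Ls) eq)) (+-monoʳ-< (rootCost M)
        (subst (_< Φ root (X , Y) Zs) (sym Φ≡)
          (build-gain h v (b * U) (length Y) P (weight Zs) (Ψ root Zs) weight≡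
            (m^n>0 D (depthBound ∸ suc (length Zs)))
            (positive {c = 2 * q} (frozen-growth p≡ root Zs L F)) (m≤n+m _ _))))
      where
      open OnMatching Mok (proj₁ (roots-head M eq)) (proj₂ (roots-head M eq))
      Zs = annotate M Ls
      Y  = blockers M X
      P  = potential (source root Zs) X Y
      v  = D ^ (depthBound ∸ suc (length Zs))
      S⁺ : IsStack root (annotate M (X ∷ Ls))
      S⁺ = push L F S
      -- Without this the exponent in `weight` would be truncated, and the new layer would not be
      -- cheaper by the factor `D`.
      shallow′ : length Zs < depthBound
      shallow′ = <⇒≤ (shallow (suc (length Zs)) (≤-trans (depth p≡ S⁺)
        (*-monoˡ-≤ ((2 * q) ^ suc (length Zs)) (≤-trans (sources≤ (X ∷ Ls) S⁺) (≤-reflexive (length-matching {M} keys))))))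
      weight≡ : weight Zs ≡ suc (suc h * (b * U)) * v
      weight≡ = trans (cong (D ^_) (+-∸-assoc 1 shallow′)) (cong (_* v) D≡)
      potential-[] : potential Y [] (blockers M []) ≡ b * U * length Y
      potential-[] = trans (cong (λ Z → b * (U * length Y) + length Z) (blockers-[] M))
        (trans (+-identityʳ (b * (U * length Y))) (sym (*-assoc b U (length Y))))
      Φ≡ : Φ root ([] , blockers M []) (annotate M (X ∷ Ls)) ≡
           suc h * v * (b * U * length Y) + (h * weight Zs * P + Ψ root Zs)
      Φ≡ = cong (λ k → suc h * v * k + (h * weight Zs * P + Ψ root Zs)) potential-[]

    reassoc : ∀ b U q p n → b * (U * (q * (p * n))) ≡ b * U * q * p * n
    reassoc = solve-∀

    -- The layer below becomes the top, which raises its factor from `h` to `suc h`. The loss of `n`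
    -- blockers makes up for this because `P′` is at most `h * n`.
    pop-gain : ∀ h w P P′ n → 1 ≤ w → 1 ≤ n → P + n ≤ P′ → P′ ≤ h * n → suc h * w * P < h * w * P′
    pop-gain h w P P′ n 1≤w 1≤n drop P′≤ = subst₂ _<_ (e (suc h) w P) (e h w P′)
      (*-monoʳ-< w {{>-nonZero 1≤w}} (+-cancelʳ-< (suc h * n) (suc h * P) (h * P′) (begin-strict
        suc h * P + suc h * n  ≡⟨ sym (*-distribˡ-+ (suc h) P n) ⟩
        suc h * (P + n)        ≤⟨ *-monoʳ-≤ (suc h) drop ⟩
        P′ + h * P′            ≡⟨ +-comm P′ (h * P′) ⟩
        h * P′ + P′            ≤⟨ +-monoʳ-≤ (h * P′) P′≤ ⟩
        h * P′ + h * n         <⟨ +-monoʳ-< (h * P′) (+-monoˡ-≤ (h * n) 1≤n) ⟩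
        h * P′ + suc h * n     ∎)))
      where
      open ≤-Reasoning
      e : ∀ h w P → w * (h * P) ≡ h * w * P
      e = solve-∀

    N>0 : ∀ {s N : List Edge} → 1 ≤ length s → length s ≤ p * length N → 1 ≤ length N
    N>0 {s} {[]}    1≤s c = contradiction (≤-trans 1≤s (≤-trans c (≤-reflexive (*-zeroʳ p)))) λ ()
    N>0 {s} {_ ∷ _} 1≤s c = s≤s z≤n

    collapse : ∀ {M root rest X} Ls (Mok : IsMatching M) → map key M ≡ ks → roots M ≡ root ∷ rest →
      LayerOn root (annotate M Ls) X (blockers M X) →
      IsStack root (annotate M Ls) →
      let N = fresh (blockers M X) X in
      length (source root (annotate M Ls)) ≤ p * length N →
      Inv (map (replace N) M , Ls) ×
      measure (map (replace N) M , Ls) < rootCost M + Ψ root (annotate M Ls)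
    -- At the bottom the only source is the root. It becomes matched, and the `2 + Φ₀` that it held
    -- pays for a new start.
    collapse {M} {root} {X = X} [] Mok keys eq L S c =
      base still-matching (trans keys′ keys) ,
      (begin-strict
        measure (M′ , [])                                ≤⟨ measure-base M′ ⟩
        rootCost M′ + (1 + Φ₀)          <⟨ +-monoʳ-< (rootCost M′) ≤-refl ⟩
        rootCost M′ + (2 + Φ₀)          ≡⟨ +-comm (rootCost M′) (2 + Φ₀) ⟩
        suc (length (roots M′)) * (2 + Φ₀)               ≤⟨ *-monoˡ-≤ (2 + Φ₀) fewer ⟩
        rootCost M                      ≡⟨ sym (+-identityʳ _) ⟩
        rootCost M + 0                  ∎)
      where
      open ≤-Reasoning
      N = fresh (blockers M X) X
      source-⊆M : ∀ {f} → f ∈ˡ root ∷ [] → f ∈ˡ M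
      source-⊆M (here refl) = proj₁ (roots-head M eq)
      open Collapse Mok L source-⊆M renaming (keys to keys′)
      fewer : length (roots M′) < length (roots M)
      fewer = ≤-trans (≤-reflexive (+-comm 1 _)) (≤-trans (+-monoʳ-≤ (length (roots M′)) (N>0 {root ∷ []} {N} ≤-refl c))
        (drop-count (λ e → not (meetB e e)) (λ { (here refl) → T-not⁺ (proj₂ (roots-head M eq)) })
          (λ i t → T-not⁻ t (E-real (All.lookup (IsLayer.edges L) (N⊆X i))))))
    collapse {M} {root} {rest} {X} (X′ ∷ Ls) Mok keys eq L (push L′ F′ S) c =
      top still-matching (trans keys′ keys) roots≡
        (subst (λ Zs → LayerOn root Zs X′ (blockers M′ X′)) (sym same) (pop-layer {Ls = Ls} L L′))
        (subst (IsStack root) (sym same) S) ,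
      (begin-strict
        measure (M′ , X′ ∷ Ls)
          ≡⟨ measure-top M′ X′ Ls roots≡ ⟩
        rootCost M′ + Φ root (X′ , blockers M′ X′) (annotate M′ Ls)
          ≡⟨ cong₂ (λ R Zs → length R * (2 + Φ₀) + Φ root (X′ , blockers M′ X′) Zs) (pop-roots {Ls = Ls} L L′) same ⟩
        rootCost M + (suc h * weight Zs * P″ + Ψ root Zs)
          <⟨ +-monoʳ-< (rootCost M) (+-monoˡ-< (Ψ root Zs) smaller) ⟩
        rootCost M + (h * weight Zs * P′ + Ψ root Zs) ∎)
      where
      open ≤-Reasoning
      N = fresh (blockers M X) X
      open OnMatching Mok (proj₁ (roots-head M eq)) (proj₂ (roots-head M eq))
      open Collapse Mok L (λ i → proj₁ (blockers⁻ M X′ i)) renaming (keys to keys′)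
      Zs = annotate M Ls
      roots≡ = trans (pop-roots {Ls = Ls} L L′) eq
      same : annotate M′ Ls ≡ annotate M Ls
      same = pop-annotate {Ls = Ls} L L′
      s′ = source root Zs
      P′ = potential s′ X′ (blockers M X′)
      P″ = potential s′ X′ (blockers M′ X′)
      growth : suc (length (allY Zs)) ≤ 2 * q * length (blockers M X′)
      growth = frozen-growth p≡ root Zs L′ F′
      Y′>0 : 1 ≤ length (blockers M X′)
      Y′>0 = positive {c = 2 * q} growth
      drop : P″ + length N ≤ P′
      drop = ≤-trans (≤-reflexive (+-assoc (b * (U * length s′ ∸ length X′)) (length (blockers M′ X′)) (length N)))
        (+-monoʳ-≤ (b * (U * length s′ ∸ length X′)) (pop-blockers {Ls = Ls} L L′))
      -- The sources of the dropped layer are the blockers of the one below, so `c` bounds these by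
      -- `p * length N`. The factors collected on the way make up `h`.
      P′≤ : P′ ≤ h * length N
      P′≤ = begin
        P′                                             ≤⟨ potential≤ L′ ⟩
        b * (U * length s′)                            ≤⟨ *-monoʳ-≤ b (*-monoʳ-≤ U (≤-trans (length-source root Zs) growth)) ⟩
        b * (U * (2 * q * length (blockers M X′)))     ≤⟨ *-monoʳ-≤ b (*-monoʳ-≤ U (*-monoʳ-≤ (2 * q) c)) ⟩
        b * (U * (2 * q * (p * length N)))             ≡⟨ reassoc b U (2 * q) p (length N) ⟩
        b * U * (2 * q) * p * length N                 ≡⟨ cong (_* length N) (sym h≡) ⟩
        h * length N                                   ∎
      smaller : suc h * weight Zs * P″ < h * weight Zs * P′
      smaller = pop-gain h (weight Zs) P″ P′ (length N) (weight>0 Zs) (N>0 {blockers M X′} {N} Y′>0 c) drop P′≤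

    module OnTop {M root rest X} (Ls : List (List Edge)) (Mok : IsMatching M) (keys : map key M ≡ ks)
      (eq : roots M ≡ root ∷ rest)
      (L : LayerOn root (annotate M Ls) X (blockers M X))
      (S : IsStack root (annotate M Ls)) where

      open Top M root X Ls
      private
        root∈M = proj₁ (roots-head M eq)
        root#  = proj₂ (roots-head M eq)

      open OnMatching Mok root∈M root#

      ext : Extended {M} {s} {used Zs} Mok X X⁺ E
      ext = extended Mok E (All.tabulate id) L
      open Extended ext

      Φ⁺≤Φ : Φ root (X⁺ , Y⁺) Zs ≤ Φ root (X , blockers M X) Zs
      Φ⁺≤Φ = +-monoˡ-≤ (Ψ root Zs) (*-monoʳ-≤ (suc h * weight Zs) lower)

      build : length s ≰ p * length N → q * length X⁺ ≰ length (allY Zs) →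
              Progress (M , X ∷ Ls) (M , [] ∷ X⁺ ∷ Ls)
      build ¬c ¬small = advance
        (top Mok keys eq (subst (IsLayer Y⁺ (used (annotate M (X⁺ ∷ Ls))) []) (sym (blockers-[] M)) empty-layer)
          (push layer F S))
        (subst (measure (M , [] ∷ X⁺ ∷ Ls) <_) (sym (measure-top M X Ls eq))
          (<-≤-trans (push-measure X⁺ Ls Mok keys eq layer F S) (+-monoʳ-≤ (rootCost M) Φ⁺≤Φ)))
        where
        F : IsFrozen s (used Zs) X⁺ Y⁺ (length (allY Zs))
        F = record { maximal = maximal ; growing = ≰⇒> ¬small ; stuck = ≰⇒> ¬c }

      give-up : q * length X⁺ ≤ length (allY Zs) → Progress (M , X ∷ Ls) (M , X ∷ Ls)
      give-up small = halt (failed Mok keys eq layer maximal S small)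

      pop : length s ≤ p * length N → Progress (M , X ∷ Ls) (map (replace N) M , Ls)
      pop c = let inv , decr = collapse Ls Mok keys eq layer S c in
        advance inv (subst (measure (map (replace N) M , Ls) <_) (sym (measure-top M X Ls eq))
          (<-≤-trans decr (+-monoʳ-≤ (rootCost M) (m≤n+m (Ψ root Zs) _))))

    then-branch : ∀ {A : Set} {b} {x y : A} → T b → (if b then x else y) ≡ x
    then-branch {b = true} _ = refl

    else-branch : ∀ {A : Set} {b} {x y : A} → ¬ T b → (if b then x else y) ≡ y
    else-branch {b = true}  ¬b = contradiction _ ¬b
    else-branch {b = false} _  = refl

    progress : ∀ {st} → Inv st → Progress st (step st)
    progress (base {M} Mok keys) with roots M in eq
    ... | []       = halt (matched Mok keys eq)
    ... | root ∷ _ = open-base Mok keys eq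
    progress (top {M} {root} {rest} {X} {Ls} Mok keys eq L S)
      with T? collapsible | T? small
      where open Top M root X Ls
    ... | yes c | _ = subst (Progress _) (sym (trans (step-top M X Ls eq) (then-branch c)))
      (OnTop.pop Ls Mok keys eq L S (≤ᵇ⇒≤ _ _ c))
    ... | no ¬c | yes s = subst (Progress _) (sym (trans (step-top M X Ls eq) (trans (else-branch ¬c) (then-branch s))))
      (OnTop.give-up Ls Mok keys eq L S (≤ᵇ⇒≤ _ _ s))
    ... | no ¬c | no ¬s = subst (Progress _) (sym (trans (step-top M X Ls eq) (trans (else-branch ¬c) (else-branch ¬s))))
      (OnTop.build Ls Mok keys eq L S (¬c ∘ ≤⇒≤ᵇ) (¬s ∘ ≤⇒≤ᵇ))

    iterate : ∀ {A : Set} → List A → State → State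
    iterate fuel st = foldl (λ st _ → step st) st fuel

    halted : ∀ {A : Set} (fuel : List A) {st} → step st ≡ st → iterate fuel st ≡ st
    halted []         eq = refl
    halted (_ ∷ fuel) eq = trans (cong (iterate fuel) eq) (halted fuel eq)

    -- A terminal state is fixed by `step`, so leftover fuel does no harm; before that every unit of
    -- fuel lowers the measure.
    terminates : ∀ {A : Set} (fuel : List A) {st} → Inv st → measure st ≤ length fuel → Terminal (iterate fuel st)
    terminates fuel {st} inv enough with step st in eq | progress inv
    ... | _ | halt t = subst Terminal (sym (halted fuel eq)) t
    terminates []         {st} inv enough | _ | advance inv′ decr = contradiction (<-≤-trans decr enough) λ ()
    terminates (_ ∷ fuel) {st} inv enough | st′ | advance inv′ decr rewrite eq =
      terminates fuel inv′ (s≤s⁻¹ (≤-trans decr enough))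

  -- The cover left by a failed search

  AllPairs-sub : ∀ {R : Edge → Edge → Set} {xs ys} → xs ⊑ ys → AllPairs R ys → AllPairs R xs
  AllPairs-sub []         []         = []
  AllPairs-sub (_ ∷ʳ p)   (_ ∷ rss)  = AllPairs-sub p rss
  AllPairs-sub (refl ∷ p) (rs ∷ rss) = All-resp-⊆ p rs ∷ AllPairs-sub p rss

  allX : List Layer → List Edge
  allX = concatMap proj₁

  used-split : ∀ Zs {f} → f ∈ˡ used Zs → f ∈ˡ allX Zs ++ allY Zs
  used-split ((X , Y) ∷ Zs) i with ∈-++⁻ (X ++ Y) i
  ... | inj₁ j with ∈-++⁻ X j
  ...   | inj₁ k = ∈-++⁺ˡ (∈-++⁺ˡ k)
  ...   | inj₂ k = ∈-++⁺ʳ (X ++ allX Zs) (∈-++⁺ˡ k)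
  used-split ((X , Y) ∷ Zs) i | inj₂ j with ∈-++⁻ (allX Zs) (used-split Zs j)
  ...   | inj₁ k = ∈-++⁺ˡ (∈-++⁺ʳ X k)
  ...   | inj₂ k = ∈-++⁺ʳ (X ++ allX Zs) (∈-++⁺ʳ Y k)

  -- An edge at an open source cannot be rejected as `full`, which leaves `hit`. The deeper layers
  -- contribute through the maximality recorded when they were frozen.
  opens-cover : ∀ {root} X Y Zs →
    (∀ {e} → e ∈ˡ E → SameKey e (source root Zs) → Covered (used Zs) X Y e) → IsStack root Zs →
    ∀ {e} → e ∈ˡ E → SameKey e (opens root ((X , Y) ∷ Zs)) →
    ∃[ f ] f ∈ˡ used ((X , Y) ∷ Zs) × T (meetB e f)
  opens-cover {root} X Y Zs maximal S {e} e∈E k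
    with Any.++⁻ (filterᵇ (λ f → degree X f <ᵇ U) (source root Zs)) k
  ... | inj₁ k′ = here-cover (maximal e∈E (Any-resp-⊆ (filter-⊆ _ (source root Zs)) k′))
    where
    here-cover : Covered (used Zs) X Y e → ∃[ f ] f ∈ˡ used ((X , Y) ∷ Zs) × T (meetB e f)
    here-cover (hit {f} i m) = f , subst (f ∈ˡ_) (sym (++-assoc X Y (used Zs))) i , m
    here-cover (full U≤) =
      let g , g∈ , e~g = find k′
          g-open = <ᵇ⇒< _ _ (proj₂ (∈-filterᵇ⁻ (λ f → degree X f <ᵇ U) (source root Zs) g∈))
      in contradiction (<-≤-trans (<-≤-trans g-open U≤) (degree-cong X e~g)) (<-irrefl refl)
  opens-cover {root} X Y ((X′ , Y′) ∷ Zs) maximal (push L F S) e∈E k | inj₂ k′ =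
    let f , i , m = opens-cover X′ Y′ Zs (IsFrozen.maximal F) S e∈E k′ in f , ∈-++⁺ʳ (X ++ Y) i , m

  -- A saturated source accounts for at least `U` edges of `X`, and as keys are distinct, no edge of
  -- `X` is counted for two sources.
  saturation : ∀ {s u X Y} → IsLayer s u X Y → Distinct s →
               U * length s ≤ U * count (λ f → degree X f <ᵇ U) s + length X
  saturation {s} {u} {X} L ne = begin
    U * length s                                  ≡⟨ cong (U *_) (sym (count-not unsat s)) ⟩
    U * (count unsat s + count (not ∘ unsat) s)   ≡⟨ *-distribˡ-+ U (count unsat s) _ ⟩
    U * count unsat s + U * length sat            ≤⟨ +-monoʳ-≤ (U * count unsat s) sat≤ ⟩
    U * count unsat s + length X                  ∎
    where
    open ≤-Reasoning
    unsat : Edge → Bool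
    unsat f = degree X f <ᵇ U
    sat = filterᵇ (not ∘ unsat) s
    sat≤ : U * length sat ≤ length X
    sat≤ = subst (U * length sat ≤_) (+-identityʳ _) (double-counting sameA sat X {U} {1}
      (All.tabulate λ {f} i → ≮⇒≥ (T-not⁻ (proj₂ (∈-filterᵇ⁻ (not ∘ unsat) s i)) ∘ <⇒<ᵇ))
      (All.tabulate λ {e} _ → ≤-trans (count-filterᵇ (λ f → sameA f e) (not ∘ unsat) s)
        (≤-trans (count-mono (λ f → sameA f e) (sameA e) s λ _ m → key⇒sameA (sym (sameA⇒key m)))
          (degree≤1 ne e))))

  -- The witness `n` counts the fresh edges of all layers. The bounds from `stuck` telescope because
  -- the sources of a layer are the `Y` of the layer below; the topmost `Y`, not yet the source of a
  -- frozen layer, stays on the left.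
  stack-size : p ≡ 2 * q * U → ∀ {root Zs} → IsStack root Zs →
    ∃[ n ] length (allX Zs) ≤ length (allY Zs) + U * n × p * n + length (source root Zs) ≤ suc (length (allY Zs))
  stack-size p≡ [] = 0 , z≤n , ≤-reflexive (cong (_+ 1) (*-zeroʳ p))
  stack-size p≡ {root} {(X , Y) ∷ Zs} (push L F S) =
    let n , x≤ , n≤ = stack-size p≡ S
        open ≤-Reasoning
        N = fresh Y X
        e : ∀ y U n z m → y + U * n + (z + U * m) ≡ y + z + U * (n + m)
        e = solve-∀
        e₂ : ∀ p n m → p * (n + m) ≡ p * m + p * n
        e₂ = solve-∀
    in length N + n ,
      (begin
        length (X ++ allX Zs)                                   ≡⟨ length-++ X ⟩
        length X + length (allX Zs)                             ≤⟨ +-mono-≤ (length-layer L) x≤ ⟩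
        length Y + U * length N + (length (allY Zs) + U * n)    ≡⟨ e (length Y) U (length N) _ n ⟩
        length Y + length (allY Zs) + U * (length N + n)        ≡⟨ cong (_+ U * (length N + n)) (sym (length-++ Y)) ⟩
        length (Y ++ allY Zs) + U * (length N + n)              ∎) ,
      (begin
        p * (length N + n) + length Y                           ≡⟨ cong (_+ length Y) (e₂ p (length N) n) ⟩
        p * n + p * length N + length Y                         ≤⟨ +-monoˡ-≤ (length Y) (+-monoʳ-≤ (p * n) (<⇒≤ (IsFrozen.stuck F))) ⟩
        p * n + length (source root Zs) + length Y              ≤⟨ +-monoˡ-≤ (length Y) n≤ ⟩
        suc (length (allY Zs) + length Y)                       ≡⟨ cong suc (+-comm (length (allY Zs)) (length Y)) ⟩
        suc (length Y + length (allY Zs))                       ≡⟨ cong suc (sym (length-++ Y)) ⟩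
        suc (length (Y ++ allY Zs))                             ∎)

  source>0 : p ≡ 2 * q * U → ∀ {root Zs} → IsStack root Zs → 1 ≤ length (source root Zs)
  source>0 p≡ []                         = s≤s z≤n
  source>0 p≡ {root} {_ ∷ Zs} (push L F S) = positive {c = 2 * q} (frozen-growth p≡ root Zs L F)

  stack-⊆E : ∀ {root Zs} → IsStack root Zs → All (_∈ˡ E) (allX Zs)
  stack-⊆E []           = []
  stack-⊆E (push L F S) = All.++⁺ (IsLayer.edges L) (stack-⊆E S)

  stack-touching : ∀ {root Zs} → IsStack root Zs →
                   ∀ {f} → f ∈ˡ allY Zs → ∃[ e ] e ∈ˡ allX Zs × T (meetB f e)
  stack-touching (push {X} {Y} L F S) i with ∈-++⁻ Y i
  ... | inj₁ j = let e , k , m = IsLayer.touching L j in e , ∈-++⁺ˡ k , m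
  ... | inj₂ j = let e , k , m = stack-touching S j in e , ∈-++⁺ʳ X k , m

  module OpenSources {M : List Edge} {root : Edge} (Mok : IsMatching M) (root∈M : root ∈ˡ M) (root# : root # root) where
    open OnMatching Mok root∈M root#
    private module M = IsMatching Mok

    source-distinct : ∀ Ls → Distinct (source root (annotate M Ls))
    source-distinct []      = [] ∷ []
    source-distinct (X ∷ _) = AllPairs.filter⁺ (λ f → T? (meets X f)) M.distinct

    opens-⊆ : ∀ Ls X Y → opens root ((X , Y) ∷ annotate M Ls) ⊑ sources Ls
    opens-⊆ []        X Y = subst (_⊑ root ∷ []) (sym (++-identityʳ _)) (filter-⊆ (λ f → T? (degree X f <ᵇ U)) (root ∷ []))
    opens-⊆ (X′ ∷ Ls) X Y = subst (opens root ((X , Y) ∷ annotate M (X′ ∷ Ls)) ⊑_)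
      (sym (++-assoc (blockers M X′) (allY (annotate M Ls)) (root ∷ [])))
      (++⁺ (filter-⊆ _ (blockers M X′)) (opens-⊆ Ls X′ (blockers M X′)))

    opens-length : ∀ Ls {X Y} → LayerOn root (annotate M Ls) X Y →
      IsStack root (annotate M Ls) →
      U * length (sources Ls) ≤
      U * length (opens root ((X , Y) ∷ annotate M Ls)) + (length X + length (allX (annotate M Ls)))
    opens-length Ls {X} {Y} L S = subst (λ k → U * length (sources Ls) ≤ U * k + (length X + length (allX (annotate M Ls))))
      (sym (length-++ O)) (go Ls L S)
      where
      O = filterᵇ (λ f → degree X f <ᵇ U) (source root (annotate M Ls))
      go : ∀ Ls {X Y} → LayerOn root (annotate M Ls) X Y →
        IsStack root (annotate M Ls) →
        U * length (sources Ls) ≤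
        U * (count (λ f → degree X f <ᵇ U) (source root (annotate M Ls)) + length (opens root (annotate M Ls)))
          + (length X + length (allX (annotate M Ls)))
      go [] {X} L S = subst₂ (λ j k → U * 1 ≤ U * j + k)
        (sym (+-identityʳ _)) (sym (+-identityʳ (length X))) (saturation L (source-distinct []))
      go (X′ ∷ Ls) {X} {Y} L S@(push L′ F′ S′) = begin
        U * length (sources (X′ ∷ Ls))
          ≡⟨ cong (U *_) (trans (cong length (++-assoc Y′ (allY Zs) (root ∷ []))) (length-++ Y′)) ⟩
        U * (length Y′ + length (sources Ls))
          ≡⟨ *-distribˡ-+ U (length Y′) _ ⟩
        U * length Y′ + U * length (sources Ls)
          ≤⟨ +-mono-≤ (saturation L (source-distinct (X′ ∷ Ls))) (opens-length Ls L′ S′) ⟩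
        U * c + length X + (U * o + (length X′ + length (allX Zs)))
          ≡⟨ e U c (length X) o _ ⟩
        U * (c + o) + (length X + (length X′ + length (allX Zs)))
          ≡⟨ cong (λ k → U * (c + o) + (length X + k)) (sym (length-++ X′)) ⟩
        U * (c + o) + (length X + length (X′ ++ allX Zs)) ∎
        where
        open ≤-Reasoning
        Zs = annotate M Ls
        Y′ = blockers M X′
        c = count (λ f → degree X f <ᵇ U) Y′
        o = length (opens root ((X′ , Y′) ∷ Zs))
        e : ∀ U c x o y → U * c + x + (U * o + y) ≡ U * (c + o) + (x + y)
        e = solve-∀

  -- `budgeted` relates the numbers of edges in `Xs`, `Ys` and `S`; it keeps the arithmetic of the
  -- constants apart from the combinatorics.
  record Obstruction (M S : List Edge) (budgeted : ℕ → ℕ → ℕ → Set) : Set where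
    field
      Xs Ys    : List Edge
      Xs⊆E     : All (_∈ˡ E) Xs
      Ys⊆E     : All (_∈ˡ E) Ys
      touching : ∀ {f} → f ∈ˡ Ys → ∃[ e ] e ∈ˡ Xs × T (meetB f e)
      S⊆M      : All (_∈ˡ M) S
      distinct : Distinct S
      cover    : ∀ {e} → e ∈ˡ E → SameKey e S → ∃[ f ] f ∈ˡ Xs ++ Ys × T (meetB e f)
      sized    : budgeted (length Xs) (length Ys) (length S)

  module _ (p≡ : p ≡ 2 * q * U) (budgeted : ℕ → ℕ → ℕ → Set)
    (budget-lemma : ∀ x x′ y y′ n s → x ≤ y + U * n → 2 * q * U * n ≤ y → q * x′ ≤ y → y′ ≤ b * x′ →
                    U * suc y ≤ U * s + (x′ + x) → budgeted (x′ + x) (y′ + y) s) where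

    obstruction : ∀ {M root} X Ls (Mok : IsMatching M) (root∈M : root ∈ˡ M) (root# : root # root) →
      let Zs = annotate M Ls ; Y = blockers M X in
      LayerOn root Zs X Y →
      (∀ {e} → e ∈ˡ E → SameKey e (source root Zs) → Covered (used Zs) X Y e) →
      IsStack root Zs → q * length X ≤ length (allY Zs) →
      Obstruction M (opens root ((X , Y) ∷ Zs)) budgeted
    obstruction {M} {root} X Ls Mok root∈M root# L maximal S small = record
      { Xs       = X ++ allX Zs
      ; Ys       = Y ++ allY Zs
      ; Xs⊆E     = All.++⁺ (IsLayer.edges L) (stack-⊆E S)
      ; Ys⊆E     = All.tabulate λ {f} i → real (Ys⊆M i)
      ; touching = λ i → touch (∈-++⁻ Y i)
      ; S⊆M      = All.tabulate λ i → sources-⊆ Ls (Any-resp-⊆ (opens-⊆ Ls X Y) i)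
      ; distinct = AllPairs-sub (opens-⊆ Ls X Y) (sources-distinct Ls S)
      ; cover    = λ e∈E k → let f , i , m = opens-cover X Y Zs maximal S e∈E k in f , used-split ((X , Y) ∷ Zs) i , m
      ; sized    = subst₂ (λ x y → budgeted x y (length (opens root ((X , Y) ∷ Zs))))
                     (sym (length-++ X)) (sym (length-++ Y)) in-budget
      }
      where
      open OnMatching Mok root∈M root#
      open OpenSources Mok root∈M root#
      Zs = annotate M Ls
      Y  = blockers M X
      Ys⊆M : ∀ {f} → f ∈ˡ Y ++ allY Zs → f ∈ˡ M × T (meetB f f)
      Ys⊆M i = allY-⊆ (X ∷ Ls) i
      real : ∀ {f} → f ∈ˡ M × T (meetB f f) → f ∈ˡ E
      real (i , m) with All.lookup (IsMatching.real Mok) i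
      ... | inj₁ f∈E = f∈E
      ... | inj₂ f#f = contradiction m f#f
      touch : ∀ {f} → f ∈ˡ Y ⊎ f ∈ˡ allY Zs → ∃[ e ] e ∈ˡ X ++ allX Zs × T (meetB f e)
      touch (inj₁ j) = let e , k , m = IsLayer.touching L j in e , ∈-++⁺ˡ k , m
      touch (inj₂ j) = let e , k , m = stack-touching S j in e , ∈-++⁺ʳ X k , m
      in-budget : budgeted (length X + length (allX Zs)) (length Y + length (allY Zs)) (length (opens root ((X , Y) ∷ Zs)))
      in-budget =
        let n , x≤ , n≤ = stack-size p≡ S
            -- The current source is nonempty and thus offsets the root, which is the 1 in `suc`.
            n≤′ = s≤s⁻¹ (≤-trans (≤-trans (≤-reflexive (+-comm 1 (p * n))) (+-monoʳ-≤ (p * n) (source>0 p≡ S))) n≤)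
        in budget-lemma (length (allX Zs)) (length X) (length (allY Zs)) (length Y) n _ x≤
             (subst (λ p → p * n ≤ length (allY Zs)) p≡ n≤′) small (IsLayer.spread L)
             (subst (λ k → U * k ≤ U * length (opens root ((X , Y) ∷ Zs)) + (length X + length (allX Zs))) (length-sources Ls) (opens-length Ls L S))

  data Solved (ks : List K) (budgeted : ℕ → ℕ → ℕ → Set) : List Edge ⊎ List Edge → Set where
    perfect : ∀ {M} → All (_∈ˡ E) M → AllPairs _#_ M → map key M ≡ ks → Solved ks budgeted (inj₁ M)
    blocked : ∀ {M S} → map key M ≡ ks → Obstruction M S budgeted → Solved ks budgeted (inj₂ S)

  output-matched : ∀ {M} Ls → roots M ≡ [] → output (M , Ls) ≡ inj₁ M
  output-matched Ls eq rewrite eq = refl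

  output-failed : ∀ M {root rest} X Ls → roots M ≡ root ∷ rest → let open Top M root X Ls in
                  output (M , X ∷ Ls) ≡ inj₂ (opens root ((X⁺ , Y⁺) ∷ Zs))
  output-failed M X Ls eq rewrite eq = refl

  module _ (ks : List K) (h D depthBound : ℕ)
    (p≡ : p ≡ 2 * q * U) (h≡ : h ≡ b * U * (2 * q) * p) (D≡ : D ≡ suc (suc h * (b * U)))
    (shallow : ∀ l → suc (2 * q) ^ l ≤ length ks * (2 * q) ^ l → suc l ≤ depthBound)
    (budgeted : ℕ → ℕ → ℕ → Set)
    (budget-lemma : ∀ x x′ y y′ n s → x ≤ y + U * n → 2 * q * U * n ≤ y → q * x′ ≤ y → y′ ≤ b * x′ →
                    U * suc y ≤ U * s + (x′ + x) → budgeted (x′ + x) (y′ + y) s) where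

    open Run ks h D depthBound p≡ h≡ D≡ shallow

    output-solved : ∀ {st} → Terminal st → Solved ks budgeted (output st)
    output-solved (matched {M} {Ls} Mok keys eq) = subst (Solved ks budgeted) (sym (output-matched Ls eq))
      (perfect (All.tabulate real) (IsMatching.apart Mok) keys)
      where
      real : ∀ {f} → f ∈ˡ M → f ∈ˡ E
      real i with All.lookup (IsMatching.real Mok) i
      ... | inj₁ f∈E = f∈E
      ... | inj₂ f#f = contradiction (subst (_ ∈ˡ_) eq (∈-filterᵇ⁺ (λ e → not (meetB e e)) i (T-not⁺ f#f))) λ ()
    output-solved (failed {M} {root} {rest} {X} {Ls} Mok keys eq L maximal S sm) =
      subst (Solved ks budgeted) (sym (output-failed M X Ls eq))
        (blocked keys (obstruction p≡ budgeted budget-lemma X⁺ Ls Mok (proj₁ (roots-head M eq)) (proj₂ (roots-head M eq))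
          L maximal S sm))
      where open Top M root X Ls using (X⁺)

    solve : ∀ {A : Set} (fuel : List A) {M} → IsMatching M → map key M ≡ ks →
            length M * (2 + Φ₀) + (1 + Φ₀) ≤ length fuel →
            Solved ks budgeted (output (foldl (λ st _ → step st) (M , []) fuel))
    solve fuel {M} Mok keys enough = output-solved (terminates fuel (base Mok keys)
      (≤-trans (measure-base M) (≤-trans (+-monoˡ-≤ (1 + Φ₀) (*-monoˡ-≤ (2 + Φ₀)
        (length-filter (λ e → T? (not (meetB e e))) M))) enough)))

-- Choice of the constants

module _ (m β : ℕ) .{{_ : NonZero m}} where
  private
    b = suc β

  -- gapBound is m (2r - 3 + 1/m) for r = β + 2. With y blockers, a cover exceeds
  -- (2r - 3) y by at most y / 2m because of slackBound, and the saturated sources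
  -- cost another y / 2m because U = 6 gapBound.
  gapBound slackBound : ℕ
  gapBound   = suc (m * (2 * β + 1))
  slackBound = 4 * m * (b * b)

  module _ (x x′ y y′ n s : ℕ) where
    private
      G = gapBound
      q = slackBound
      U = 6 * G
    budget : x ≤ y + U * n → 2 * q * U * n ≤ y → q * x′ ≤ y → y′ ≤ b * x′ →
             U * suc y ≤ U * s + (x′ + x) →
             ∃[ s′ ] s ≡ suc s′ × m * (b * (x′ + x) + β * (y′ + y)) ≤ G * s′
    budget x≤ n≤ x′≤ y′≤ s≥ = conclude s s≥
      where
      open ≤-Reasoning
      instance
        q≢0 : NonZero q
        q≢0 = m*n≢0 (4 * m) (b * b) {{m*n≢0 4 m}}
        2q≢0 : NonZero (2 * q)
        2q≢0 = m*n≢0 2 q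
        4m≢0 : NonZero (4 * m)
        4m≢0 = m*n≢0 4 m
      2qx≤ : 2 * q * x ≤ 2 * q * y + y
      2qx≤ = begin
        2 * q * x                  ≤⟨ *-monoʳ-≤ (2 * q) x≤ ⟩
        2 * q * (y + U * n)        ≡⟨ e (2 * q) y U n ⟩
        2 * q * y + 2 * q * U * n  ≤⟨ +-monoʳ-≤ (2 * q * y) n≤ ⟩
        2 * q * y + y              ∎
        where
        e : ∀ q y U n → q * (y + U * n) ≡ q * y + q * U * n
        e = solve-∀
      x≤2y : x ≤ y + y
      x≤2y = *-cancelˡ-≤ (2 * q) (≤-trans 2qx≤ (≤-trans (+-monoʳ-≤ (2 * q * y) (m≤n*m y (2 * q)))
        (≤-reflexive (sym (*-distribˡ-+ (2 * q) y y)))))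
      x′≤y : x′ ≤ y
      x′≤y = ≤-trans (m≤n*m x′ q) x′≤
      4mbx≤ : 4 * m * b * x ≤ 4 * m * b * y + y
      4mbx≤ = *-cancelˡ-≤ (2 * b) (begin
        2 * b * (4 * m * b * x)              ≡⟨ e₁ b m x ⟩
        2 * (4 * m * (b * b)) * x            ≤⟨ 2qx≤ ⟩
        2 * (4 * m * (b * b)) * y + y        ≤⟨ +-monoʳ-≤ (2 * (4 * m * (b * b)) * y) (m≤n*m y (2 * b)) ⟩
        2 * (4 * m * (b * b)) * y + 2 * b * y ≡⟨ e₂ b m y ⟩
        2 * b * (4 * m * b * y + y)          ∎)
        where
        e₁ : ∀ b m x → 2 * b * (4 * m * b * x) ≡ 2 * (4 * m * (b * b)) * x
        e₁ = solve-∀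
        e₂ : ∀ b m y → 2 * (4 * m * (b * b)) * y + 2 * b * y ≡ 2 * b * (4 * m * b * y + y)
        e₂ = solve-∀
      cost = b * (x′ + x) + β * (y′ + y)
      -- After scaling by `4 * m`, the coefficient of `x′` is `slackBound`, since
      -- `b + β * b = b * b`; so the top layer costs at most `y`. The excess of `x` over `y` costs
      -- another `y`, and `2 * y` remain for the saturated sources.
      4m-cost≤ : 4 * m * cost + 2 * y ≤ 4 * G * y
      4m-cost≤ = begin
        4 * m * (b * (x′ + x) + β * (y′ + y)) + 2 * y
          ≤⟨ +-monoˡ-≤ (2 * y) (*-monoʳ-≤ (4 * m) (+-monoʳ-≤ (b * (x′ + x)) (*-monoʳ-≤ β (+-monoˡ-≤ y y′≤)))) ⟩
        4 * m * (suc β * (x′ + x) + β * (suc β * x′ + y)) + 2 * y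
          ≡⟨ e₁ m β x x′ y ⟩
        4 * m * (suc β * suc β) * x′ + 4 * m * suc β * x + (4 * m * β * y + 2 * y)
          ≤⟨ +-monoˡ-≤ (4 * m * β * y + 2 * y) (+-mono-≤ x′≤ 4mbx≤) ⟩
        y + (4 * m * suc β * y + y) + (4 * m * β * y + 2 * y)
          ≡⟨ e₂ m β y ⟩
        4 * suc (m * (2 * β + 1)) * y ∎
        where
        e₁ : ∀ m β x x′ y → 4 * m * (suc β * (x′ + x) + β * (suc β * x′ + y)) + 2 * y ≡
             4 * m * (suc β * suc β) * x′ + 4 * m * suc β * x + (4 * m * β * y + 2 * y)
        e₁ = solve-∀
        e₂ : ∀ m β y → y + (4 * m * suc β * y + y) + (4 * m * β * y + 2 * y) ≡ 4 * suc (m * (2 * β + 1)) * y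
        e₂ = solve-∀
      conclude : ∀ s → U * suc y ≤ U * s + (x′ + x) → ∃[ s′ ] s ≡ suc s′ × m * cost ≤ G * s′
      conclude s s≥ = go s (≤-trans s≥ (+-monoʳ-≤ (U * s) (≤-trans (+-mono-≤ x′≤y x≤2y) (≤-reflexive (e y)))))
        where
        e : ∀ y → y + (y + y) ≡ 3 * y
        e = solve-∀
        go : ∀ s → U * suc y ≤ U * s + 3 * y → ∃[ s′ ] s ≡ suc s′ × m * cost ≤ G * s′
        -- If all sources were saturated, `6 * suc y ≤ 3 * y` would follow.
        go zero    s≥ = contradiction (begin-strict
          3 * y              ≤⟨ *-monoˡ-≤ y (m≤m+n 3 3) ⟩
          6 * y              <⟨ *-monoʳ-< 6 (n<1+n y) ⟩
          6 * suc y          ≤⟨ *-monoˡ-≤ (suc y) (m≤m*n 6 G) ⟩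
          U * suc y          ≤⟨ s≥ ⟩
          U * 0 + 3 * y      ≡⟨ cong (_+ 3 * y) (*-zeroʳ U) ⟩
          3 * y              ∎) (<-irrefl refl)
        go (suc s′) s≥ = s′ , refl , *-cancelˡ-≤ 4 (+-cancelʳ-≤ (2 * y) (4 * (m * cost)) (4 * (G * s′)) (begin
          4 * (m * cost) + 2 * y        ≡⟨ cong (_+ 2 * y) (sym (*-assoc 4 m cost)) ⟩
          4 * m * cost + 2 * y          ≤⟨ 4m-cost≤ ⟩
          4 * G * y                  ≤⟨ 4Gy≤ ⟩
          4 * (G * s′) + 2 * y       ∎))
          where
          -- `U = 6 * G` turns the at most `3 * y` edges of the layers into a loss of `2 * y`. The
          -- root, which is the 1 in `suc y`, pays for passing from the number of open sources to
          -- its predecessor `s′`.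
          4Gy≤ : 4 * G * y ≤ 4 * (G * s′) + 2 * y
          4Gy≤ = *-cancelˡ-≤ 3 (+-cancelˡ-≤ (2 * (6 * G)) (3 * (4 * G * y)) (3 * (4 * (G * s′) + 2 * y)) (begin
            2 * (6 * G) + 3 * (4 * G * y)              ≡⟨ e₁ G y ⟩
            2 * (6 * G * suc y)                        ≤⟨ *-monoʳ-≤ 2 s≥ ⟩
            2 * (6 * G * suc s′ + 3 * y)               ≡⟨ e₂ G s′ y ⟩
            2 * (6 * G) + 3 * (4 * (G * s′) + 2 * y)   ∎))
            where
            e₁ : ∀ G y → 2 * (6 * G) + 3 * (4 * G * y) ≡ 2 * (6 * G * suc y)
            e₁ = solve-∀
            e₂ : ∀ G s y → 2 * (6 * G * suc s + 3 * y) ≡ 2 * (6 * G) + 3 * (4 * (G * s) + 2 * y)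
            e₂ = solve-∀

-- Logarithms and exponential growth

power-of-two : ∀ n → ∃[ L ] n < 2 ^ L × 2 ^ L ≤ 2 * n + 1
power-of-two zero = 0 , s≤s z≤n , ≤-refl
power-of-two (suc n) with power-of-two n
... | L , n< , ≤2n+1 with suc n <? 2 ^ L
...   | yes sn< = L , sn< , ≤-trans ≤2n+1 (+-monoˡ-≤ 1 (*-monoʳ-≤ 2 (n≤1+n n)))
...   | no  sn≮ = suc L , <-≤-trans (m<m+n (suc n) (s≤s z≤n)) (≤-trans (≤-reflexive (e (suc n))) (*-monoʳ-≤ 2 n<)) ,
                  ≤-trans (*-monoʳ-≤ 2 (≮⇒≥ sn≮)) (m≤m+n _ 1)
  where
  e : ∀ n → n + n ≡ 2 * n
  e = solve-∀

-- Bernoulli's inequality `(1 + 1 / c) ^ k ≥ 1 + k / c`, freed of denominators.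
bernoulli : ∀ c k → (c + k) * c ^ k ≤ c * suc c ^ k
bernoulli c zero    = ≤-reflexive (cong (_* 1) (+-identityʳ c))
bernoulli c (suc k) = begin
  (c + suc k) * (c * c ^ k)              ≤⟨ m≤m+n _ (k * c ^ k) ⟩
  (c + suc k) * (c * c ^ k) + k * c ^ k  ≡⟨ e₁ c k (c ^ k) ⟩
  suc c * ((c + k) * c ^ k)              ≤⟨ *-monoʳ-≤ (suc c) (bernoulli c k) ⟩
  suc c * (c * suc c ^ k)                ≡⟨ e₂ c (suc c ^ k) ⟩
  c * (suc c * suc c ^ k)                ∎
  where
  open ≤-Reasoning
  e₁ : ∀ c k w → (c + suc k) * (c * w) + k * w ≡ suc c * ((c + k) * w)
  e₁ = solve-∀
  e₂ : ∀ c w → suc c * (c * w) ≡ c * (suc c * w)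
  e₂ = solve-∀

module _ (c : ℕ) .{{_ : NonZero c}} where

  doubling : 2 * c ^ c ≤ suc c ^ c
  doubling = *-cancelˡ-≤ c (≤-trans (≤-reflexive (e c (c ^ c))) (bernoulli c c))
    where
    e : ∀ c w → c * (2 * w) ≡ (c + c) * w
    e = solve-∀

  exponential-growth : ∀ L j → 2 ^ L * c ^ (c * L + j) ≤ suc c ^ (c * L + j)
  exponential-growth L j = begin
    2 ^ L * c ^ (c * L + j)         ≡⟨ cong (2 ^ L *_) (^-distribˡ-+-* c (c * L) j) ⟩
    2 ^ L * (c ^ (c * L) * c ^ j)   ≡⟨ cong (λ w → 2 ^ L * (w * c ^ j)) (sym (^-*-assoc c c L)) ⟩
    2 ^ L * ((c ^ c) ^ L * c ^ j)   ≡⟨ sym (*-assoc (2 ^ L) _ _) ⟩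
    2 ^ L * (c ^ c) ^ L * c ^ j     ≡⟨ cong (_* c ^ j) (sym (^-distribʳ-* L 2 (c ^ c))) ⟩
    (2 * c ^ c) ^ L * c ^ j         ≤⟨ *-mono-≤ (^-monoˡ-≤ L doubling) (^-monoˡ-≤ j (n≤1+n c)) ⟩
    (suc c ^ c) ^ L * suc c ^ j     ≡⟨ cong (_* suc c ^ j) (^-*-assoc (suc c) c L) ⟩
    suc c ^ (c * L) * suc c ^ j     ≡⟨ sym (^-distribˡ-+-* (suc c) (c * L) j) ⟩
    suc c ^ (c * L + j)             ∎
    where open ≤-Reasoning

  -- Growth by `1 + 1 / c` doubles in every `c` layers, so from depth `c * L` on it would exceed
  -- `n`.
  shallow : ∀ {n} L → n < 2 ^ L → ∀ l → suc c ^ l ≤ n * c ^ l → suc l ≤ c * L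
  shallow {n} L n< l l≤ with c * L ≤? l
  ... | no ≰  = ≰⇒> ≰
  ... | yes ≤l = contradiction (*-cancelʳ-≤ (2 ^ L) n (c ^ l) {{m^n≢0 c l}}
    (≤-trans (subst (λ l → 2 ^ L * c ^ l ≤ suc c ^ l) (m+[n∸m]≡n ≤l) (exponential-growth L (l ∸ c * L))) l≤)) (<⇒≱ n<)

-- The natural exponent of `2 ^ L` would be a logarithm of `D ^ c`. Bounding `D ^ c` by
-- `2 ^ (D ^ c)` gives an integer instead, which is large but independent of `n`.
power-bound : ∀ D c n L → 2 ^ L ≤ 2 * n + 1 → D ^ (c * L) ≤ (2 * n + 1) ^ (D ^ c)
power-bound D c n L ≤n = begin
  D ^ (c * L)               ≡⟨ sym (^-*-assoc D c L) ⟩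
  (D ^ c) ^ L               ≤⟨ ^-monoˡ-≤ L (con≤ 0 (D ^ c)) ⟩
  (2 ^ (D ^ c)) ^ L         ≡⟨ ^-*-assoc 2 (D ^ c) L ⟩
  2 ^ (D ^ c * L)           ≡⟨ cong (2 ^_) (*-comm (D ^ c) L) ⟩
  2 ^ (L * D ^ c)           ≡⟨ sym (^-*-assoc 2 L (D ^ c)) ⟩
  (2 ^ L) ^ (D ^ c)         ≤⟨ ^-monoˡ-≤ (D ^ c) ≤n ⟩
  (2 * n + 1) ^ (D ^ c)     ∎
  where open ≤-Reasoning

-- The local search as a program

V : Ty
V = vertexSetTy

BinaryI : (Bool → Bool → Bool) → Set
BinaryI op = ∀ {Γ f g} → Impl Γ bool f → Impl Γ bool g → Impl Γ bool (λ ρ → op (f ρ) (g ρ))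

all-tt : ∀ (xs : List Bool) → All (λ _ → ⊤) xs
all-tt []       = []
all-tt (x ∷ xs) = tt ∷ all-tt xs

module _ (op : Bool → Bool → Bool) where
  zipStep : List Bool × List Bool → Bool → List Bool × List Bool
  zipStep st x = match (proj₁ st) st λ y ys → ys , op x y ∷ proj₂ st

  zip-done : ∀ out xs → foldl zipStep ([] , out) xs ≡ ([] , out)
  zip-done out []       = refl
  zip-done out (x ∷ xs) = zip-done out xs

  zip-correct : ∀ out xs ys → reverse (proj₂ (foldl zipStep (ys , out) xs)) ≡ reverse out ++ zipWith op xs ys
  zip-correct out []       ys = sym (++-identityʳ (reverse out))
  zip-correct out (x ∷ xs) [] = trans (cong (reverse ∘ proj₂) (zip-done out xs)) (sym (++-identityʳ (reverse out)))
  zip-correct out (x ∷ xs) (y ∷ ys) = trans (zip-correct (op x y ∷ out) xs ys)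
    (trans (cong (_++ zipWith op xs ys) (unfold-reverse (op x y) out))
           (++-assoc (reverse out) (op x y ∷ []) (zipWith op xs ys)))

  zip-bounded : ∀ {k l} out xs ys → length ys ≤ k → length out + length xs ≤ l →
    Bounded (k + l) (V ⊗ V) (foldl zipStep (ys , out) xs)
  zip-bounded out [] ys p q = (≤-trans p (m≤m+n _ _) , all-tt ys) ,
    (≤-trans (≤-trans (m≤m+n _ 0) q) (m≤n+m _ _) , all-tt out)
  zip-bounded out (x ∷ xs) []       p q = zip-bounded out xs [] p (≤-trans (+-monoʳ-≤ (length out) (n≤1+n _)) q)
  zip-bounded out (x ∷ xs) (y ∷ ys) p q = zip-bounded (op x y ∷ out) xs ys (≤-trans (n≤1+n _) p)
    (≤-trans (≤-reflexive (sym (+-suc (length out) (length xs)))) q)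

  zipWithI : BinaryI op → ∀ {f g} → Impl Γ V f → Impl Γ V g → Impl Γ V (λ ρ → zipWith op (f ρ) (g ρ))
  zipWithI opI {f} {g} F G = castI (λ ρ → zip-correct [] (f ρ) (g ρ))
    (reverseI (sndI (foldlI′ F (pairI G nilI)
      (unconsI (fstI v1) v1 (pairI v1 (consI (opI v2 v0) (sndI (varI (there (there (there (here refl)))))))))
      (width G ⊞ width F) λ ok xs b → zip-bounded [] xs _ (proj₁ (bound G ok)) (proj₁ b))))

_∧ᵛ_ _∨ᵛ_ : List Bool → List Bool → List Bool
_∧ᵛ_ = zipWith _∧_
_∨ᵛ_ = zipWith _∨_

iff : Bool → Bool → Bool
iff x y = if x then y else not y

eqᵛ : List Bool → List Bool → Bool
eqᵛ []       []       = true
eqᵛ []       (_ ∷ _)  = false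
eqᵛ (_ ∷ _)  []       = false
eqᵛ (x ∷ xs) (y ∷ ys) = iff x y ∧ eqᵛ xs ys

eqStep : Bool × List Bool → Bool → Bool × List Bool
eqStep st x = match (proj₂ st) (false , []) λ y ys → proj₁ st ∧ iff x y , ys

eq-correct : ∀ ok xs ys → (let st = foldl eqStep (ok , ys) xs in match (proj₂ st) (proj₁ st) λ _ _ → false) ≡ ok ∧ eqᵛ xs ys
eq-correct ok []       []       = sym (∧-identityʳ ok)
eq-correct ok []       (y ∷ ys) = sym (∧-zeroʳ ok)
eq-correct ok (x ∷ xs) []       = trans (failed xs) (sym (∧-zeroʳ ok))
  where
  failed : ∀ xs → (let st = foldl eqStep (false , []) xs in match (proj₂ st) (proj₁ st) λ _ _ → false) ≡ false
  failed []       = refl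
  failed (x ∷ xs) = failed xs
eq-correct ok (x ∷ xs) (y ∷ ys) = trans (eq-correct (ok ∧ iff x y) xs ys) (∧-assoc ok (iff x y) (eqᵛ xs ys))

eqI : ∀ {f g} → Impl Γ V f → Impl Γ V g → Impl Γ bool (λ ρ → eqᵛ (f ρ) (g ρ))
eqI {Γ} {f} {g} F G = castI (λ ρ → eq-correct true (f ρ) (g ρ))
  (bindI (foldlI′ F (pairI trueI G)
      (unconsI (sndI v1) (pairI falseI nilI)
        (pairI (∧I (fstI (varI (there (there (there (here refl)))))) (ifI v2 v0 (notI v0))) v1))
      (width G) λ ok xs _ → tt , bounded true xs (bound G ok))
    (unconsI (sndI v0) (fstI v0) falseI))
  where
  bounded : ∀ {s} ok xs {ys} → Bounded s V ys → Bounded s V (proj₂ (foldl eqStep (ok , ys) xs))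
  bounded ok []       b = b
  bounded ok (x ∷ xs) {[]}     b       = bounded false xs (z≤n , [])
  bounded ok (x ∷ xs) {y ∷ ys} (l , _) = bounded _ xs (≤-trans (n≤1+n _) l , all-tt ys)

sameᵛ meetᵛ : List Bool → List Bool → List Bool → Bool
sameᵛ A e f = eqᵛ (A ∧ᵛ e) (A ∧ᵛ f)
meetᵛ B e f = any (λ x → x) (B ∧ᵛ (e ∧ᵛ f))

sameI : ∀ {a e f} → Impl Γ V a → Impl Γ V e → Impl Γ V f → Impl Γ bool (λ ρ → sameᵛ (a ρ) (e ρ) (f ρ))
sameI A E F = eqI (zipWithI _∧_ ∧I A E) (zipWithI _∧_ ∧I A F)

meetI : ∀ {b e f} → Impl Γ V b → Impl Γ V e → Impl Γ V f → Impl Γ bool (λ ρ → meetᵛ (b ρ) (e ρ) (f ρ))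
meetI B E F = anyI (zipWithI _∧_ ∧I B (zipWithI _∧_ ∧I E F)) v0

complementI : ∀ {f} → Impl Γ V f → Impl Γ V (λ ρ → map not (f ρ))
complementI F = mapI F (notI v0)

zeros : List Bool → List Bool
zeros = map (λ _ → false)

-- The placeholders of all vertices of `A`. They form the initial matching, and their number
-- determines the fuel.
singletons : List Bool → List (List Bool)
singletons []       = []
singletons (b ∷ bs) = (if b then (true ∷ zeros bs) ∷_ else id) (map (false ∷_) (singletons bs))

length-singletons : ∀ bs → length (singletons bs) ≤ length bs
length-singletons []           = z≤n
length-singletons (true ∷ bs)  = s≤s (≤-trans (≤-reflexive (length-map _ (singletons bs))) (length-singletons bs))
length-singletons (false ∷ bs) = m≤n⇒m≤1+n (≤-trans (≤-reflexive (length-map _ (singletons bs))) (length-singletons bs))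

singletons-length : ∀ bs → All (λ v → length v ≡ length bs) (singletons bs)
singletons-length []           = []
singletons-length (true ∷ bs)  = cong suc (length-map _ bs) ∷ All.map⁺ (All.map (cong suc) (singletons-length bs))
singletons-length (false ∷ bs) = All.map⁺ (All.map (cong suc) (singletons-length bs))

singletonsI : ∀ {f} → Impl Γ V f → Impl Γ (list V) (λ ρ → singletons (f ρ))
singletonsI {Γ} {f} F = castI (λ ρ → cong proj₂ (as-foldr (f ρ)))
  (sndI (foldrI F (pairI nilI nilI)
    (bindI (mapI (sndI v1) (consI falseI v0))
      (pairI (consI falseI (fstI v2)) (ifI v1 (consI (consI trueI (fstI v2)) v0) v0)))
    (width F) λ ok xs b → subst (Bounded _ (V ⊗ list V)) (sym (as-foldr xs)) (bounded xs b)))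
  where
  go : List Bool → List Bool × List (List Bool)
  go = foldr (λ b acc → (false ∷ proj₁ acc) ,
         (if b then (true ∷ proj₁ acc) ∷ map (false ∷_) (proj₂ acc) else map (false ∷_) (proj₂ acc))) ([] , [])
  as-foldr : ∀ bs → go bs ≡ (zeros bs , singletons bs)
  as-foldr []           = refl
  as-foldr (true ∷ bs)  rewrite as-foldr bs = refl
  as-foldr (false ∷ bs) rewrite as-foldr bs = refl
  bounded : ∀ {s} bs → Bounded s V bs → Bounded s (V ⊗ list V) (zeros bs , singletons bs)
  bounded bs (l , _) = (≤-trans (≤-reflexive (length-map _ bs)) l , all-tt _) ,
    (≤-trans (length-singletons bs) l ,
     All.map (λ {v} eq → ≤-trans (≤-reflexive eq) l , all-tt v) (singletons-length bs))

-- Intersecting with `A` leaves the vertex of `A` in each edge, so a list of open sources becomes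
-- the vertex set of the answer.
union : List Bool → List (List Bool) → List Bool
union A = foldr (λ f v → (A ∧ᵛ f) ∨ᵛ v) (zeros A)

length-zipWith≤ : ∀ (op : Bool → Bool → Bool) xs ys → length (zipWith op xs ys) ≤ length ys
length-zipWith≤ op []       ys       = z≤n
length-zipWith≤ op (x ∷ xs) []       = z≤n
length-zipWith≤ op (x ∷ xs) (y ∷ ys) = s≤s (length-zipWith≤ op xs ys)

unionI : ∀ {a s} → Impl Γ V a → Impl Γ (list V) s → Impl Γ V (λ ρ → union (a ρ) (s ρ))
unionI A S = foldrI S (mapI A falseI) (zipWithI _∨_ ∨I (zipWithI _∧_ ∧I (wk (wk A)) v0) v1) (width A)
  λ ok fs _ → bounded _ fs (proj₁ (bound A ok)) , all-tt _
  where
  bounded : ∀ a fs {s} → length a ≤ s → length (union a fs) ≤ s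
  bounded a []       l = ≤-trans (≤-reflexive (length-map _ a)) l
  bounded a (f ∷ fs) l = ≤-trans (length-zipWith≤ _∨_ (a ∧ᵛ f) (union a fs)) (bounded a fs l)

module Implementation (U p q : ℕ) where
  module Alg (A B : List Bool) (E : List (List Bool)) = Algorithm (sameᵛ A) (meetᵛ B) E U p q

  layerTy stateTy : Ty
  layerTy = list V ⊗ list V
  stateTy = list V ⊗ list (list V)

  Vs : Ty
  Vs = list V

  meetsI : ∀ {b xs e} → Impl Γ V b → Impl Γ Vs xs → Impl Γ V e →
           Impl Γ bool (λ ρ → any (meetᵛ (b ρ) (e ρ)) (xs ρ))
  meetsI B Xs E = anyI Xs (meetI (wk B) (wk E) v0)

  blockersI : ∀ {b m x} → Impl Γ V b → Impl Γ Vs m → Impl Γ Vs x →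
              Impl Γ Vs (λ ρ → filterᵇ (λ f → any (meetᵛ (b ρ) f) (x ρ)) (m ρ))
  blockersI B M X = filterI M (meetsI (wk B) (wk X) v0)

  annotateI : ∀ {b m ls} → Impl Γ V b → Impl Γ Vs m → Impl Γ (list Vs) ls →
              Impl Γ (list layerTy) (λ ρ → map (λ X → X , filterᵇ (λ f → any (meetᵛ (b ρ) f) X) (m ρ)) (ls ρ))
  annotateI B M Ls = mapI Ls (pairI v0 (blockersI (wk B) (wk M) v0))

  sourceI : ∀ (a b : Env Γ → List Bool) (e : Env Γ → List (List Bool)) {r zs} →
            Impl Γ V r → Impl Γ (list layerTy) zs → Impl Γ Vs (λ ρ → Alg.source (a ρ) (b ρ) (e ρ) (r ρ) (zs ρ))
  sourceI a b e {r} {zs} R Zs = castI (λ ρ → eq (a ρ) (b ρ) (e ρ) (r ρ) (zs ρ)) (unconsI Zs (consI R nilI) (sndI v0))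
    where
    eq : ∀ a b e r zs → match zs (r ∷ []) (λ Z _ → proj₂ Z) ≡ Alg.source a b e r zs
    eq a b e r []      = refl
    eq a b e r (_ ∷ _) = refl

  usedI : ∀ {zs} → Impl Γ (list layerTy) zs → Impl Γ Vs (λ ρ → concatMap (λ Z → proj₁ Z ++ proj₂ Z) (zs ρ))
  usedI Zs = concatMapI Zs (fstI v0 ++I sndI v0)

  allYI : ∀ {zs} → Impl Γ (list layerTy) zs → Impl Γ Vs (λ ρ → concatMap proj₂ (zs ρ))
  allYI Zs = concatMapI Zs (sndI v0)

  unsaturatedI : ∀ {a x e} → Impl Γ V a → Impl Γ Vs x → Impl Γ V e →
                 Impl Γ bool (λ ρ → count (sameᵛ (a ρ) (e ρ)) (x ρ) <ᵇ U)
  unsaturatedI {a = a} {x} {e} A X E = castI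
    (λ ρ → cong (count (sameᵛ (a ρ) (e ρ)) (x ρ) <ᵇ_) (trans (length-repeat U (tt ∷ [])) (*-identityʳ U)))
    (consI E (filterI X (sameI (wk A) (wk E) v0)) ≤I repeatI U (consI unitI nilI))

  addableI : ∀ {a b m s u x e} → Impl Γ V a → Impl Γ V b → Impl Γ Vs m → Impl Γ Vs s → Impl Γ Vs u →
    Impl Γ Vs x → Impl Γ V e → Impl Γ bool (λ ρ → Alg.addable (a ρ) (b ρ) [] (m ρ) (s ρ) (u ρ) (x ρ) (e ρ))
  addableI A B M S Us X E = ∧I (anyI S (sameI (wk A) (wk E) v0))
    (∧I (notI (meetsI B (X ++I (blockersI B M X ++I Us)) E)) (unsaturatedI A X E))

  module _ (A B : List Bool) (M S Us : List (List Bool)) where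
    private
      go : List (List Bool) → List (List Bool) → List (List Bool)
      go = foldl (Alg.add A B [] M S Us)

    length-extend : ∀ es xs → length (go xs es) ≤ length xs + length es
    length-extend []       xs = m≤m+n _ 0
    length-extend (e ∷ es) xs with Alg.addable A B [] M S Us xs e
    ... | true  = ≤-trans (length-extend es (e ∷ xs)) (≤-reflexive (sym (+-suc (length xs) (length es))))
    ... | false = ≤-trans (length-extend es xs) (+-monoʳ-≤ (length xs) (n≤1+n _))

    all-extend : ∀ {P : List Bool → Set} {es xs} → All P es → All P xs → All P (go xs es)
    all-extend                   []       ps = ps
    all-extend {es = e ∷ _} {xs} (q ∷ qs) ps with Alg.addable A B [] M S Us xs e
    ... | true  = all-extend qs (q ∷ ps)
    ... | false = all-extend qs ps

  extendI : ∀ {a b e m s u x} → Impl Γ V a → Impl Γ V b → Impl Γ Vs e → Impl Γ Vs m → Impl Γ Vs s → Impl Γ Vs u →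
    Impl Γ Vs x → Impl Γ Vs (λ ρ → Alg.extend (a ρ) (b ρ) (e ρ) (m ρ) (s ρ) (u ρ) (x ρ))
  extendI {a = a} {b} {m = m} {s} {u} {x} A B E M S Us X = foldlI′ E X
    (ifI (addableI (wk (wk A)) (wk (wk B)) (wk (wk M)) (wk (wk S)) (wk (wk Us)) v1 v0) (consI v0 v1) v1)
    (width X ⊞ width E) λ {ρ} ok es (q , qs) → let p , ps = bound X ok in
      ≤-trans (length-extend (a ρ) (b ρ) (m ρ) (s ρ) (u ρ) es (x ρ)) (+-mono-≤ p q) ,
      all-extend (a ρ) (b ρ) (m ρ) (s ρ) (u ρ)
        (All.map (λ {v} → Bounded-mono V {v = v} (m≤n+m _ _)) qs) (All.map (λ {v} → Bounded-mono V {v = v} (m≤m+n _ _)) ps)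

  length-fresh : ∀ A xs → length (foldr (Alg.insert A [] []) [] xs) ≤ length xs
  length-fresh A []       = z≤n
  length-fresh A (x ∷ xs) with any (sameᵛ A x) (foldr (Alg.insert A [] []) [] xs)
  ... | true  = m≤n⇒m≤1+n (length-fresh A xs)
  ... | false = s≤s (length-fresh A xs)

  all-fresh : ∀ A {P : List Bool → Set} {xs} → All P xs → All P (foldr (Alg.insert A [] []) [] xs)
  all-fresh A []                 = []
  all-fresh A {xs = x ∷ xs} (p ∷ ps) with any (sameᵛ A x) (foldr (Alg.insert A [] []) [] xs)
  ... | true  = all-fresh A ps
  ... | false = p ∷ all-fresh A ps

  freshI : ∀ {a b y x} → Impl Γ V a → Impl Γ V b → Impl Γ Vs y → Impl Γ Vs x →
           Impl Γ Vs (λ ρ → Alg.fresh (a ρ) (b ρ) [] (y ρ) (x ρ))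
  freshI {a = a} A B Y X = foldrI (filterI X (notI (meetsI (wk B) (wk Y) v0))) nilI
    (ifI (anyI v1 (sameI (wk (wk (wk A))) v1 v0)) v1 (consI v0 v1)) (width X)
    λ {ρ} ok xs b → ≤-trans (length-fresh (a ρ) xs) (proj₁ b) , all-fresh (a ρ) (proj₂ b)

  all-replace : ∀ A {P : List Bool → Set} {gs f} → P f → All P gs → P (Alg.replace A [] [] gs f)
  all-replace A b []                       = b
  all-replace A {f = f} b (_∷_ {g} {gs} p ps) with sameᵛ A f g
  ... | true  = p
  ... | false = all-replace A b ps

  replaceI : ∀ {a n f} → Impl Γ V a → Impl Γ Vs n → Impl Γ V f →
             Impl Γ V (λ ρ → Alg.replace (a ρ) [] [] (n ρ) (f ρ))
  replaceI {a = a} {n} {f} A N F = foldrI N F (ifI (sameI (wk (wk A)) (wk (wk F)) v0) v0 v1) (width N ⊞ width F)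
    λ {ρ} {s} ok gs (_ , ps) → all-replace (a ρ) {P = Bounded (⟪ width N ⟫ s + ⟪ width F ⟫ s) V}
      (Bounded-mono V {v = f ρ} (m≤n+m _ _) (bound F ok)) (All.map (λ {v} → Bounded-mono V {v = v} (m≤m+n _ _)) ps)

  rootsI : ∀ {b m} → Impl Γ V b → Impl Γ Vs m → Impl Γ Vs (λ ρ → filterᵇ (λ e → not (meetᵛ (b ρ) e e)) (m ρ))
  rootsI B M = filterI M (notI (meetI (wk B) v0 v0))

  ≤times : ∀ k {f g} → Impl Γ (list σ) f → Impl Γ (list τ) g → Impl Γ bool (λ ρ → length (f ρ) ≤ᵇ k * length (g ρ))
  ≤times k {f} {g} F G = castI (λ ρ → cong (length (f ρ) ≤ᵇ_) (length-repeat k (g ρ))) (F ≤I repeatI k G)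

  times≤ : ∀ k {f g} → Impl Γ (list σ) f → Impl Γ (list τ) g → Impl Γ bool (λ ρ → k * length (f ρ) ≤ᵇ length (g ρ))
  times≤ k {f} {g} F G = castI (λ ρ → cong (_≤ᵇ length (g ρ)) (length-repeat k (f ρ))) (repeatI k F ≤I G)

  nextI : ∀ {a b e m r x ls} → Impl Γ V a → Impl Γ V b → Impl Γ Vs e → Impl Γ Vs m → Impl Γ V r → Impl Γ Vs x →
    Impl Γ (list Vs) ls → Impl Γ stateTy (λ ρ → Alg.Top.next (a ρ) (b ρ) (e ρ) (m ρ) (r ρ) (x ρ) (ls ρ))
  nextI {a = a} {b} {e} A B E M R X Ls =
    -- The bindings share intermediate results. In the innermost scope the variables 0 to 3 are `N`,
    -- `X⁺`, `s` and the annotated stack.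
    bindI (annotateI B M Ls)
    (bindI (sourceI (a ∘ All.tail) (b ∘ All.tail) (e ∘ All.tail) (wk R) v0)
    (bindI (extendI (wk (wk A)) (wk (wk B)) (wk (wk E)) (wk (wk M)) v0 (usedI v1) (wk (wk X)))
    (bindI (freshI (wk³ A) (wk³ B) (blockersI (wk³ B) (wk³ M) v0) v0)
    (ifI (≤times p v2 v0)
      (pairI (mapI (wk (wk³ M)) (replaceI (wk (wk (wk³ A))) v1 v0)) (wk (wk³ Ls)))
      (ifI (times≤ q v1 (allYI (varI (there (there (there (here refl)))))))
        (pairI (wk (wk³ M)) (consI (wk (wk³ X)) (wk (wk³ Ls))))
        (pairI (wk (wk³ M)) (consI nilI (consI v1 (wk (wk³ Ls))))))))))

  stepI : ∀ {a b e st} → Impl Γ V a → Impl Γ V b → Impl Γ Vs e → Impl Γ stateTy st →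
          Impl Γ stateTy (λ ρ → Alg.step (a ρ) (b ρ) (e ρ) (st ρ))
  stepI A B E St = unconsI (rootsI B (fstI St)) St
    (unconsI (wk (wk (sndI St))) (pairI (wk (wk (fstI St))) (consI nilI nilI))
      (nextI (wk⁴ A) (wk⁴ B) (wk⁴ E) (wk⁴ (fstI St)) v2 v0 v1))

  opensI : ∀ (a′ b′ : Env Γ → List Bool) (e : Env Γ → List (List Bool)) {r zs} (A : Impl Γ V a′) →
           Impl Γ V r → Impl Γ (list layerTy) zs →
           Impl Γ Vs (λ ρ → Alg.opens (a′ ρ) (b′ ρ) (e ρ) (r ρ) (zs ρ))
  opensI a b e {r} {zs} A R Zs = castI (λ ρ → cong proj₂ (as-foldr (a ρ) (b ρ) (e ρ) (r ρ) (zs ρ)))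
    (sndI (foldrI Zs (pairI (consI R nilI) nilI)
      (pairI (sndI v0) (filterI (fstI v1) (unsaturatedI (wk (wk (wk A))) (fstI v1) v0) ++I sndI v1))
      (c ⊞ width Zs ⊠ c) λ {ρ} {s} ok zs (l , ps) →
        let sb , ol , ob = bounded (a ρ) (b ρ) (e ρ) (r ρ) (≤-trans (m≤n+m _ _) (n≤1+n _))
                             (Bounded-mono V {v = r ρ} (≤-trans (m≤m+n _ _) (n≤1+n _)) (bound R ok)) zs ps
        in subst (Bounded (⟪ c ⊞ width Zs ⊠ c ⟫ s) (Vs ⊗ Vs)) (sym (as-foldr (a ρ) (b ρ) (e ρ) (r ρ) zs))
             (Bounded-mono Vs (m≤m+n _ _) sb ,
              (≤-trans ol (≤-trans (*-monoˡ-≤ (⟪ c ⟫ s) l) (m≤n+m _ _)) ,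
               All.map (λ {v} → Bounded-mono V {v = v} (m≤m+n _ _)) ob))))
    where
    c : Poly
    c = con 1 ⊞ (width R ⊞ width Zs)
    go : List Bool → List Bool → List (List (List Bool) × List (List Bool)) → List (List Bool) × List (List Bool)
    go a r = foldr (λ Z acc → proj₂ Z , filterᵇ (λ f → count (sameᵛ a f) (proj₁ Z) <ᵇ U) (proj₁ acc) ++ proj₂ acc) (r ∷ [] , [])
    as-foldr : ∀ a b e r zs → go a r zs ≡ (Alg.source a b e r zs , Alg.opens a b e r zs)
    as-foldr a b e r []       = refl
    as-foldr a b e r (Z ∷ zs) rewrite as-foldr a b e r zs = refl
    bounded : ∀ a b e r {k c} → k ≤ suc c → Bounded (suc c) V r → ∀ zs → All (Bounded k layerTy) zs →
      Bounded (suc c) Vs (Alg.source a b e r zs) ×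
      length (Alg.opens a b e r zs) ≤ length zs * suc c × All (Bounded (suc c) V) (Alg.opens a b e r zs)
    bounded a b e r k≤ rb []       []              = (s≤s z≤n , rb ∷ []) , z≤n , []
    bounded a b e r k≤ rb (Z ∷ zs) ((_ , yb) ∷ ps) =
      let sb , ol , ob = bounded a b e r k≤ rb zs ps
          p = λ f → T? (count (sameᵛ a f) (proj₁ Z) <ᵇ U)
      in Bounded-mono Vs k≤ yb ,
         ≤-trans (≤-reflexive (length-++ (filterᵇ (λ f → count (sameᵛ a f) (proj₁ Z) <ᵇ U) (Alg.source a b e r zs))))
           (+-mono-≤ (≤-trans (length-filter p (Alg.source a b e r zs)) (proj₁ sb)) ol) ,
         All.++⁺ (All.filter⁺ p (proj₂ sb)) ob

  outputI : ∀ {a b e st} → Impl Γ V a → Impl Γ V b → Impl Γ Vs e → Impl Γ stateTy st →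
            Impl Γ (Vs ⊕ Vs) (λ ρ → Alg.output (a ρ) (b ρ) (e ρ) (st ρ))
  outputI {Γ} {a} {b} {e} A B E St = unconsI (rootsI B (fstI St)) (inlI (fstI St))
    (unconsI (wk (wk (sndI St))) (inlI (wk (wk (fstI St))))
      (bindI (annotateI (wk⁴ B) (wk⁴ (fstI St)) v1)
      (bindI (extendI (wk⁵ A) (wk⁵ B) (wk⁵ E) (wk⁵ (fstI St))
                (sourceI (a ∘ tail⁵) (b ∘ tail⁵) (e ∘ tail⁵) (varI (there (there (there (here refl))))) v0) (usedI v0) v1)
        (inrI (opensI (a ∘ tail⁶) (b ∘ tail⁶) (e ∘ tail⁶) (wk (wk⁵ A)) (varI (there (there (there (there (here refl))))))
          (consI (pairI v0 (blockersI (wk (wk⁵ B)) (wk (wk⁵ (fstI St))) v0)) v1))))))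

  match-elim : ∀ {A B : Set} (P : B → Set) (xs : List A) {z k} → P z → (∀ x xs → P (k x xs)) → P (match xs z k)
  match-elim P []       z k = z
  match-elim P (x ∷ xs) z k = k x xs

  if-elim : ∀ {B : Set} (P : B → Set) b {x y} → P x → P y → P (if b then x else y)
  if-elim P true  x y = x
  if-elim P false x y = y

  -- The bound on the accumulator that the fold over the fuel demands, after `n` steps: a step adds
  -- at most one layer, and at most `length E` edges to a layer.
  record StateBound (s n : ℕ) (st : ⟦ stateTy ⟧) : Set where
    field
      chosen : Bounded s Vs (proj₁ st)
      depth    : length (proj₂ st) ≤ n
      layers   : All (λ X → length X ≤ n * s × All (Bounded s V) X) (proj₂ st)

  module _ (A B : List Bool) {E s} (Eb : Bounded s Vs E) where
    private
      grow : ∀ n {Ls : List (List (List Bool))} → All (λ X → length X ≤ n * s × All (Bounded s V) X) Ls →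
             All (λ X → length X ≤ suc n * s × All (Bounded s V) X) Ls
      grow n = All.map λ (l , b) → ≤-trans l (m≤n+m _ s) , b

    step-bounded : ∀ {n} st → StateBound s n st → StateBound s (suc n) (Alg.step A B E st)
    step-bounded {n} (M , Ls) ok = match-elim (StateBound s (suc n)) (Alg.roots A B E M) stay λ root _ →
      match-elim′ root Ls depth layers
      where
      open StateBound ok
      stay : StateBound s (suc n) (M , Ls)
      stay = record { chosen = chosen ; depth = m≤n⇒m≤1+n depth ; layers = grow n layers }
      match-elim′ : ∀ root Ls → length Ls ≤ n → All (λ X → length X ≤ n * s × All (Bounded s V) X) Ls →
        StateBound s (suc n) (match Ls (M , [] ∷ []) λ X Ls → Alg.Top.next A B E M root X Ls)
      match-elim′ root []       d ls = record { chosen = chosen ; depth = s≤s z≤n ; layers = (z≤n , []) ∷ [] }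
      match-elim′ root (X ∷ Ls) d ls@((l , b) ∷ ls′) =
        if-elim (StateBound s (suc n)) collapsible
          (record { chosen = ≤-trans (≤-reflexive (length-map _ M)) (proj₁ chosen) ,
                               All.map⁺ (All.map (λ f → all-replace A f Nb) (proj₂ chosen))
                  ; depth = ≤-trans (n≤1+n _) (m≤n⇒m≤1+n d) ; layers = grow n ls′ })
          (if-elim (StateBound s (suc n)) small
            (record { chosen = chosen ; depth = m≤n⇒m≤1+n d ; layers = grow n ls })
            (record { chosen = chosen ; depth = s≤s d ; layers = (z≤n , []) ∷ (X⁺l , X⁺b) ∷ grow n ls′ }))
        where
        open Alg.Top A B E M root X Ls renaming (s to src; N to new)
        X⁺l : length X⁺ ≤ suc n * s
        X⁺l = ≤-trans (length-extend A B M src (Alg.used A B E Zs) E X)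
          (≤-trans (+-mono-≤ l (proj₁ Eb)) (≤-reflexive (+-comm (n * s) s)))
        X⁺b : All (Bounded s V) X⁺
        X⁺b = all-extend A B M src (Alg.used A B E Zs) (proj₂ Eb) b
        Nb : All (Bounded s V) new
        Nb = all-fresh A (All.filter⁺ (λ e → T? (not (Alg.meets A B E Y⁺ e))) X⁺b)

    run-bounded : ∀ (fuel : List ⊤) {n st} → StateBound s n st →
                  StateBound s (length fuel + n) (foldl (λ st _ → Alg.step A B E st) st fuel)
    run-bounded []         ok = ok
    run-bounded (_ ∷ fuel) {n} {st} ok = subst (λ k → StateBound s k (foldl (λ st _ → Alg.step A B E st) (Alg.step A B E st) fuel)) (+-suc (length fuel) n)
      (run-bounded fuel (step-bounded st ok))

  state-Bounded : ∀ {s n st} → StateBound s n st → Bounded (s + (n + n * s)) stateTy st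
  state-Bounded {s} {n} ok = Bounded-mono Vs (m≤m+n s _) chosen ,
    ≤-trans depth (≤-trans (m≤m+n n _) (m≤n+m _ s)) ,
    All.map (λ (l , b) → ≤-trans l (≤-trans (m≤n+m _ n) (m≤n+m _ s)) , All.map (λ {v} → Bounded-mono V {v = v} (m≤m+n s _)) b) layers
    where open StateBound ok

  decode : List Bool → List (List Bool) ⊎ List (List Bool) → ⟦ outputTy ⟧
  decode A = [ inj₁ , (λ S → inj₂ (union A S)) ]′

  decodeI : ∀ {a o} → Impl Γ V a → Impl Γ (Vs ⊕ Vs) o → Impl Γ outputTy (λ ρ → decode (a ρ) (o ρ))
  decodeI A O = caseI O (inlI v0) (inrI (unionI (wk A) v0))

  outcomeI : Impl (stateTy ∷ V ∷ inputTy ∷ []) outputTy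
    (λ ρ → decode (proj₁ (All.lookup ρ (there (there (here refl)))))
      (Alg.output (proj₁ (All.lookup ρ (there (there (here refl))))) (All.lookup ρ (there (here refl)))
        (proj₂ (All.lookup ρ (there (there (here refl))))) (All.lookup ρ (here refl))))
  outcomeI = decodeI (fstI v2) (outputI (fstI v2) v1 (sndI v2) v0)

  module _ (P : Poly) where
    final : List Bool → List Bool → List (List Bool) → ⟦ stateTy ⟧
    final A B E = foldl (λ st _ → Alg.step A B E st) (singletons A , []) (units P (singletons A))

    result : List Bool → List (List Bool) → ⟦ outputTy ⟧
    result A E = decode A (Alg.output A (map not A) E (final A (map not A) E))

    finalI : ∀ {a b e} → Impl Γ V a → Impl Γ V b → Impl Γ Vs e → Impl Γ stateTy (λ ρ → final (a ρ) (b ρ) (e ρ))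
    finalI {a = a} {b} {e} A B E = foldlI′ fuel (pairI As nilI)
      (stepI (wk (wk A)) (wk (wk B)) (wk (wk E)) v1)
      (s ⊞ (width fuel ⊞ width fuel ⊠ s)) λ {ρ} {k} ok us (l , _) →
        let Eb = Bounded-mono Vs (m≤n+m _ (⟪ width As ⟫ k)) (bound E ok)
            fin = run-bounded (a ρ) (b ρ) Eb us {0} {singletons (a ρ) , []}
                    (record { chosen = Bounded-mono Vs (m≤m+n _ (⟪ width E ⟫ k)) (bound As ok) ; depth = z≤n ; layers = [] })
            l′ = ≤-trans (≤-reflexive (+-identityʳ (length us))) l
        in Bounded-mono stateTy (+-monoʳ-≤ (⟪ s ⟫ k) (+-mono-≤ l′ (*-monoˡ-≤ (⟪ s ⟫ k) l′))) (state-Bounded fin)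
      where
      As = singletonsI A
      fuel = unitsI P As
      s = width As ⊞ width E

    stagedI : Impl (V ∷ inputTy ∷ []) outputTy
      (λ ρ → decode (proj₁ (All.lookup ρ (there (here refl))))
        (Alg.output (proj₁ (All.lookup ρ (there (here refl)))) (All.lookup ρ (here refl)) (proj₂ (All.lookup ρ (there (here refl))))
          (final (proj₁ (All.lookup ρ (there (here refl)))) (All.lookup ρ (here refl)) (proj₂ (All.lookup ρ (there (here refl)))))))
    stagedI = bindI (finalI (fstI v1) v0 (sndI v1)) outcomeI

    resultI : Impl (inputTy ∷ []) outputTy (λ ρ → result (proj₁ (All.lookup ρ (here refl))) (proj₂ (All.lookup ρ (here refl))))
    resultI = bindI (complementI (fstI v0)) stagedI

-- Subsets as characteristic vectors

toList-inj : ∀ {n} {p q : Subset n} → toList p ≡ toList q → p ≡ q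
toList-inj {p = []}    {[]}    eq = refl
toList-inj {p = x ∷ p} {y ∷ q} eq = cong₂ _∷_ (∷-injectiveˡ eq) (toList-inj (∷-injectiveʳ eq))

toList-zipWith : ∀ (op : Bool → Bool → Bool) {n} (p q : Subset n) →
                 zipWith op (toList p) (toList q) ≡ toList (Vec.zipWith op p q)
toList-zipWith op []      []      = refl
toList-zipWith op (x ∷ p) (y ∷ q) = cong (op x y ∷_) (toList-zipWith op p q)

nonempty⁻ : ∀ {n} (p : Subset n) → T (any (λ x → x) (toList p)) → Nonempty p
nonempty⁻ (true ∷ p)  t = zero , here
nonempty⁻ (false ∷ p) t = let i , i∈p = nonempty⁻ p t in suc i , there i∈p

nonempty⁺ : ∀ {n} (p : Subset n) → Nonempty p → T (any (λ x → x) (toList p))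
nonempty⁺ (true ∷ p)  ne                    = _
nonempty⁺ (false ∷ p) (suc i , there i∈p)   = nonempty⁺ p (i , i∈p)

meet-toList : ∀ {n} (B e f : Subset n) →
              meetᵛ (toList B) (toList e) (toList f) ≡ any (λ x → x) (toList (B ∩ (e ∩ f)))
meet-toList B e f = cong (any λ x → x)
  (trans (cong (toList B ∧ᵛ_) (toList-zipWith _∧_ e f)) (toList-zipWith _∧_ B (e ∩ f)))

meet⁻ : ∀ {n} (B e f : Subset n) → T (meetᵛ (toList B) (toList e) (toList f)) →
        ∃[ v ] v ∈ B × v ∈ e × v ∈ f
meet⁻ B e f t =
  let v , i = nonempty⁻ (B ∩ (e ∩ f)) (subst T (meet-toList B e f) t)
      v∈B , j = x∈p∩q⁻ B (e ∩ f) i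
      v∈e , v∈f = x∈p∩q⁻ e f j
  in v , v∈B , v∈e , v∈f

meet⁺ : ∀ {n} (B e f : Subset n) {v} → v ∈ B → v ∈ e → v ∈ f → T (meetᵛ (toList B) (toList e) (toList f))
meet⁺ B e f {v} v∈B v∈e v∈f = subst T (sym (meet-toList B e f))
  (nonempty⁺ (B ∩ (e ∩ f)) (v , x∈p∩q⁺ (v∈B , x∈p∩q⁺ (v∈e , v∈f))))

∧ᵛ-comm : ∀ e f → e ∧ᵛ f ≡ f ∧ᵛ e
∧ᵛ-comm []      []      = refl
∧ᵛ-comm []      (_ ∷ _) = refl
∧ᵛ-comm (_ ∷ _) []      = refl
∧ᵛ-comm (x ∷ e) (y ∷ f) = cong₂ _∷_ (∧-comm x y) (∧ᵛ-comm e f)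

meet-sym : ∀ B {e f} → T (meetᵛ B e f) → T (meetᵛ B f e)
meet-sym B {e} {f} = subst (λ v → T (any (λ x → x) (B ∧ᵛ v))) (∧ᵛ-comm e f)

meet-self : ∀ B {e f} → T (meetᵛ B e f) → T (meetᵛ B e e)
meet-self (true ∷ B)  {true ∷ e}  {y ∷ f}     t = _
meet-self (true ∷ B)  {false ∷ e} {y ∷ f}     t = meet-self B {e} {f} t
meet-self (false ∷ B) {true ∷ e}  {true ∷ f}  t = meet-self B {e} {f} t
meet-self (false ∷ B) {true ∷ e}  {false ∷ f} t = meet-self B {e} {f} t
meet-self (false ∷ B) {false ∷ e} {y ∷ f}     t = meet-self B {e} {f} t

eqᵛ⁻ : ∀ {xs ys} → T (eqᵛ xs ys) → xs ≡ ys
eqᵛ⁻ {[]}        {[]}        t = refl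
eqᵛ⁻ {true ∷ _}  {true ∷ _}  t = cong (true ∷_) (eqᵛ⁻ t)
eqᵛ⁻ {false ∷ _} {false ∷ _} t = cong (false ∷_) (eqᵛ⁻ t)

eqᵛ⁺ : ∀ {xs ys} → xs ≡ ys → T (eqᵛ xs ys)
eqᵛ⁺ {[]}         refl = _
eqᵛ⁺ {true ∷ xs}  refl = eqᵛ⁺ {xs} refl
eqᵛ⁺ {false ∷ xs} refl = eqᵛ⁺ {xs} refl

zeros-toList : ∀ {n} (p : Subset n) → zeros (toList p) ≡ toList (⊥ {n})
zeros-toList []      = refl
zeros-toList (x ∷ p) = cong (false ∷_) (zeros-toList p)

∈-singletons⁻ : ∀ {n} (p : Subset n) {v} → v ∈ˡ singletons (toList p) → ∃[ i ] i ∈ p × v ≡ toList ⁅ i ⁆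
∈-singletons⁻ (true ∷ p)  (here refl) = zero , here , cong (true ∷_) (zeros-toList p)
∈-singletons⁻ (true ∷ p)  (there j) = let u , k , eq = ∈-map⁻ (false ∷_) j ; i , i∈p , eq′ = ∈-singletons⁻ p k in
  suc i , there i∈p , trans eq (cong (false ∷_) eq′)
∈-singletons⁻ (false ∷ p) j = let u , k , eq = ∈-map⁻ (false ∷_) j ; i , i∈p , eq′ = ∈-singletons⁻ p k in
  suc i , there i∈p , trans eq (cong (false ∷_) eq′)

∈-singletons⁺ : ∀ {n} (p : Subset n) {i} → i ∈ p → toList ⁅ i ⁆ ∈ˡ singletons (toList p)
∈-singletons⁺ (true ∷ p)  here        = here (cong (true ∷_) (sym (zeros-toList p)))
∈-singletons⁺ (true ∷ p)  (there i∈p) = there (∈-map⁺ (false ∷_) (∈-singletons⁺ p i∈p))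
∈-singletons⁺ (false ∷ p) (there i∈p) = ∈-map⁺ (false ∷_) (∈-singletons⁺ p i∈p)

singletons-distinct : ∀ bs → AllPairs _≢_ (singletons bs)
singletons-distinct []           = []
singletons-distinct (true ∷ bs)  = All.map⁺ (All.universal (λ _ ()) _) ∷ AllPairs.map⁺ (AllPairs.map (λ ne eq → ne (∷-injectiveʳ eq)) (singletons-distinct bs))
singletons-distinct (false ∷ bs) = AllPairs.map⁺ (AllPairs.map (λ ne eq → ne (∷-injectiveʳ eq)) (singletons-distinct bs))

∣p∣>0⇒nonempty : ∀ {n} (p : Subset n) → 1 ≤ ∣ p ∣ → Nonempty p
∣p∣>0⇒nonempty (true ∷ p)  _ = zero , here
∣p∣>0⇒nonempty (false ∷ p) l = let i , i∈p = ∣p∣>0⇒nonempty p l in suc i , there i∈p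

∣p∣≡0⇒⊥ : ∀ {n} (p : Subset n) → ∣ p ∣ ≡ 0 → p ≡ ⊥
∣p∣≡0⇒⊥ []          _  = refl
∣p∣≡0⇒⊥ (false ∷ p) eq = cong (false ∷_) (∣p∣≡0⇒⊥ p eq)

∣p∣≡1⇒singleton : ∀ {n} (p : Subset n) {i} → ∣ p ∣ ≡ 1 → i ∈ p → p ≡ ⁅ i ⁆
∣p∣≡1⇒singleton (true ∷ p)  eq here        = cong (true ∷_) (∣p∣≡0⇒⊥ p (suc-injective eq))
∣p∣≡1⇒singleton (true ∷ p)  eq (there i∈p) =
  contradiction (subst (_ ∈_) (∣p∣≡0⇒⊥ p (suc-injective eq)) i∈p) ∉⊥
∣p∣≡1⇒singleton (false ∷ p) eq (there i∈p) = cong (false ∷_) (∣p∣≡1⇒singleton p eq i∈p)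

∣p∪q∣+∣p∩q∣ : ∀ {n} (p q : Subset n) → ∣ p ∪ q ∣ + ∣ p ∩ q ∣ ≡ ∣ p ∣ + ∣ q ∣
∣p∪q∣+∣p∩q∣ []          []          = refl
∣p∪q∣+∣p∩q∣ (true ∷ p)  (true ∷ q)  = cong suc (trans (+-suc _ _) (trans (cong suc (∣p∪q∣+∣p∩q∣ p q)) (sym (+-suc _ _))))
∣p∪q∣+∣p∩q∣ (true ∷ p)  (false ∷ q) = cong suc (∣p∪q∣+∣p∩q∣ p q)
∣p∪q∣+∣p∩q∣ (false ∷ p) (true ∷ q)  = trans (cong suc (∣p∪q∣+∣p∩q∣ p q)) (sym (+-suc _ _))
∣p∪q∣+∣p∩q∣ (false ∷ p) (false ∷ q) = ∣p∪q∣+∣p∩q∣ p q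

∣p∪q∣≤ : ∀ {n} (p q : Subset n) → ∣ p ∪ q ∣ ≤ ∣ p ∣ + ∣ q ∣
∣p∪q∣≤ p q = ≤-trans (m≤m+n _ _) (≤-reflexive (∣p∪q∣+∣p∩q∣ p q))

∣p∪q∣<-meet : ∀ {n} (p q : Subset n) {i} → i ∈ p → i ∈ q → suc ∣ p ∪ q ∣ ≤ ∣ p ∣ + ∣ q ∣
∣p∪q∣<-meet p q {i} i∈p i∈q = ≤-trans (≤-reflexive (+-comm 1 _))
  (≤-trans (+-monoʳ-≤ ∣ p ∪ q ∣ (≤-trans (≤-reflexive (sym (∣⁅x⁆∣≡1 i))) (p⊆q⇒∣p∣≤∣q∣ ⁅i⁆⊆)))
           (≤-reflexive (∣p∪q∣+∣p∩q∣ p q)))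
  where
  ⁅i⁆⊆ : ⁅ i ⁆ ⊆ p ∩ q
  ⁅i⁆⊆ j = subst (_∈ p ∩ q) (sym (x∈⁅y⁆⇒x≡y i j)) (x∈p∩q⁺ (i∈p , i∈q))

∣⁅i⁆∪p∣ : ∀ {n} i (p : Subset n) → i ∉ p → suc ∣ p ∣ ≤ ∣ ⁅ i ⁆ ∪ p ∣
∣⁅i⁆∪p∣ i p i∉p = p⊂q⇒∣p∣<∣q∣ (q⊆p∪q ⁅ i ⁆ p , i , p⊆p∪q p (x∈⁅x⁆ i) , i∉p)

module _ {n : ℕ} where
  ∈-⋃⁺ : ∀ {p} {ps : List (Subset n)} {i} → p ∈ˡ ps → i ∈ p → i ∈ ⋃ ps
  ∈-⋃⁺ {ps = _ ∷ ps} (here refl) i∈p = p⊆p∪q (⋃ ps) i∈p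
  ∈-⋃⁺ {ps = q ∷ ps} (there j)   i∈p = q⊆p∪q q (⋃ ps) (∈-⋃⁺ j i∈p)

  ∈-⋃⁻ : ∀ (ps : List (Subset n)) {i} → i ∈ ⋃ ps → ∃[ p ] p ∈ˡ ps × i ∈ p
  ∈-⋃⁻ []       i∈ = contradiction i∈ ∉⊥
  ∈-⋃⁻ (p ∷ ps) i∈ with x∈p∪q⁻ p (⋃ ps) i∈
  ... | inj₁ i∈p = p , here refl , i∈p
  ... | inj₂ i∈⋃ = let q , j , i∈q = ∈-⋃⁻ ps i∈⋃ in q , there j , i∈q

  ∣⋃∣≤ : ∀ {c} (ps : List (Subset n)) → All (λ p → ∣ p ∣ ≤ c) ps → ∣ ⋃ ps ∣ ≤ c * length ps
  ∣⋃∣≤ []       []      = ≤-trans (≤-reflexive (∣⊥∣≡0 n)) z≤n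
  ∣⋃∣≤ {c} (p ∷ ps) (l ∷ ls) = ≤-trans (∣p∪q∣≤ p (⋃ ps))
    (≤-trans (+-mono-≤ l (∣⋃∣≤ ps ls)) (≤-reflexive (sym (*-suc c (length ps)))))

  R⊆foldr∪ : ∀ R (ps : List (Subset n)) → R ⊆ foldr _∪_ R ps
  R⊆foldr∪ R []       i∈R = i∈R
  R⊆foldr∪ R (q ∷ qs) i∈R = q⊆p∪q q (foldr _∪_ R qs) (R⊆foldr∪ R qs i∈R)

  -- Each member of the list shares a vertex with `R` and so contributes at most `β` new ones. This
  -- saves one vertex for every edge of `Y`.
  ∣⋃∪∣≤ : ∀ {β} R (ps : List (Subset n)) → All (λ p → ∣ p ∣ ≤ suc β × ∃[ i ] i ∈ p × i ∈ R) ps → ∣ foldr _∪_ R ps ∣ ≤ ∣ R ∣ + β * length ps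
  ∣⋃∪∣≤ {β} R []       []                        = m≤m+n _ _
  ∣⋃∪∣≤ {β} R (p ∷ ps) ((l , i , i∈p , i∈R) ∷ ls) = s≤s⁻¹ (begin
    suc ∣ p ∪ foldr _∪_ R ps ∣            ≤⟨ ∣p∪q∣<-meet p (foldr _∪_ R ps) i∈p (R⊆foldr∪ R ps i∈R) ⟩
    ∣ p ∣ + ∣ foldr _∪_ R ps ∣            ≤⟨ +-mono-≤ l (∣⋃∪∣≤ R ps ls) ⟩
    suc β + (∣ R ∣ + β * length ps)       ≡⟨ cong suc (trans (sym (+-assoc β ∣ R ∣ _)) (trans (cong (_+ β * length ps) (+-comm β ∣ R ∣)) (+-assoc ∣ R ∣ β _))) ⟩
    suc (∣ R ∣ + (β + β * length ps))     ≡⟨ cong (λ k → suc (∣ R ∣ + k)) (sym (*-suc β (length ps))) ⟩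
    suc (∣ R ∣ + β * suc (length ps))     ∎)
    where
    open ≤-Reasoning

  ∈-foldr∪⁺ : ∀ R (ps : List (Subset n)) {p i} → p ∈ˡ ps → i ∈ p → i ∈ foldr _∪_ R ps
  ∈-foldr∪⁺ R (_ ∷ ps) (here refl) i∈p = p⊆p∪q (foldr _∪_ R ps) i∈p
  ∈-foldr∪⁺ R (q ∷ ps) (there j)   i∈p = q⊆p∪q q (foldr _∪_ R ps) (∈-foldr∪⁺ R ps j i∈p)

  foldr∪-⊆ : ∀ {B} R (ps : List (Subset n)) → R ⊆ B → All (_⊆ B) ps → foldr _∪_ R ps ⊆ B
  foldr∪-⊆ R []       R⊆B []         i∈ = R⊆B i∈
  foldr∪-⊆ R (p ∷ ps) R⊆B (p⊆B ∷ ls) i∈ with x∈p∪q⁻ p (foldr _∪_ R ps) i∈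
  ... | inj₁ i∈p = p⊆B i∈p
  ... | inj₂ i∈R = foldr∪-⊆ R ps R⊆B ls i∈R

least : ∀ {P : ℕ → Set} → Decidable P → ∀ {n} → P n → ∃[ m ] P m × m ≤ n × (∀ {k} → P k → m ≤ k)
least {P} P? {n} Pn with P? 0
... | yes P0 = 0 , P0 , z≤n , λ _ → z≤n
least {P} P? {zero}  Pn | no ¬P0 = contradiction Pn ¬P0
least {P} P? {suc n} Pn | no ¬P0 =
  let m , Pm , m≤n , min = least {P ∘ suc} (P? ∘ suc) Pn in
  suc m , Pm , s≤s m≤n , λ { {zero} P0 → contradiction P0 ¬P0 ; {suc k} Pk → s≤s (min Pk) }

-- The real bound

-- In unnormalised rationals the comparison is one of cross products, and these come from natural
-- numbers.
rational-bound : ∀ (t g s num d-1 : ℕ) .(cop : Coprime num (suc d-1)) → suc d-1 ℕ.* t ℕ.≤ (suc d-1 ℕ.* g ℕ.+ num) ℕ.* s →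
  (ℤ.+ t) ℚ./ 1 ℚ.≤ ((ℤ.+ g) ℚ./ 1 ℚ.+ mkℚ (ℤ.+ num) d-1 cop) ℚ.* ((ℤ.+ s) ℚ./ 1)
rational-bound t g s num d cop le = ℚₚ.toℚᵘ-cancel-≤ (begin
  toℚᵘ ((ℤ.+ t) ℚ./ 1)                                      ≃⟨ ℚₚ.toℚᵘ-fromℚᵘ (mkℚᵘ (ℤ.+ t) 0) ⟩
  mkℚᵘ (ℤ.+ t) 0                                            ≤⟨ *≤* (subst₂ ℤ._≤_ lhs rhs (+≤+ le)) ⟩
  (mkℚᵘ (ℤ.+ g) 0 ℚᵘ.+ mkℚᵘ (ℤ.+ num) d) ℚᵘ.* mkℚᵘ (ℤ.+ s) 0    ≃⟨ ℚᵘₚ.≃-sym (ℚᵘₚ.*-cong (ℚᵘₚ.+-cong (ℚₚ.toℚᵘ-fromℚᵘ (mkℚᵘ (ℤ.+ g) 0)) ℚᵘₚ.≃-refl) (ℚₚ.toℚᵘ-fromℚᵘ (mkℚᵘ (ℤ.+ s) 0))) ⟩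
  (toℚᵘ ((ℤ.+ g) ℚ./ 1) ℚᵘ.+ toℚᵘ (mkℚ (ℤ.+ num) d cop)) ℚᵘ.* toℚᵘ ((ℤ.+ s) ℚ./ 1)
    ≃⟨ ℚᵘₚ.≃-sym (ℚᵘₚ.*-cong (ℚₚ.toℚᵘ-homo-+ ((ℤ.+ g) ℚ./ 1) (mkℚ (ℤ.+ num) d cop)) (ℚᵘₚ.≃-refl {toℚᵘ ((ℤ.+ s) ℚ./ 1)})) ⟩
  toℚᵘ ((ℤ.+ g) ℚ./ 1 ℚ.+ mkℚ (ℤ.+ num) d cop) ℚᵘ.* toℚᵘ ((ℤ.+ s) ℚ./ 1)
    ≃⟨ ℚᵘₚ.≃-sym (ℚₚ.toℚᵘ-homo-* ((ℤ.+ g) ℚ./ 1 ℚ.+ mkℚ (ℤ.+ num) d cop) ((ℤ.+ s) ℚ./ 1)) ⟩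
  toℚᵘ (((ℤ.+ g) ℚ./ 1 ℚ.+ mkℚ (ℤ.+ num) d cop) ℚ.* ((ℤ.+ s) ℚ./ 1)) ∎)
  where
  open ℚᵘₚ.≤-Reasoning
  lhs : ℤ.+ (suc d ℕ.* t) ≡ ℤ.+ t ℤ.* ℤ.+ ((1 ℕ.* suc d) ℕ.* 1)
  lhs = trans (cong ℤ.+_ (e d t)) (ℤₚ.pos-* t ((1 ℕ.* suc d) ℕ.* 1))
    where
    e : ∀ d t → suc d ℕ.* t ≡ t ℕ.* ((1 ℕ.* suc d) ℕ.* 1)
    e = solve-∀
  rhs : ℤ.+ ((suc d ℕ.* g ℕ.+ num) ℕ.* s) ≡ (((ℤ.+ g) ℤ.* ℤ.+ suc d ℤ.+ (ℤ.+ num) ℤ.* ℤ.+ 1) ℤ.* ℤ.+ s) ℤ.* ℤ.+ 1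
  rhs = trans (cong ℤ.+_ (e d g num s)) (trans (ℤₚ.pos-* ((g ℕ.* suc d ℕ.+ num ℕ.* 1) ℕ.* s) 1) (cong (ℤ._* ℤ.+ 1)
    (trans (ℤₚ.pos-* (g ℕ.* suc d ℕ.+ num ℕ.* 1) s) (cong (ℤ._* ℤ.+ s)
      (trans (ℤₚ.pos-+ (g ℕ.* suc d) (num ℕ.* 1)) (cong₂ ℤ._+_ (ℤₚ.pos-* g (suc d)) (ℤₚ.pos-* num 1)))))))
    where
    e : ∀ d g num s → (suc d ℕ.* g ℕ.+ num) ℕ.* s ≡ (g ℕ.* suc d ℕ.+ num ℕ.* 1) ℕ.* s ℕ.* 1
    e = solve-∀

-- m is the denominator of the rational witness of 0 < ε.
witness-bound : (ε : ℝ) → fromℕ 0 <ᵣ ε →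
  ∃[ m ] NonZero m × (∀ β t s → m ℕ.* t ℕ.≤ suc (m ℕ.* (2 ℕ.* β ℕ.+ 1)) ℕ.* s →
    fromℕ t ≤ᵣ (fromℤ (ℤ.+ (2 ℕ.* suc (suc β)) ℤ.- ℤ.+ 3) +ᵣ ε) ·ᵣ (ℤ.+ suc s ℤ.- ℤ.+ 1))
witness-bound ε (mkℚ (ℤ.-[1+ k ]) d cop , 0<δ , _)  with () ← ℚ.positive 0<δ
witness-bound ε (mkℚ (ℤ.+ 0) d cop , 0<δ , _)         with () ← ℚ.positive 0<δ
witness-bound ε (δ@(mkℚ (ℤ.+ suc k) d cop) , 0<δ , N , ε≥) = suc d , _ , λ β t s le η 0<η → N , λ n N≤n →
  let open ℚₚ.≤-Reasoning
      g = 2 ℕ.* β ℕ.+ 1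
      instance s≥0 = ℚₚ.normalize-nonNeg s 1
  in begin
    (ℤ.+ t) ℚ./ 1
      -- The numerator `suc k` of `δ` is at least 1, the value assumed in `le`.
      ≤⟨ rational-bound t g s (suc k) d cop (ℕₚ.≤-trans le (ℕₚ.*-monoˡ-≤ s
           (ℕₚ.≤-trans (ℕₚ.≤-reflexive (ℕₚ.+-comm 1 (suc d ℕ.* g))) (ℕₚ.+-monoʳ-≤ (suc d ℕ.* g) (ℕ.s≤s ℕ.z≤n))))) ⟩
    ((ℤ.+ g) ℚ./ 1 ℚ.+ δ) ℚ.* ((ℤ.+ s) ℚ./ 1)
      ≤⟨ ℚₚ.*-monoʳ-≤-nonNeg ((ℤ.+ s) ℚ./ 1) (ℚₚ.+-monoʳ-≤ ((ℤ.+ g) ℚ./ 1)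
           (subst (ℚ._≤ seq ε n) (ℚₚ.+-identityˡ δ) (ε≥ n N≤n))) ⟩
    ((ℤ.+ g) ℚ./ 1 ℚ.+ seq ε n) ℚ.* ((ℤ.+ s) ℚ./ 1)
      ≡⟨ cong (λ i → (i ℚ./ 1 ℚ.+ seq ε n) ℚ.* ((ℤ.+ s) ℚ./ 1)) (sym (cong (λ k → ℤ.+ k ℤ.- ℤ.+ 3) (e β))) ⟩
    ((ℤ.+ (2 ℕ.* suc (suc β)) ℤ.- ℤ.+ 3) ℚ./ 1 ℚ.+ seq ε n) ℚ.* ((ℤ.+ s) ℚ./ 1)
      ≡⟨ sym (ℚₚ.+-identityʳ _) ⟩
    ((ℤ.+ (2 ℕ.* suc (suc β)) ℤ.- ℤ.+ 3) ℚ./ 1 ℚ.+ seq ε n) ℚ.* ((ℤ.+ s) ℚ./ 1) ℚ.+ 0ℚ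
      ≤⟨ ℚₚ.+-monoʳ-≤ (((ℤ.+ (2 ℕ.* suc (suc β)) ℤ.- ℤ.+ 3) ℚ./ 1 ℚ.+ seq ε n) ℚ.* ((ℤ.+ s) ℚ./ 1)) (ℚₚ.<⇒≤ 0<η) ⟩
    ((ℤ.+ (2 ℕ.* suc (suc β)) ℤ.- ℤ.+ 3) ℚ./ 1 ℚ.+ seq ε n) ℚ.* ((ℤ.+ s) ℚ./ 1) ℚ.+ η ∎
  where
  e : ∀ β → 2 ℕ.* suc (suc β) ≡ suc (suc (suc (2 ℕ.* β ℕ.+ 1)))
  e = solve-∀

-- From hypergraphs to outcomes

module Parameters (β m : ℕ) .{{m≢0 : NonZero m}} where
  -- `p` is chosen for `frozen-growth`, `h` for `collapse` and `D` for `build-gain`; `1 + 1 / c` is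
  -- the rate at which the stack grows.
  b q U p h D c : ℕ
  b = suc β
  q = slackBound m β
  U = 6 * gapBound m β
  p = 2 * q * U
  h = b * U * (2 * q) * p
  D = suc (suc h * (b * U))
  c = 2 * q

  instance
    c≢0 : NonZero c
    c≢0 = m*n≢0 2 q {{_}} {{m*n≢0 (4 * m) (b * b) {{m*n≢0 4 m}}}}

  -- There are fewer than c L layers for 2 ^ L ≤ 2 |A| + 1, and
  -- D ^ (c L) ≤ (2 ^ L) ^ (D ^ c), which is where the exponent comes from.
  Φₚ fuelₚ : Poly
  Φₚ = con (suc h) ⊠ (con 2 ⊠ 𝒳 ⊞ con 1) ^ₚ (D ^ c) ⊠ con (b * (U * 1) + 0)
  fuelₚ = 𝒳 ⊠ (con 2 ⊞ Φₚ) ⊞ (con 1 ⊞ Φₚ)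

  module Search (H : BipartiteHypergraph (suc (suc β))) where
    open BipartiteHypergraph H

    A′ B′ : List Bool
    A′ = toList A
    B′ = map not A′

    E′ singles : List (List Bool)
    E′ = map toList E
    singles = singletons A′

    B′≡ : B′ ≡ toList B
    B′≡ = sym (toList-map not A)

    meetsB⁻ : ∀ e f → T (meetᵛ B′ (toList e) (toList f)) → ∃[ v ] v ∈ B × v ∈ e × v ∈ f
    meetsB⁻ e f t = meet⁻ B e f (subst (λ B → T (meetᵛ B (toList e) (toList f))) B′≡ t)

    meetsB⁺ : ∀ e f {v} → v ∈ B → v ∈ e → v ∈ f → T (meetᵛ B′ (toList e) (toList f))
    meetsB⁺ e f v∈B v∈e v∈f = subst (λ B → T (meetᵛ B (toList e) (toList f))) (sym B′≡) (meet⁺ B e f v∈B v∈e v∈f)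

    uniform-A : ∀ {e} → e ∈ˡ E → ∣ e ∩ A ∣ ≡ 1
    uniform-A i = proj₁ (All.lookup uniform i)

    uniform-B : ∀ {e} → e ∈ˡ E → ∣ e ∩ B ∣ ≡ b
    uniform-B i = proj₂ (All.lookup uniform i)

    E′-real : ∀ {e} → e ∈ˡ E′ → T (meetᵛ B′ e e)
    E′-real i with ∈-map⁻ toList i
    ... | e , e∈E , refl =
      let v , v∈ = ∣p∣>0⇒nonempty (e ∩ B) (subst (1 ≤_) (sym (uniform-B e∈E)) (s≤s z≤n))
          v∈e , v∈B = x∈p∩q⁻ e B v∈
      in meetsB⁺ e e v∈B v∈e v∈e

    Apart : List (List Bool) → Set
    Apart = AllPairs (λ f g → ¬ T (meetᵛ B′ f g))

    -- The counted edges meet `Z` in disjoint nonempty parts. The part of each is removed from `Z`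
    -- before the remaining ones are counted.
    count-apart : ∀ P M (Z : Subset n) → Z ⊆ B → Apart M →
      (∀ {f} → f ∈ˡ M → T (P f) → ∃[ F ] f ≡ toList F × Nonempty (Z ∩ F)) → count P M ≤ ∣ Z ∣
    count-apart P []      Z Z⊆B []         hyp = z≤n
    count-apart P (f ∷ M) Z Z⊆B (rs ∷ rss) hyp with P f in eq
    ... | false = count-apart P M Z Z⊆B rss (hyp ∘ there)
    ... | true with hyp (here refl) (subst T (sym eq) _)
    ...   | F , refl , v , v∈ = ≤-trans (s≤s (count-apart P M (Z ∩ ∁ F) (Z⊆B ∘ p∩q⊆p Z (∁ F)) rss rest))
      (p⊂q⇒∣p∣<∣q∣ (p∩q⊆p Z (∁ F) , v , proj₁ (x∈p∩q⁻ Z F v∈) ,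
        λ v∈′ → x∈∁p⇒x∉p (proj₂ (x∈p∩q⁻ Z (∁ F) v∈′)) (proj₂ (x∈p∩q⁻ Z F v∈))))
      where
      rest : ∀ {g} → g ∈ˡ M → T (P g) → ∃[ G ] g ≡ toList G × Nonempty ((Z ∩ ∁ F) ∩ G)
      rest i t with hyp (there i) t
      ... | G , refl , w , w∈ =
        let w∈Z , w∈G = x∈p∩q⁻ Z G w∈
        in G , refl , w , x∈p∩q⁺ (x∈p∩q⁺ (w∈Z , x∉p⇒x∈∁p (λ w∈F →
             All.lookup rs i (meetsB⁺ F G (Z⊆B w∈Z) w∈F w∈G))) , w∈G)

    E′-meets : ∀ {e M} → e ∈ˡ E′ → All (λ f → f ∈ˡ E′ ⊎ ¬ T (meetᵛ B′ f f)) M → Apart M →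
               count (meetᵛ B′ e) M ≤ b
    E′-meets {M = M} i real apart with ∈-map⁻ toList i
    ... | e , e∈E , refl = ≤-trans
      (count-apart (meetᵛ B′ (toList e)) M (e ∩ B) (p∩q⊆q e B) apart found) (≤-reflexive (uniform-B e∈E))
      where
      found : ∀ {f} → f ∈ˡ M → T (meetᵛ B′ (toList e) f) → ∃[ F ] f ≡ toList F × Nonempty ((e ∩ B) ∩ F)
      found {f} j t with All.lookup real j
      ... | inj₂ ¬m = contradiction (meet-self B′ {f} {toList e} (meet-sym B′ {toList e} {f} t)) ¬m
      ... | inj₁ k with ∈-map⁻ toList k
      ...   | F , _ , refl = let v , v∈B , v∈e , v∈F = meetsB⁻ e F t in
        F , refl , v , x∈p∩q⁺ (x∈p∩q⁺ (v∈e , v∈B) , v∈F)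

    -- The trace on `A`, which is a singleton for edges and placeholders alike, so that both are
    -- compared by their vertex in `A`.
    key : List Bool → List Bool
    key e = A′ ∧ᵛ e

    key-toList : ∀ e → key (toList e) ≡ toList (A ∩ e)
    key-toList e = toList-zipWith _∧_ A e

    key-singleton : ∀ {a} → a ∈ A → key (toList ⁅ a ⁆) ≡ toList ⁅ a ⁆
    key-singleton {a} a∈A = trans (key-toList ⁅ a ⁆) (cong toList (⊆-antisym (p∩q⊆q A ⁅ a ⁆)
      λ i → x∈p∩q⁺ (subst (_∈ A) (sym (x∈⁅y⁆⇒x≡y a i)) a∈A , i)))

    key-edge : ∀ {e v} → e ∈ˡ E → v ∈ A → v ∈ e → key (toList e) ≡ toList ⁅ v ⁆
    key-edge {e} {v} e∈E v∈A v∈e = trans (key-toList e) (cong toList (∣p∣≡1⇒singleton (A ∩ e)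
      (trans (cong ∣_∣ (∩-comm A e)) (uniform-A e∈E)) (x∈p∩q⁺ (v∈A , v∈e))))

    key-∈ : ∀ {e v} → key (toList e) ≡ toList ⁅ v ⁆ → v ∈ e
    key-∈ {e} {v} k = proj₂ (x∈p∩q⁻ A e (subst (v ∈_) (sym (toList-inj (trans (sym (key-toList e)) k))) (x∈⁅x⁆ v)))

    keys : List (List Bool)
    keys = map key singles

    keys⁻ : ∀ {k} → k ∈ˡ keys → ∃[ a ] a ∈ A × k ≡ toList ⁅ a ⁆
    keys⁻ i with ∈-map⁻ key i
    ... | s , s∈ , refl with ∈-singletons⁻ A s∈
    ...   | a , a∈A , refl = a , a∈A , key-singleton a∈A

    symmetric : ∀ {e f} → T (meetᵛ B′ e f) → T (meetᵛ B′ f e)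
    symmetric {e} {f} = meet-sym B′ {e} {f}

    reflexive : ∀ {e f} → T (meetᵛ B′ e f) → T (meetᵛ B′ e e)
    reflexive {e} {f} = meet-self B′ {e} {f}

    open Correctness key (sameᵛ A′) (meetᵛ B′) eqᵛ⁻ eqᵛ⁺ symmetric reflexive E′ E′-real b E′-meets U p q
      using (IsMatching; Obstruction; Solved; perfect; blocked; solve)

    single-pseudo : ∀ {s f} → s ∈ˡ singles → ¬ T (meetᵛ B′ s f)
    single-pseudo {s} {f} i t with ∈-singletons⁻ A i
    ... | a , a∈A , refl = let v , v∈B , v∈a , _ = meetsB⁻ ⁅ a ⁆ ⁅ a ⁆ (meet-self B′ {toList ⁅ a ⁆} {f} t) in
      x∈∁p⇒x∉p v∈B (subst (_∈ A) (sym (x∈⁅y⁆⇒x≡y a v∈a)) a∈A)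

    singles-matching : IsMatching singles
    singles-matching = record
      { real     = All.tabulate λ {s} i → inj₂ (single-pseudo {s} {s} i)
      ; apart    = pairs singles id
      ; distinct = keys-distinct singles id (singletons-distinct A′)
      }
      where
      pairs : ∀ ss → (∀ {s} → s ∈ˡ ss → s ∈ˡ singles) → Apart ss
      pairs []       sub = []
      pairs (s ∷ ss) sub = All.tabulate (λ {f} _ → single-pseudo {s} {f} (sub (here refl))) ∷ pairs ss (sub ∘ there)
      key-id : ∀ {s} → s ∈ˡ singles → key s ≡ s
      key-id i with ∈-singletons⁻ A i
      ... | a , a∈A , refl = key-singleton a∈A
      keys-distinct : ∀ ss → (∀ {s} → s ∈ˡ ss → s ∈ˡ singles) → AllPairs _≢_ ss → AllPairs (λ e f → key e ≢ key f) ss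
      keys-distinct []       sub []         = []
      keys-distinct (s ∷ ss) sub (ne ∷ nes) =
        All.tabulate (λ i eq → All.lookup ne i (trans (sym (key-id (sub (here refl)))) (trans eq (key-id (sub (there i)))))) ∷
        keys-distinct ss (sub ∘ there) nes

    keys-unique : AllPairs _≢_ keys
    keys-unique = AllPairs.map⁺ (IsMatching.distinct singles-matching)

    open Implementation U p q using (result; final; decode; module Alg)

    Budgeted : ℕ → ℕ → ℕ → Set
    Budgeted x y s = ∃[ s′ ] s ≡ suc s′ × m * (b * x + β * y) ≤ gapBound m β * s′

    levels : ∃[ L ] length singles < 2 ^ L × 2 ^ L ≤ 2 * length singles + 1
    levels = power-of-two (length singles)

    solved : Solved keys Budgeted (Alg.output A′ B′ E′ (final fuelₚ A′ B′ E′))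
    solved =
      let L , n< , ≤n = levels
          -- The exponent `c * L` depends on the input, so the clock is set by the polynomial `Φₚ`
          -- above it.
          Φ≤ : suc h * D ^ (c * L) * (b * (U * 1) + 0) + 0 ≤ ⟪ Φₚ ⟫ (length singles)
          Φ≤ = ≤-trans (≤-reflexive (+-identityʳ _)) (*-monoˡ-≤ (b * (U * 1) + 0) (*-monoʳ-≤ (suc h)
                 (≤-trans (power-bound D c (length singles) L ≤n)
                   (≤-reflexive (sym (⟪^ₚ⟫ (con 2 ⊠ 𝒳 ⊞ con 1) (D ^ c) (length singles)))))))
      in solve keys h D (c * L) refl refl refl
           (λ l → shallow c L (subst (_< 2 ^ L) (sym (length-map key singles)) n<) l)
           Budgeted (λ x x′ y y′ n s → budget m β x x′ y y′ n s)
           (units fuelₚ singles) singles-matching refl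
           (≤-trans (+-mono-≤ (*-monoʳ-≤ (length singles) (+-monoʳ-≤ 2 Φ≤)) (+-monoʳ-≤ 1 Φ≤))
             (≤-reflexive (sym (length-units fuelₚ singles))))

    unmap : ∀ {es} → All (_∈ˡ E′) es → ∃[ fs ] map toList fs ≡ es × All (_∈ˡ E) fs
    unmap []       = [] , refl , []
    unmap (i ∷ is) with ∈-map⁻ toList i | unmap is
    ... | f , f∈E , refl | fs , refl , fs⊆E = f ∷ fs , refl , f∈E ∷ fs⊆E

    -- The equation between the lists of keys yields an edge at every vertex of `A`. Distinctness of
    -- the keys makes the edges disjoint within `A`, and disjointness makes the edge at a vertex
    -- unique.
    perfect-matching : ∀ M → All (_∈ˡ E) M → Apart (map toList M) → map key (map toList M) ≡ keys →
                       IsPerfectMatching M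
    perfect-matching M M⊆E apart keys≡ = record
      { edges = M⊆E ; disjoint = disjoint ; covers = covers }
      where
      keys-differ : AllPairs (λ e f → key (toList e) ≢ key (toList f)) M
      keys-differ = AllPairs.map⁻ (AllPairs.map⁻ (subst (AllPairs _≢_) (sym keys≡) keys-unique))
      disjoint : AllPairs (λ e f → Empty (e ∩ f)) M
      disjoint = go M M⊆E (AllPairs.zip (AllPairs.map⁻ apart , keys-differ))
        where
        go : ∀ M → All (_∈ˡ E) M → AllPairs (λ e f → ¬ T (meetᵛ B′ (toList e) (toList f)) × key (toList e) ≢ key (toList f)) M →
             AllPairs (λ e f → Empty (e ∩ f)) M
        go []       []         []         = []
        go (e ∷ es) (e∈ ∷ es⊆) (rs ∷ rss) = All.tabulate separate ∷ go es es⊆ rss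
          where
          separate : ∀ {f} → f ∈ˡ es → Empty (e ∩ f)
          separate {f} i (v , v∈) with x∈p∩q⁻ e f v∈ | v ∈? A
          ... | v∈e , v∈f | no v∉A  = proj₁ (All.lookup rs i) (meetsB⁺ e f (x∉p⇒x∈∁p v∉A) v∈e v∈f)
          ... | v∈e , v∈f | yes v∈A = proj₂ (All.lookup rs i)
            (trans (key-edge e∈ v∈A v∈e) (sym (key-edge (All.lookup es⊆ i) v∈A v∈f)))
      covers : ∀ a → a ∈ A → ∃! _≡_ (λ e → e ∈ˡ M × a ∈ e)
      covers a a∈A with ∈-map⁻ key (subst (toList ⁅ a ⁆ ∈ˡ_) (sym keys≡)
                          (subst (_∈ˡ keys) (key-singleton a∈A) (∈-map⁺ key (∈-singletons⁺ A a∈A))))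
      ... | e′ , e′∈ , a≡ with ∈-map⁻ toList e′∈
      ...   | e , e∈M , refl = e , (e∈M , a∈e) , same
        where
        a∈e : a ∈ e
        a∈e = key-∈ (sym a≡)
        same : ∀ {f} → f ∈ˡ M × a ∈ f → e ≡ f
        same {f} (f∈M , a∈f) with AllPairs-lookup (λ {x} {y} d → d ∘ subst Nonempty (∩-comm y x)) disjoint e∈M f∈M
        ... | inj₁ eq = eq
        ... | inj₂ d  = contradiction (a , x∈p∩q⁺ (a∈e , a∈f)) d

    Vertices : List (Fin n) → List (List Bool) → Set
    Vertices = Pointwise λ a f → key f ≡ toList ⁅ a ⁆

    vertices : ∀ {M S} → map key M ≡ keys → All (_∈ˡ M) S → ∃[ as ] Vertices as S × All (_∈ A) as
    vertices eq []       = [] , [] , []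
    vertices eq (i ∷ is) =
      let a , a∈A , k = keys⁻ (subst (_ ∈ˡ_) eq (∈-map⁺ key i))
          as , ks , as⊆A = vertices eq is
      in a ∷ as , k ∷ ks , a∈A ∷ as⊆A

    span : List (Fin n) → Subset n
    span as = ⋃ (map ⁅_⁆ as)

    toList-span : ∀ {as S} → Vertices as S → toList (span as) ≡ union A′ S
    toList-span []       = sym (zeros-toList A)
    toList-span {a ∷ as} (k ∷ ks) = trans (sym (toList-zipWith _∨_ ⁅ a ⁆ (span as)))
      (cong₂ _∨ᵛ_ (sym k) (toList-span ks))

    ∈-span⁻ : ∀ as {v} → v ∈ span as → v ∈ˡ as
    ∈-span⁻ as v∈ with ∈-⋃⁻ (map ⁅_⁆ as) v∈
    ... | p , p∈ , v∈p with ∈-map⁻ ⁅_⁆ p∈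
    ...   | a , a∈ , refl = subst (_∈ˡ as) (sym (x∈⁅y⁆⇒x≡y a v∈p)) a∈

    span-⊆ : ∀ {as} → All (_∈ A) as → span as ⊆ A
    span-⊆ {as} as⊆A v∈ = All.lookup as⊆A (∈-span⁻ as v∈)

    vertex-key : ∀ {as S a} → Vertices as S → a ∈ˡ as → ∃[ f ] f ∈ˡ S × key f ≡ toList ⁅ a ⁆
    vertex-key (k ∷ ks) (here refl) = _ , here refl , k
    vertex-key (k ∷ ks) (there i)   = let f , j , l = vertex-key ks i in f , there j , l

    length-span : ∀ {as S} → Vertices as S → AllPairs (λ e f → key e ≢ key f) S → length S ≤ ∣ span as ∣
    length-span []       []         = z≤n
    length-span {a ∷ as} (k ∷ ks) (ne ∷ nes) = ≤-trans (s≤s (length-span ks nes)) (∣⁅i⁆∪p∣ a (span as) a∉)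
      where
      a∉ : a ∉ span as
      a∉ a∈ = let f , i , l = vertex-key ks (∈-span⁻ as a∈) in All.lookup ne i (trans k (sym l))

    hits? : ∀ F R → Dec (R Hits F)
    hits? F R = All.all? (λ e → nonempty? (R ∩ e)) F

    -- An outcome contains the exact value of `τ`, but its encoding shows only `S`. So an exhaustive
    -- search over subsets is harmless: it belongs to the proof and not to the program.
    transversal-number : ∀ F R → R ⊆ B → R Hits F → ∃[ t ] τ⟨ F ⟩≡ t × t ≤ ∣ R ∣
    transversal-number F R R⊆B hits =
      let t , at , t≤ , min = least (λ t → anySubset? λ R → R ⊆? B ×-dec (hits? F R ×-dec ∣ R ∣ ≟ t)) (R , R⊆B , hits , refl)
      in t , record { attained = at ; minimal = λ R R⊆B hits → min (R , R⊆B , hits , refl) } , t≤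

    module Blocked {M S} (keys≡ : map key M ≡ keys) (O : Obstruction M S Budgeted) where
      open Obstruction O

      as : List (Fin n)
      as = proj₁ (vertices keys≡ S⊆M)

      as-S : Vertices as S
      as-S = proj₁ (proj₂ (vertices keys≡ S⊆M))

      as⊆A : All (_∈ A) as
      as⊆A = proj₂ (proj₂ (vertices keys≡ S⊆M))

      xs ys : List (Subset n)
      xs = proj₁ (unmap Xs⊆E)
      ys = proj₁ (unmap Ys⊆E)

      xs≡ : map toList xs ≡ Xs
      xs≡ = proj₁ (proj₂ (unmap Xs⊆E))

      ys≡ : map toList ys ≡ Ys
      ys≡ = proj₁ (proj₂ (unmap Ys⊆E))

      R₁ R : Subset n
      R₁ = ⋃ (map (_∩ B) xs)
      R  = foldr _∪_ R₁ (map (_∩ B) ys)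

      length-xs : length (map (_∩ B) xs) ≡ length Xs
      length-xs = trans (length-map (_∩ B) xs) (trans (sym (length-map toList xs)) (cong length xs≡))

      length-ys : length (map (_∩ B) ys) ≡ length Ys
      length-ys = trans (length-map (_∩ B) ys) (trans (sym (length-map toList ys)) (cong length ys≡))

      size-B : ∀ {es} → All (_∈ˡ E) es → All (λ p → ∣ p ∣ ≤ b) (map (_∩ B) es)
      size-B es⊆E = All.map⁺ (All.map (λ i → ≤-reflexive (uniform-B i)) es⊆E)

      ∣R∣≤ : ∣ R ∣ ≤ b * length Xs + β * length Ys
      ∣R∣≤ = ≤-trans (∣⋃∪∣≤ R₁ (map (_∩ B) ys) (All.map⁺ (All.tabulate touched)))
        (+-mono-≤ (≤-trans (∣⋃∣≤ (map (_∩ B) xs) (size-B (proj₂ (proj₂ (unmap Xs⊆E))))) (≤-reflexive (cong (b *_) length-xs)))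
                  (≤-reflexive (cong (β *_) length-ys)))
        where
        touched : ∀ {y} → y ∈ˡ ys → ∣ y ∩ B ∣ ≤ suc β × ∃[ i ] i ∈ y ∩ B × i ∈ R₁
        touched {y} y∈ with touching (subst (toList y ∈ˡ_) ys≡ (∈-map⁺ toList y∈))
        ... | e , e∈ , m with ∈-map⁻ toList (subst (e ∈ˡ_) (sym xs≡) e∈)
        ...   | x , x∈ , refl = let v , v∈B , v∈y , v∈x = meetsB⁻ y x m in
          ≤-reflexive (uniform-B (All.lookup (proj₂ (proj₂ (unmap Ys⊆E))) y∈)) , v , x∈p∩q⁺ (v∈y , v∈B) ,
          ∈-⋃⁺ (∈-map⁺ (_∩ B) x∈) (x∈p∩q⁺ (v∈x , v∈B))

      R⊆B : R ⊆ B
      R⊆B = foldr∪-⊆ R₁ (map (_∩ B) ys) R₁⊆B (All.map⁺ (All.tabulate λ {y} _ → p∩q⊆q y B))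
        where
        R₁⊆B : R₁ ⊆ B
        R₁⊆B v∈ with ∈-⋃⁻ (map (_∩ B) xs) v∈
        ... | p , p∈ , v∈p with ∈-map⁻ (_∩ B) p∈
        ...   | x , _ , refl = p∩q⊆q x B v∈p

      in-R : ∀ {g v} → toList g ∈ˡ Xs ++ Ys → v ∈ B → v ∈ g → v ∈ R
      in-R {g} {v} i v∈B v∈g with ∈-++⁻ Xs i
      ... | inj₁ j with ∈-map⁻ toList (subst (toList g ∈ˡ_) (sym xs≡) j)
      ...   | x , x∈ , eq = R⊆foldr∪ R₁ (map (_∩ B) ys) (∈-⋃⁺ (∈-map⁺ (_∩ B) x∈)
        (x∈p∩q⁺ (subst (v ∈_) (toList-inj eq) v∈g , v∈B)))
      in-R {g} {v} i v∈B v∈g | inj₂ j with ∈-map⁻ toList (subst (toList g ∈ˡ_) (sym ys≡) j)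
      ...   | y , y∈ , eq = ∈-foldr∪⁺ R₁ (map (_∩ B) ys) (∈-map⁺ (_∩ B) y∈)
        (x∈p∩q⁺ (subst (v ∈_) (toList-inj eq) v∈g , v∈B))

      hits : R Hits E⟨ span as ⟩
      hits = All.tabulate hit
        where
        hit : ∀ {e} → e ∈ˡ E⟨ span as ⟩ → Nonempty (R ∩ e)
        hit {e} i =
          let e∈E , one = ∈-filter⁻ (λ e → ∣ e ∩ span as ∣ ≟ 1) {xs = E} i
              v , v∈ = ∣p∣>0⇒nonempty (e ∩ span as) (≤-reflexive (sym one))
              v∈e , v∈S = x∈p∩q⁻ e (span as) v∈
              f , f∈S , k = vertex-key as-S (∈-span⁻ as v∈S)
              g , g∈ , t = cover (∈-map⁺ toList e∈E)
                (Any.map (λ { refl → trans (key-edge e∈E (span-⊆ as⊆A v∈S) v∈e) (sym k) }) f∈S)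
          in met g∈ t (unlist g∈)
          where
          unlist : ∀ {g} → g ∈ˡ Xs ++ Ys → ∃[ g′ ] g ≡ toList g′
          unlist i with ∈-++⁻ Xs i
          ... | inj₁ j = let g′ , _ , eq = ∈-map⁻ toList (subst (_ ∈ˡ_) (sym xs≡) j) in g′ , eq
          ... | inj₂ j = let g′ , _ , eq = ∈-map⁻ toList (subst (_ ∈ˡ_) (sym ys≡) j) in g′ , eq
          met : ∀ {g} → g ∈ˡ Xs ++ Ys → T (meetᵛ B′ (toList e) g) → ∃[ g′ ] g ≡ toList g′ → Nonempty (R ∩ e)
          met g∈ t (g′ , refl) = let v , v∈B , v∈e , v∈g = meetsB⁻ e g′ t in v , x∈p∩q⁺ (in-R g∈ v∈B v∈g , v∈e)

      large : ∃[ s ] ∣ span as ∣ ≡ suc s × m * ∣ R ∣ ≤ gapBound m β * s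
      large with ∣ span as ∣ | length-span as-S distinct | Obstruction.sized O
      ... | zero  | l | s′ , eq , _  = contradiction (subst (_≤ 0) eq l) λ ()
      -- The budget is stated for the length of `S`. By `length-span` this is at most the size of
      -- `span as`, and the bound is increasing in it.
      ... | suc s | l | s′ , eq , le = s , refl , ≤-trans (*-monoʳ-≤ m ∣R∣≤)
        (≤-trans le (*-monoʳ-≤ (gapBound m β) (s≤s⁻¹ (subst (_≤ suc s) eq l))))

    module _ (ε : ℝ) (bound-ε : ∀ β t s → m * t ≤ suc (m * (2 * β + 1)) * s →
                fromℕ t ≤ᵣ (fromℤ (ℤ.+ (2 * suc (suc β)) ℤ.- ℤ.+ 3) +ᵣ ε) ·ᵣ (ℤ.+ suc s ℤ.- ℤ.+ 1)) where

      outcome : ∀ {o} → Solved keys Budgeted o → Σ[ out ∈ Outcome ε H ] encodeOutcome out ≡ decode A′ o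
      outcome (perfect {M} M⊆E′ apart keys≡) with unmap M⊆E′
      ... | Ms , refl , Ms⊆E = matching Ms (perfect-matching Ms Ms⊆E apart keys≡) , refl
      outcome (blocked {M} {S} keys≡ O) =
        let t , τ≡ , t≤ = transversal-number E⟨ span as ⟩ R R⊆B hits
            s , eq , le = large
        in witness (span as) (span-⊆ as⊆A) t τ≡
             (subst (λ k → fromℕ t ≤ᵣ (fromℤ (ℤ.+ (2 * suc (suc β)) ℤ.- ℤ.+ 3) +ᵣ ε) ·ᵣ (ℤ.+ k ℤ.- ℤ.+ 1)) (sym eq)
               (bound-ε β t s (≤-trans (*-monoʳ-≤ m t≤) le))) ,
           cong inj₂ (toList-span as-S)
        where open Blocked keys≡ O

-- The code is taken in its own context by the identity renaming. The size of the input bounds all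
-- lengths of lists in it, so the time polynomial may be evaluated at the size.
polynomial-time : ∀ {r} {ε : ℝ} {f} (F : Impl (inputTy ∷ []) outputTy f) →
  ((H : BipartiteHypergraph r) → Σ[ o ∈ Outcome ε H ] encodeOutcome o ≡ f (encode H ∷ [])) →
  Σ[ 𝒜 ∈ Program inputTy outputTy ] Σ[ c ∈ ℕ ] Σ[ k ∈ ℕ ]
    ((H : BipartiteHypergraph r) → Σ[ o ∈ Outcome ε H ] Σ[ t ∈ ℕ ]
      (𝒜 on encode H yields encodeOutcome o inTime t) × t ≤ c * size inputTy (encode H) ^ k + c)
polynomial-time F solve = code F (λ i → i) , 3 ^ deg (time F) , deg (time F) , λ H →
  let o , o≡ = solve H
      t , t≤ , run-t = run F (λ i → i) {encode H ∷ []} (λ _ → refl) (Bounded-size inputTy (encode H) ∷ [])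
  in o , t , subst (λ y → code F (λ i → i) on encode H yields y inTime t) (sym o≡) run-t ,
     ≤-trans t≤ (⟪⟫-bound (time F) (size inputTy (encode H)))

theorem5p4 : (ε : ℝ) → fromℕ 0 <ᵣ ε → (r : ℕ) → 2 ≤ r →
    Σ[ 𝒜 ∈ Program inputTy outputTy ] Σ[ c ∈ ℕ ] Σ[ k ∈ ℕ ]
    ((H : BipartiteHypergraph r) →
    Σ[ o ∈ Outcome ε H ] Σ[ t ∈ ℕ ]
    (𝒜 on encode H yields encodeOutcome o inTime t) ×
    t ≤ c * size inputTy (encode H) ^ k + c)
theorem5p4 ε ε>0 (suc (suc β)) (s≤s (s≤s z≤n)) with witness-bound ε ε>0
... | m , m≢0 , bound-ε = polynomial-time (Implementation.resultI U p q fuelₚ) λ H →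
  Search.outcome H ε bound-ε (Search.solved H)
  where
  open Parameters β m {{m≢0}}
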